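{- For every integer $t$ with $1\leq t\leq 6$ we have $\frac{t}{6}\Lambda^{(3)}\subseteq\Pi^{(3)}_{\mathrm{vvv},\infty}$, where $\frac{t}{6}\Lambda^{(3)}=\{\frac{t}{6}\Lambda_F : F\text{ is a }3\text{ -graph}\}$. That is, for every $3$-graph $F$ with Lagrangian $\Lambda_F$ there is a family $\mathcal{F}$ of $3$-graphs with $\pi_{\mathrm{vvv}}(\mathcal{F})=\frac{t}{6}\Lambda_F$.
   Context: A $3$-graph $H=(V,E)$ consists of a finite vertex set $V$ and an edge set $E\subseteq V^{(3)}$, where $U^{(k)}=\{e\subseteq U : |e|=k\}$ for a set $U$. A family of $3$-graphs is a (possibly infinite) set of $3$-graphs; $H$ is $\mathcal{F}$-free if it contains no member of $\mathcal{F}$ as a (not necessarily induced) subhypergraph. For $d\in[0,1]$ and $\eta>0$, a $3$-graph $H=(V,E)$ is uniformly $(d,\eta)$-dense if $|U^{(3)}\cap E|\geq d\binom{|U|}{3}-\eta|V|^3$ for every $U\subseteq V$. For a family $\mathcal{F}$ of $3$-graphs, the uniform Turán density $\pi_{\mathrm{vvv}}(\mathcal{F})$ is the supremum of all $d\in[0,1]$ such that for every $\eta>0$ and every $n\in\mathbb{N}$ there is an $\mathcal{F}$-free, uniformly $(d,\eta)$-dense $3$-graph $H$ with $|V(H)|\geq n$. Set $\Pi^{(3)}_{\mathrm{vvv},\infty}=\{\pi_{\mathrm{vvv}}(\mathcal{F}) : \mathcal{F}\text{ is a family of }3\text{ -graphs}\}$. Let $\mathbb{S}_r=\{(x_1,\dots,x_r)\in[0,1]^r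 : x_1+\dots+x_r=1\}$. For a $3$-graph $F=(V,E)$ on $r$ vertices, with $V$ identified with $[r]=\{1,\dots,r\}$, the Lagrange polynomial is $\lambda_F(x_1,\dots,x_r)=3!\sum_{\{i_1,i_2,i_3\}\in E}x_{i_1}x_{i_2}x_{i_3}$ and the Lagrangian is $\Lambda_F=\max_{\mathbf{x}\in\mathbb{S}_r}\lambda_F(\mathbf{x})$. Set $\Lambda^{(3)}=\{\Lambda_F : F\text{ is a }3\text{ -graph}\}$. -}

module Defs where

open import Level using (0ℓ) renaming (suc to lsuc)
open import Data.Bool.Base using (Bool; T)
open import Data.Bool.Properties using (T?)
open import Data.Fin.Base using (Fin)
open import Data.Fin.Subset
  using (Subset; inside; outside; ∣_∣; ⁅_⁆; ⋃) renaming (_⊆_ to _⊆ˢ_)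
open import Data.Fin.Subset.Properties using (_∈?_; _⊆?_)
open import Data.Integer.Base using (+_)
open import Data.List.Base as List using (List; []; _∷_; _++_; filter; length; allFin)
open import Data.Nat.Base as ℕ using (ℕ; _⊔_; _^_; _!)
import Data.Nat.Properties as ℕ
open import Data.Nat.Combinatorics using (_C_)
open import Data.Product.Base using (Σ-syntax; ∃-syntax; _×_; _,_)
open import Data.Rational.Base as ℚ using (ℚ; 0ℚ; 1ℚ; ½)
import Data.Rational.Properties as ℚ
open import Data.Rational.Solver using (module +-*-Solver)
open import Data.Vec.Base using ([]; _∷_)
open import Function.Base using (_∘_)
open import Function.Definitions using (Injective)
open import Relation.Binary.PropositionalEquality
open import Relation.Nullary.Negation.Core using (¬_)
open import Relation.Unary using (Pred; _∈_)

open +-*-Solver using (solve; _:+_; _:*_; _:-_; :-_; _:=_; con)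

------------------------------------------------------------------------
-- Real numbers: Cauchy sequences of rationals, compared by _≃ℝ_.

IsCauchy : (ℕ → ℚ) → Set
IsCauchy s = ∀ ε → 0ℚ ℚ.< ε →
  ∃[ N ] (∀ m n → N ℕ.≤ m → N ℕ.≤ n → ℚ.∣ s m ℚ.- s n ∣ ℚ.< ε)

record ℝ : Set where
  constructor mkℝ
  field
    seq    : ℕ → ℚ
    cauchy : IsCauchy seq

open ℝ public

infix 4 _≤ℝ_ _<ℝ_ _≃ℝ_

_≤ℝ_ : ℝ → ℝ → Set
x ≤ℝ y = ∀ ε → 0ℚ ℚ.< ε → ∃[ N ] (∀ n → N ℕ.≤ n → seq x n ℚ.≤ seq y n ℚ.+ ε)

_<ℝ_ : ℝ → ℝ → Set
x <ℝ y = ∃[ ε ] (0ℚ ℚ.< ε × ∃[ N ] (∀ n → N ℕ.≤ n → seq x n ℚ.+ ε ℚ.≤ seq y n))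

_≃ℝ_ : ℝ → ℝ → Set
x ≃ℝ y = x ≤ℝ y × y ≤ℝ x

private
  half-pos : ∀ {ε} → 0ℚ ℚ.< ε → 0ℚ ℚ.< ½ ℚ.* ε
  half-pos {ε} ε>0 = ℚ.positive⁻¹ (½ ℚ.* ε)
    where instance
      _ : ℚ.Positive (½ ℚ.* ε)
      _ = ℚ.pos*pos⇒pos ½ ε {{ℚ.positive ε>0}}

  half+half : ∀ ε → ½ ℚ.* ε ℚ.+ ½ ℚ.* ε ≡ ε
  half+half = solve 1 (λ e → con ½ :* e :+ con ½ :* e := e) refl

  const-cauchy : ∀ q → IsCauchy (λ _ → q)
  const-cauchy q ε ε>0 = 0 , λ _ _ _ _ →
    subst (ℚ._< ε) (sym (cong ℚ.∣_∣ (ℚ.+-inverseʳ q))) ε>0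

  +-cauchy : ∀ {s t} → IsCauchy s → IsCauchy t → IsCauchy (λ n → s n ℚ.+ t n)
  +-cauchy {s} {t} cs ct ε ε>0 with cs _ (half-pos ε>0) | ct _ (half-pos ε>0)
  ... | M , p | N , q = M ⊔ N , λ m n m≥ n≥ → begin-strict
    ℚ.∣ (s m ℚ.+ t m) ℚ.- (s n ℚ.+ t n) ∣
      ≡⟨ cong ℚ.∣_∣ (regroup (s m) (t m) (s n) (t n)) ⟩
    ℚ.∣ (s m ℚ.- s n) ℚ.+ (t m ℚ.- t n) ∣
      ≤⟨ ℚ.∣p+q∣≤∣p∣+∣q∣ (s m ℚ.- s n) (t m ℚ.- t n) ⟩
    ℚ.∣ s m ℚ.- s n ∣ ℚ.+ ℚ.∣ t m ℚ.- t n ∣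
      <⟨ ℚ.+-mono-< (p m n (ℕ.m⊔n≤o⇒m≤o M N m≥) (ℕ.m⊔n≤o⇒m≤o M N n≥))
                    (q m n (ℕ.m⊔n≤o⇒n≤o M N m≥) (ℕ.m⊔n≤o⇒n≤o M N n≥)) ⟩
    ½ ℚ.* ε ℚ.+ ½ ℚ.* ε
      ≡⟨ half+half ε ⟩
    ε ∎
    where
    open ℚ.≤-Reasoning
    regroup : ∀ a b c d → (a ℚ.+ b) ℚ.- (c ℚ.+ d) ≡ (a ℚ.- c) ℚ.+ (b ℚ.- d)
    regroup = solve 4 (λ a b c d → (a :+ b) :- (c :+ d) := (a :- c) :+ (b :- d)) refl

  neg-cauchy : ∀ {s} → IsCauchy s → IsCauchy (λ n → ℚ.- s n)
  neg-cauchy {s} cs ε ε>0 with cs ε ε>0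
  ... | N , p = N , λ m n m≥ n≥ →
    subst (ℚ._< ε) (cong ℚ.∣_∣ (flip (s n) (s m))) (p n m n≥ m≥)
    where
    flip : ∀ a b → a ℚ.- b ≡ (ℚ.- b) ℚ.- (ℚ.- a)
    flip = solve 2 (λ a b → a :- b := (:- b) :- (:- a)) refl

  eventually-bounded : ∀ {s} → IsCauchy s →
    ∃[ B ] (0ℚ ℚ.< B × ∃[ N ] (∀ n → N ℕ.≤ n → ℚ.∣ s n ∣ ℚ.≤ B))
  eventually-bounded {s} cs with cs 1ℚ (ℚ.positive⁻¹ 1ℚ)
  ... | N , p = 1ℚ ℚ.+ ℚ.∣ s N ∣
    , ℚ.+-mono-<-≤ (ℚ.positive⁻¹ 1ℚ) (ℚ.0≤∣p∣ (s N))
    , N , λ n n≥ → begin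
    ℚ.∣ s n ∣                            ≡⟨ cong ℚ.∣_∣ (split (s n) (s N)) ⟩
    ℚ.∣ (s n ℚ.- s N) ℚ.+ s N ∣          ≤⟨ ℚ.∣p+q∣≤∣p∣+∣q∣ (s n ℚ.- s N) (s N) ⟩
    ℚ.∣ s n ℚ.- s N ∣ ℚ.+ ℚ.∣ s N ∣      ≤⟨ ℚ.+-monoˡ-≤ ℚ.∣ s N ∣ (ℚ.<⇒≤ (p n N n≥ ℕ.≤-refl)) ⟩
    1ℚ ℚ.+ ℚ.∣ s N ∣                     ∎
    where
    open ℚ.≤-Reasoning
    split : ∀ a b → a ≡ (a ℚ.- b) ℚ.+ b
    split = solve 2 (λ a b → a := (a :- b) :+ b) refl

  -- For B > 0 and ε > 0 there is δ > 0 with B δ = ε.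
  divide : ∀ {B ε} → 0ℚ ℚ.< B → 0ℚ ℚ.< ε → ∃[ δ ] (0ℚ ℚ.< δ × B ℚ.* δ ≡ ε)
  divide {B} {ε} B>0 ε>0 = B⁻¹ ℚ.* ε , ℚ.positive⁻¹ (B⁻¹ ℚ.* ε) , (begin
    B ℚ.* (B⁻¹ ℚ.* ε)   ≡⟨ ℚ.*-assoc B B⁻¹ ε ⟨
    (B ℚ.* B⁻¹) ℚ.* ε   ≡⟨ cong (ℚ._* ε) (ℚ.*-inverseʳ B) ⟩
    1ℚ ℚ.* ε            ≡⟨ ℚ.*-identityˡ ε ⟩
    ε                   ∎)
    where
    open ≡-Reasoning
    instance
      B-pos : ℚ.Positive B
      B-pos = ℚ.positive B>0
      B-nonZero : ℚ.NonZero B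
      B-nonZero = ℚ.pos⇒nonZero B
    B⁻¹ : ℚ
    B⁻¹ = ℚ.1/ B
    instance
      _ : ℚ.Positive (B⁻¹ ℚ.* ε)
      _ = ℚ.pos*pos⇒pos B⁻¹ {{ℚ.1/pos⇒pos B}} ε {{ℚ.positive ε>0}}

  ∣*∣-bound : ∀ {B δ} a b → 0ℚ ℚ.< B → ℚ.∣ a ∣ ℚ.≤ B → ℚ.∣ b ∣ ℚ.< δ →
              ℚ.∣ a ℚ.* b ∣ ℚ.< B ℚ.* δ
  ∣*∣-bound {B} {δ} a b B>0 a≤B b<δ = begin-strict
    ℚ.∣ a ℚ.* b ∣          ≡⟨ ℚ.∣p*q∣≡∣p∣*∣q∣ a b ⟩
    ℚ.∣ a ∣ ℚ.* ℚ.∣ b ∣    ≤⟨ ℚ.*-monoʳ-≤-nonNeg ℚ.∣ b ∣ {{ℚ.∣-∣-nonNeg b}} a≤B ⟩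
    B ℚ.* ℚ.∣ b ∣          <⟨ ℚ.*-monoʳ-<-pos B {{ℚ.positive B>0}} b<δ ⟩
    B ℚ.* δ                ∎
    where open ℚ.≤-Reasoning

  *-close : ∀ {A B δ γ} s t s′ t′ → 0ℚ ℚ.< A → 0ℚ ℚ.< B →
            ℚ.∣ s ∣ ℚ.≤ A → ℚ.∣ t ℚ.- t′ ∣ ℚ.< δ →
            ℚ.∣ t′ ∣ ℚ.≤ B → ℚ.∣ s ℚ.- s′ ∣ ℚ.< γ →
            ℚ.∣ s ℚ.* t ℚ.- s′ ℚ.* t′ ∣ ℚ.< A ℚ.* δ ℚ.+ B ℚ.* γ
  *-close {A} {B} {δ} {γ} s t s′ t′ A>0 B>0 s≤A t-t′ t′≤B s-s′ = begin-strict
    ℚ.∣ s ℚ.* t ℚ.- s′ ℚ.* t′ ∣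
      ≡⟨ cong ℚ.∣_∣ (regroup s t s′ t′) ⟩
    ℚ.∣ s ℚ.* (t ℚ.- t′) ℚ.+ t′ ℚ.* (s ℚ.- s′) ∣
      ≤⟨ ℚ.∣p+q∣≤∣p∣+∣q∣ (s ℚ.* (t ℚ.- t′)) (t′ ℚ.* (s ℚ.- s′)) ⟩
    ℚ.∣ s ℚ.* (t ℚ.- t′) ∣ ℚ.+ ℚ.∣ t′ ℚ.* (s ℚ.- s′) ∣
      <⟨ ℚ.+-mono-< (∣*∣-bound s (t ℚ.- t′) A>0 s≤A t-t′)
                    (∣*∣-bound t′ (s ℚ.- s′) B>0 t′≤B s-s′) ⟩
    A ℚ.* δ ℚ.+ B ℚ.* γ ∎
    where
    open ℚ.≤-Reasoning
    regroup : ∀ a b c d →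
      a ℚ.* b ℚ.- c ℚ.* d ≡ a ℚ.* (b ℚ.- d) ℚ.+ d ℚ.* (a ℚ.- c)
    regroup = solve 4
      (λ a b c d → a :* b :- c :* d := a :* (b :- d) :+ d :* (a :- c)) refl

  *-cauchy : ∀ {s t} → IsCauchy s → IsCauchy t → IsCauchy (λ n → s n ℚ.* t n)
  *-cauchy {s} {t} cs ct ε ε>0 =
    let A , A>0 , K , s≤A = eventually-bounded {s} cs
        B , B>0 , L , t≤B = eventually-bounded {t} ct
        δ , δ>0 , Aδ≡     = divide A>0 (half-pos ε>0)
        γ , γ>0 , Bγ≡     = divide B>0 (half-pos ε>0)
        M , p             = ct δ δ>0
        N , q             = cs γ γ>0
    in (K ⊔ L) ⊔ (M ⊔ N) , λ m n m≥ n≥ →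
      let KL≤m = ℕ.m⊔n≤o⇒m≤o (K ⊔ L) (M ⊔ N) m≥
          KL≤n = ℕ.m⊔n≤o⇒m≤o (K ⊔ L) (M ⊔ N) n≥
          MN≤m = ℕ.m⊔n≤o⇒n≤o (K ⊔ L) (M ⊔ N) m≥
          MN≤n = ℕ.m⊔n≤o⇒n≤o (K ⊔ L) (M ⊔ N) n≥
      in subst (ℚ.∣ s m ℚ.* t m ℚ.- s n ℚ.* t n ∣ ℚ.<_)
           (trans (cong₂ ℚ._+_ Aδ≡ Bγ≡) (half+half ε))
           (*-close (s m) (t m) (s n) (t n) A>0 B>0
             (s≤A m (ℕ.m⊔n≤o⇒m≤o K L KL≤m))
             (p m n (ℕ.m⊔n≤o⇒m≤o M N MN≤m) (ℕ.m⊔n≤o⇒m≤o M N MN≤n))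
             (t≤B n (ℕ.m⊔n≤o⇒n≤o K L KL≤n))
             (q m n (ℕ.m⊔n≤o⇒n≤o M N MN≤m) (ℕ.m⊔n≤o⇒n≤o M N MN≤n)))

fromℚ : ℚ → ℝ
fromℚ q = mkℝ (λ _ → q) (const-cauchy q)

fromℕ : ℕ → ℝ
fromℕ n = fromℚ (+ n ℚ./ 1)

0ℝ 1ℝ : ℝ
0ℝ = fromℚ 0ℚ
1ℝ = fromℚ 1ℚ

infixl 6 _+ℝ_ _-ℝ_
infixl 7 _*ℝ_
infix  8 -ℝ_

_+ℝ_ : ℝ → ℝ → ℝ
x +ℝ y = mkℝ (λ n → seq x n ℚ.+ seq y n) (+-cauchy {seq x} {seq y} (cauchy x) (cauchy y))

-ℝ_ : ℝ → ℝ
-ℝ x = mkℝ (λ n → ℚ.- seq x n) (neg-cauchy {seq x} (cauchy x))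

_-ℝ_ : ℝ → ℝ → ℝ
x -ℝ y = x +ℝ (-ℝ y)

_*ℝ_ : ℝ → ℝ → ℝ
x *ℝ y = mkℝ (λ n → seq x n ℚ.* seq y n) (*-cauchy {seq x} {seq y} (cauchy x) (cauchy y))

sumℝ productℝ : List ℝ → ℝ
sumℝ     = List.foldr _+ℝ_ 0ℝ
productℝ = List.foldr _*ℝ_ 1ℝ

[0,1] : Pred ℝ 0ℓ
[0,1] x = 0ℝ ≤ℝ x × x ≤ℝ 1ℝ

-- The least upper bound in ℝ; in particular the empty set has no supremum.
IsSupremum : Pred ℝ 0ℓ → Pred ℝ 0ℓ
IsSupremum D s = (∀ d → d ∈ D → d ≤ℝ s) × (∀ b → (∀ d → d ∈ D → d ≤ℝ b) → s ≤ℝ b)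

infixr 7 _·_

_·_ : ∀ {ℓ} → ℝ → Pred ℝ ℓ → Pred ℝ ℓ
(c · A) y = Σ[ x ∈ ℝ ] (x ∈ A × y ≃ℝ c *ℝ x)

------------------------------------------------------------------------
-- 3-graphs, up to labelling of the vertices by Fin order.

record 3-Graph : Set where
  field
    order   : ℕ
    edge    : Subset order → Bool
    uniform : ∀ e → T (edge e) → ∣ e ∣ ≡ 3

open 3-Graph public

subsets : ∀ n → List (Subset n)
subsets ℕ.zero    = [] ∷ []
subsets (ℕ.suc n) =
  List.map (outside ∷_) (subsets n) ++ List.map (inside ∷_) (subsets n)

edges : (H : 3-Graph) → List (Subset (order H))
edges H = filter (λ e → T? (edge H e)) (subsets (order H))

elements : ∀ {n} → Subset n → List (Fin n)
elements e = filter (_∈? e) (allFin _)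

image : ∀ {m n} → (Fin m → Fin n) → Subset m → Subset n
image f e = ⋃ (List.map (⁅_⁆ ∘ f) (elements e))

-- F is a (not necessarily induced) subhypergraph of H, up to isomorphism.
_⊑_ : 3-Graph → 3-Graph → Set
F ⊑ H = Σ[ f ∈ (Fin (order F) → Fin (order H)) ]
  (Injective _≡_ _≡_ f × (∀ e → T (edge F e) → T (edge H (image f e))))

Family : Set₁
Family = Pred 3-Graph 0ℓ

_IsFree_ : 3-Graph → Family → Set
H IsFree 𝓕 = ∀ F → F ∈ 𝓕 → ¬ (F ⊑ H)

------------------------------------------------------------------------
-- Uniform Turán density

-- |U⁽³⁾ ∩ E|
edgesWithin : (H : 3-Graph) → Subset (order H) → ℕ
edgesWithin H U = length (filter (_⊆? U) (edges H))

UniformlyDense : ℝ → ℝ → 3-Graph → Set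
UniformlyDense d η H = ∀ (U : Subset (order H)) →
  d *ℝ fromℕ (∣ U ∣ C 3) -ℝ η *ℝ fromℕ (order H ^ 3) ≤ℝ fromℕ (edgesWithin H U)

AttainableDensity : Family → Pred ℝ 0ℓ
AttainableDensity 𝓕 d = d ∈ [0,1] ×
  (∀ η → 0ℝ <ℝ η → ∀ n →
    Σ[ H ∈ 3-Graph ] (H IsFree 𝓕 × UniformlyDense d η H × n ℕ.≤ order H))

-- π is the uniform Turán density of 𝓕.
Isπᵥᵥᵥ : Family → Pred ℝ 0ℓ
Isπᵥᵥᵥ 𝓕 π = IsSupremum (AttainableDensity 𝓕) π

Πᵥᵥᵥ,∞ : Pred ℝ (lsuc 0ℓ)
Πᵥᵥᵥ,∞ π = Σ[ 𝓕 ∈ Family ] Isπᵥᵥᵥ 𝓕 π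

------------------------------------------------------------------------
-- Lagrangians

Simplex : ∀ r → Pred (Fin r → ℝ) 0ℓ
Simplex r x = (∀ i → x i ∈ [0,1]) × sumℝ (List.map x (allFin r)) ≃ℝ 1ℝ

lagrangePolynomial : (F : 3-Graph) → (Fin (order F) → ℝ) → ℝ
lagrangePolynomial F x =
  fromℕ (3 !) *ℝ sumℝ (List.map (λ e → productℝ (List.map x (elements e))) (edges F))

-- Λ is the maximum of the Lagrange polynomial, attained on the simplex.  The
-- simplex is empty when F has no vertices, so that F has no Lagrangian.
IsLagrangian : 3-Graph → Pred ℝ 0ℓ
IsLagrangian F Λ =
  (Σ[ x ∈ (Fin (order F) → ℝ) ] (x ∈ Simplex (order F) × lagrangePolynomial F x ≃ℝ Λ)) ×
  (∀ x → x ∈ Simplex (order F) → lagrangePolynomial F x ≤ℝ Λ)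

Λ⁽³⁾ : Pred ℝ 0ℓ
Λ⁽³⁾ Λ = Σ[ F ∈ 3-Graph ] IsLagrangian F Λ

{-# OPTIONS --safe #-}

-- Ordering the vertices of each edge of F in t of the six possible ways turns F into a palette
-- P: a set of colour triples whose density polynomial is (t/6) λ_F.  The family consists of the
-- 3-graphs that have no vertex ordering and pair colouring for which every edge i < j < k has
-- (c ij , c ik , c jk) in P.
--
-- Lower bound: a quasirandom pair colouring in which colour a has frequency x a yields a
-- colourable 3-graph of uniform density P(x), for every rational x in the simplex.
--
-- Upper bound: cut the ordering of a dense colourable 3-graph into many intervals and start from
-- the uniform measures on them.  Wherever two measures are irregular for a colour, multiplying
-- them by 1 ± f and 1 ± g increases the energy for some choice of signs, so boundedly many steps
-- make all pairs regular while each measure stays bounded by a constant times its interval's.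
-- By Ramsey's theorem, many of the measures have pairwise colour densities close to a single
-- point x of the simplex, and triangle counting bounds the edge density of their average by P(x)
-- up to a small error.  Uniform density extends from vertex sets to weights because the edge
-- polynomial is multilinear, so this average cannot be sparser than d.

module Submission where

open import Defs
open import Data.Nat.Base using (ℕ; _≤_; _<ᵇ_)
open import Data.Integer.Base using (+_)
open import Data.Rational.Base using (_/_)
open import Relation.Unary using (_⊆_)

open import Level using (0ℓ)
open import Algebra.Bundles using (CommutativeRing)
open import Data.Bool.Base using (Bool; true; false; T; _∧_; not; if_then_else_)
open import Data.Bool.ListAction using (any)
open import Data.Bool.Properties using (T?; T-≡) renaming (_≟_ to _≟ᵇ_)
open import Data.Empty using (⊥; ⊥-elim)
open import Data.Fin.Base as Fin using (Fin; zero; suc; toℕ)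
import Data.Fin.Properties as Fin
open import Data.Fin.Subset as Subset
  using (Subset; inside; outside; ∣_∣; ⁅_⁆; ⋃; _∪_) renaming (_⊆_ to _⊆ˢ_; _∈_ to _∈ˢ_; ⊥ to ∅ˢ)
import Data.Fin.Subset.Properties as Subset
open import Data.List.Base as List using (List; []; _∷_; _++_; length; allFin)
import Data.List.Properties as List
open import Data.List.Membership.Propositional using () renaming (_∈_ to _∈ᴸ_)
open import Data.List.Membership.Propositional.Properties using (∈-filter⁺; ∈-filter⁻; ∈-allFin)
open import Data.List.Relation.Unary.Any using (here; there)
open import Data.List.Relation.Unary.All as All using (All; []; _∷_)
open import Data.List.Relation.Unary.AllPairs as AllPairs using (AllPairs; []; _∷_)
import Data.List.Relation.Unary.All.Properties as All
import Data.List.Relation.Unary.AllPairs.Properties as AllPairs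
open import Data.List.Relation.Binary.Sublist.Propositional as Sublist using ([]; _∷_; _∷ʳ_) renaming (_⊆_ to _⊆ᴸ_)
import Data.List.Relation.Binary.Sublist.Propositional.Properties as Sublist
import Data.Integer.Base as ℤ
import Data.Integer.Properties as ℤ
import Data.Nat.Base as ℕ
import Data.Nat.Properties as ℕ
open import Data.Nat.Combinatorics using (_C_; nCk≡nC[n∸k]; nCn≡1; nCk+nC[k+1]≡[n+1]C[k+1])
import Data.Nat.DivMod as ℕ
open import Data.Product.Base using (Σ-syntax; ∃-syntax; _×_; _,_; proj₁; proj₂)
open import Data.Rational.Base as ℚ using (ℚ; 0ℚ; 1ℚ; ½; _+_; _*_; _-_; -_)
  renaming (_≤_ to _≤ℚ_; _<_ to _<ℚ_)
import Data.Rational.Properties as ℚ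
import Data.Rational.Unnormalised.Base as ℚᵘ
import Data.Rational.Unnormalised.Properties as ℚᵘ
open import Data.Rational.Solver using (module +-*-Solver)
open import Data.Sum.Base as Sum using (_⊎_; inj₁; inj₂)
open import Data.Unit.Base using (tt)
open import Data.Vec.Base using ([]; _∷_; lookup)
open import Data.Vec.Properties using (≡-dec)
open import Function.Base using (_∘_; id; const; case_of_)
open import Function.Bundles using (Equivalence)
open import Function.Definitions using (Injective)
open import Relation.Binary.Definitions using (tri<; tri≈; tri>)
open import Relation.Binary.PropositionalEquality
open import Relation.Nullary.Decidable using (Dec; yes; no; does; ⌊_⌋; _×-dec_; dec-true; dec-false; toWitness; fromWitness)
open import Relation.Nullary.Negation using (¬_; contradiction)
open import Relation.Unary using (Pred; _∈_)

open import Algebra.Properties.Semiring.Sum (CommutativeRing.semiring ℚ.+-*-commutativeRing)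
  using (sum; ∑-distrib-+; ∑-comm; *-distribˡ-sum; sum-cong-≗; sum-replicate-zero)
open +-*-Solver using (solve; _:+_; _:*_; _:-_; :-_; _:=_; con)

-- `edgePolynomial F` is λ_F/6 and each of the six orders contributes one copy of it, which is the
-- origin of the factor t/6. Triangle counting between three intervals yields a product of colour
-- densities of three different pairs; only when the pairs share one distribution x is it the value
-- P(x) that the Lagrangian controls, and this is what Ramsey's theorem is for. The number of
-- intervals must therefore be fixed before regularisation. Refining a partition would destroy that,
-- whereas reweighting a measure changes neither the number of measures nor their order. Hence the
-- constants are chosen in the order tolerance τ, accuracy δ, number R₀ of intervals, number s₁ of
-- steps, peak factor Q, and finally η and n₀. Freeness gives only the double negation of a
-- colouring, and regularity quantifies over all rational test functions, so the upper bound is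
-- derived as a contradiction; real numbers enter only through rational approximations. The
-- quasirandom colouring is explicit: independent coordinates of words take the place of random
-- choices.

private variable
  m n r R : ℕ

-- Indicators and the order of the rationals

infix 4 _≡ᵇ_

_≡ᵇ_ : Fin n → Fin n → Bool
i ≡ᵇ j = does (i Fin.≟ j)

𝟙 : Bool → ℚ
𝟙 true  = 1ℚ
𝟙 false = 0ℚ

0≤1 : 0ℚ ≤ℚ 1ℚ
0≤1 = ℚ.nonNegative⁻¹ 1ℚ

≤-offset : ∀ {p q} c → 0ℚ ≤ℚ c → p + c ≡ q → p ≤ℚ q
≤-offset {p} {q} c 0≤c eq = begin
  p       ≡⟨ ℚ.+-identityʳ p ⟨
  p + 0ℚ  ≤⟨ ℚ.+-monoʳ-≤ p 0≤c ⟩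
  p + c   ≡⟨ eq ⟩
  q       ∎
  where open ℚ.≤-Reasoning

0≤+ : ∀ {p q} → 0ℚ ≤ℚ p → 0ℚ ≤ℚ q → 0ℚ ≤ℚ p + q
0≤+ = ℚ.+-mono-≤

0≤* : ∀ {p q} → 0ℚ ≤ℚ p → 0ℚ ≤ℚ q → 0ℚ ≤ℚ p * q
0≤* {p} {q} 0≤p 0≤q =
  ℚ.nonNegative⁻¹ _ {{ℚ.nonNeg*nonNeg⇒nonNeg p {{ℚ.nonNegative 0≤p}} q {{ℚ.nonNegative 0≤q}}}}

0<* : ∀ {p q} → 0ℚ <ℚ p → 0ℚ <ℚ q → 0ℚ <ℚ p * q
0<* {p} {q} 0<p 0<q =
  ℚ.positive⁻¹ _ {{ℚ.pos*pos⇒pos p {{ℚ.positive 0<p}} q {{ℚ.positive 0<q}}}}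

≤⇒0≤- : ∀ {p q} → p ≤ℚ q → 0ℚ ≤ℚ q - p
≤⇒0≤- {p} {q} p≤q = subst (_≤ℚ q - p) (ℚ.+-inverseʳ p) (ℚ.+-monoˡ-≤ (- p) p≤q)

*-monoˡ : ∀ {p q q′} → 0ℚ ≤ℚ p → q ≤ℚ q′ → p * q ≤ℚ p * q′
*-monoˡ {p} 0≤p = ℚ.*-monoˡ-≤-nonNeg p {{ℚ.nonNegative 0≤p}}

*-monoʳ : ∀ {p q q′} → 0ℚ ≤ℚ p → q ≤ℚ q′ → q * p ≤ℚ q′ * p
*-monoʳ {p} 0≤p = ℚ.*-monoʳ-≤-nonNeg p {{ℚ.nonNegative 0≤p}}

*-mono : ∀ {p q p′ q′} → 0ℚ ≤ℚ p → 0ℚ ≤ℚ q′ → p ≤ℚ p′ → q ≤ℚ q′ → p * q ≤ℚ p′ * q′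
*-mono 0≤p 0≤q′ p≤p′ q≤q′ = ℚ.≤-trans (*-monoˡ 0≤p q≤q′) (*-monoʳ 0≤q′ p≤p′)

*-cancelˡ-≤ : ∀ {p q q′} → 0ℚ <ℚ p → p * q ≤ℚ p * q′ → q ≤ℚ q′
*-cancelˡ-≤ {p} 0<p = ℚ.*-cancelˡ-≤-pos p {{ℚ.positive 0<p}}

0≤square : ∀ p → 0ℚ ≤ℚ p * p
0≤square p with ℚ.≤-total 0ℚ p
... | inj₁ 0≤p = 0≤* 0≤p 0≤p
... | inj₂ p≤0 = subst (0ℚ ≤ℚ_) (solve 1 (λ p → (:- p) :* (:- p) := p :* p) refl p) (0≤* 0≤-p 0≤-p)
  where 0≤-p = ℚ.neg-antimono-≤ p≤0

In01 : Pred ℚ _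
In01 p = 0ℚ ≤ℚ p × p ≤ℚ 1ℚ

01-* : ∀ {p q} → In01 p → In01 q → In01 (p * q)
01-* {p} {q} (0≤p , p≤1) (0≤q , q≤1) =
  0≤* 0≤p 0≤q , subst (p * q ≤ℚ_) (ℚ.*-identityˡ 1ℚ) (*-mono 0≤p 0≤1 p≤1 q≤1)

01-𝟙 : ∀ b → In01 (𝟙 b)
01-𝟙 true  = 0≤1 , ℚ.≤-refl
01-𝟙 false = ℚ.≤-refl , 0≤1

0≤𝟙 : ∀ b → 0ℚ ≤ℚ 𝟙 b
0≤𝟙 b = proj₁ (01-𝟙 b)

𝟙-∧ : ∀ b c → 𝟙 (b ∧ c) ≡ 𝟙 b * 𝟙 c
𝟙-∧ true  c = sym (ℚ.*-identityˡ _)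
𝟙-∧ false c = sym (ℚ.*-zeroˡ (𝟙 c))

𝟙-mono : ∀ {b c} → (T b → T c) → 𝟙 b ≤ℚ 𝟙 c
𝟙-mono {true}  {true}  f = ℚ.≤-refl
𝟙-mono {true}  {false} f = ⊥-elim (f tt)
𝟙-mono {false} {c}     f = 0≤𝟙 c

-- Rational images of natural numbers

opaque
  natℚ : ℕ → ℚ
  natℚ n = + n / 1

  natℚ-def : ∀ n → natℚ n ≡ + n / 1
  natℚ-def n = refl

natᵘ : ℕ → ℚᵘ.ℚᵘ
natᵘ n = ℚᵘ.mkℚᵘ (+ n) 0

toℚᵘ-nat : ∀ n → ℚ.toℚᵘ (natℚ n) ℚᵘ.≃ natᵘ n
toℚᵘ-nat n = subst (λ z → ℚ.toℚᵘ z ℚᵘ.≃ natᵘ n) (sym (natℚ-def n)) (ℚ.toℚᵘ-fromℚᵘ (natᵘ n))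

natℚ-0 : natℚ 0 ≡ 0ℚ
natℚ-0 = natℚ-def 0

natℚ-1 : natℚ 1 ≡ 1ℚ
natℚ-1 = natℚ-def 1

natℚ-+ : ∀ m n → natℚ (m ℕ.+ n) ≡ natℚ m + natℚ n
natℚ-+ m n = ℚ.toℚᵘ-injective (begin
  ℚ.toℚᵘ (natℚ (m ℕ.+ n))                    ≈⟨ toℚᵘ-nat (m ℕ.+ n) ⟩
  natᵘ (m ℕ.+ n)                             ≈⟨ ℚᵘ.*≡* (cong (ℤ._* + 1) (sym (cong₂ ℤ._+_ (ℤ.*-identityʳ (+ m)) (ℤ.*-identityʳ (+ n))))) ⟩
  natᵘ m ℚᵘ.+ natᵘ n                         ≈⟨ ℚᵘ.+-cong (toℚᵘ-nat m) (toℚᵘ-nat n) ⟨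
  ℚ.toℚᵘ (natℚ m) ℚᵘ.+ ℚ.toℚᵘ (natℚ n)       ≈⟨ ℚ.toℚᵘ-homo-+ (natℚ m) (natℚ n) ⟨
  ℚ.toℚᵘ (natℚ m + natℚ n)                   ∎)
  where open ℚᵘ.≃-Reasoning

natℚ-suc : ∀ n → natℚ (ℕ.suc n) ≡ 1ℚ + natℚ n
natℚ-suc n = trans (natℚ-+ 1 n) (cong (_+ natℚ n) natℚ-1)

natℚ-* : ∀ m n → natℚ (m ℕ.* n) ≡ natℚ m * natℚ n
natℚ-* ℕ.zero    n = trans natℚ-0 (sym (trans (cong (_* natℚ n) natℚ-0) (ℚ.*-zeroˡ (natℚ n))))
natℚ-* (ℕ.suc m) n = begin
  natℚ (n ℕ.+ m ℕ.* n)            ≡⟨ natℚ-+ n (m ℕ.* n) ⟩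
  natℚ n + natℚ (m ℕ.* n)         ≡⟨ cong₂ _+_ (refl {x = natℚ n}) (natℚ-* m n) ⟩
  natℚ n + natℚ m * natℚ n        ≡⟨ solve 2 (λ m n → n :+ m :* n := (con 1ℚ :+ m) :* n) refl (natℚ m) (natℚ n) ⟩
  (1ℚ + natℚ m) * natℚ n          ≡⟨ cong (_* natℚ n) (natℚ-suc m) ⟨
  natℚ (ℕ.suc m) * natℚ n         ∎
  where open ≡-Reasoning

0≤nat : ∀ n → 0ℚ ≤ℚ natℚ n
0≤nat ℕ.zero    = ℚ.≤-reflexive (sym natℚ-0)
0≤nat (ℕ.suc n) = subst (0ℚ ≤ℚ_) (sym (natℚ-suc n)) (0≤+ 0≤1 (0≤nat n))

0<nat : ∀ n .{{_ : ℕ.NonZero n}} → 0ℚ <ℚ natℚ n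
0<nat (ℕ.suc n) = subst (0ℚ <ℚ_) (sym (natℚ-suc n)) (ℚ.+-mono-<-≤ (ℚ.positive⁻¹ 1ℚ) (0≤nat n))

natℚ-mono : m ≤ n → natℚ m ≤ℚ natℚ n
natℚ-mono {m} {n} m≤n = ≤-offset (natℚ (n ℕ.∸ m)) (0≤nat (n ℕ.∸ m))
  (trans (sym (natℚ-+ m (n ℕ.∸ m))) (cong natℚ (ℕ.m+[n∸m]≡n m≤n)))

private
  -- The denominator is at least one, so dividing by it does not lift the value above the absolute
  -- numerator.
  ≤∣↥∣ : ∀ p → p ≤ℚ natℚ ℤ.∣ ℚ.numerator p ∣
  ≤∣↥∣ p = ℚ.toℚᵘ-cancel-≤ (ℚᵘ.≤-respʳ-≃ (ℚᵘ.≃-sym (toℚᵘ-nat ℤ.∣ ℚ.numerator p ∣)) (bound p))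
    where
    bound : ∀ p → ℚ.toℚᵘ p ℚᵘ.≤ natᵘ ℤ.∣ ℚ.numerator p ∣
    bound (ℚ.mkℚ (+ a) d-1 _) = ℚᵘ.*≤* (subst₂ ℤ._≤_ (sym (ℤ.*-identityʳ (+ a))) (ℤ.pos-* a (ℕ.suc d-1))
      (ℤ.+≤+ (ℕ.m≤m*n a (ℕ.suc d-1))))
    bound (ℚ.mkℚ ℤ.-[1+ a ] d-1 _) = ℚᵘ.*≤* ℤ.-≤+

opaque
  archimedean : ∀ p → ∃[ N ] p ≤ℚ natℚ N
  archimedean p = ℤ.∣ ℚ.numerator p ∣ , ≤∣↥∣ p

  archimedean* : ∀ {q} p → 0ℚ <ℚ q → ∃[ N ] p ≤ℚ natℚ N * q
  archimedean* {q} p 0<q = N , (begin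
    p                   ≡⟨ solve 1 (λ p → p := p :* con 1ℚ) refl p ⟩
    p * 1ℚ              ≡⟨ cong (p *_) (ℚ.*-inverseˡ q) ⟨
    p * (ℚ.1/ q * q)    ≡⟨ ℚ.*-assoc p (ℚ.1/ q) q ⟨
    p * ℚ.1/ q * q      ≤⟨ *-monoʳ (ℚ.<⇒≤ 0<q) p/q≤N ⟩
    natℚ N * q          ∎)
    where
    open ℚ.≤-Reasoning
    instance
      q≢0 : ℚ.NonZero q
      q≢0 = ℚ.pos⇒nonZero q {{ℚ.positive 0<q}}
    N : ℕ
    N = proj₁ (archimedean (p * ℚ.1/ q))
    p/q≤N : p * ℚ.1/ q ≤ℚ natℚ N
    p/q≤N = proj₂ (archimedean (p * ℚ.1/ q))

-- Finite sums

opaque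
  ∑ : (Fin n → ℚ) → ℚ
  ∑ = sum

  ∑-empty : (f : Fin 0 → ℚ) → ∑ f ≡ 0ℚ
  ∑-empty f = refl

  ∑-suc : (f : Fin (ℕ.suc n) → ℚ) → ∑ f ≡ f zero + ∑ (f ∘ suc)
  ∑-suc f = refl

  ∑-cong : {f g : Fin n → ℚ} → (∀ i → f i ≡ g i) → ∑ f ≡ ∑ g
  ∑-cong = sum-cong-≗

  ∑-+ : (f g : Fin n → ℚ) → ∑ (λ i → f i + g i) ≡ ∑ f + ∑ g
  ∑-+ = ∑-distrib-+

  ∑-swap : (f : Fin m → Fin n → ℚ) → ∑ (λ i → ∑ λ j → f i j) ≡ ∑ (λ j → ∑ λ i → f i j)
  ∑-swap = ∑-comm

  ∑-pull : ∀ c (f : Fin n → ℚ) → ∑ (λ i → c * f i) ≡ c * ∑ f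
  ∑-pull c f = sym (*-distribˡ-sum c f)

  ∑-mono : {f g : Fin n → ℚ} → (∀ i → f i ≤ℚ g i) → ∑ f ≤ℚ ∑ g
  ∑-mono {ℕ.zero}  f≤g = ℚ.≤-refl
  ∑-mono {ℕ.suc n} f≤g = ℚ.+-mono-≤ (f≤g zero) (∑-mono (f≤g ∘ suc))

  0≤∑ : {f : Fin n → ℚ} → (∀ i → 0ℚ ≤ℚ f i) → 0ℚ ≤ℚ ∑ f
  0≤∑ {n} {f} 0≤f = subst (_≤ℚ ∑ f) (sum-replicate-zero n) (∑-mono 0≤f)

  ∑-const : ∀ n c → ∑ {n} (const c) ≡ natℚ n * c
  ∑-const ℕ.zero    c = sym (trans (cong (_* c) natℚ-0) (ℚ.*-zeroˡ c))
  ∑-const (ℕ.suc n) c = begin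
    c + ∑ {n} (const c)    ≡⟨ cong₂ _+_ (refl {x = c}) (∑-const n c) ⟩
    c + natℚ n * c         ≡⟨ solve 2 (λ c n → c :+ n :* c := (con 1ℚ :+ n) :* c) refl c (natℚ n) ⟩
    (1ℚ + natℚ n) * c      ≡⟨ cong (_* c) (natℚ-suc n) ⟨
    natℚ (ℕ.suc n) * c     ∎
    where open ≡-Reasoning

  ∑-bound : {f : Fin n → ℚ} → ∀ c → (∀ i → f i ≤ℚ c) → ∑ f ≤ℚ natℚ n * c
  ∑-bound {n} c f≤c = subst (_ ≤ℚ_) (∑-const n c) (∑-mono f≤c)

  ∑-zero : {f : Fin n → ℚ} → (∀ i → f i ≡ 0ℚ) → ∑ f ≡ 0ℚ
  ∑-zero {n} f≡0 = trans (sum-cong-≗ f≡0) (sum-replicate-zero n)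

  ∑-linear : ∀ c d (f g : Fin n → ℚ) → ∑ (λ i → c * f i + d * g i) ≡ c * ∑ f + d * ∑ g
  ∑-linear c d f g = trans (∑-distrib-+ (λ i → c * f i) (λ i → d * g i)) (cong₂ _+_ (∑-pull c f) (∑-pull d g))

  term≤∑ : {f : Fin n → ℚ} → (∀ i → 0ℚ ≤ℚ f i) → ∀ i → f i ≤ℚ ∑ f
  term≤∑ {f = f} 0≤f zero    = ≤-offset (∑ (f ∘ suc)) (0≤∑ (0≤f ∘ suc)) refl
  term≤∑ {f = f} 0≤f (suc i) = ℚ.≤-trans (term≤∑ (0≤f ∘ suc) i)
    (≤-offset (f zero) (0≤f zero) (ℚ.+-comm (∑ (f ∘ suc)) (f zero)))

  ∑-select : ∀ (i : Fin n) (f : Fin n → ℚ) → ∑ (λ j → 𝟙 (i ≡ᵇ j) * f j) ≡ f i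
  ∑-select zero    f = begin
    1ℚ * f zero + ∑ (λ j → 0ℚ * f (suc j))  ≡⟨ cong₂ _+_ (ℚ.*-identityˡ (f zero)) (∑-zero (λ j → ℚ.*-zeroˡ (f (suc j)))) ⟩
    f zero + 0ℚ                             ≡⟨ ℚ.+-identityʳ (f zero) ⟩
    f zero                                  ∎
    where open ≡-Reasoning
  ∑-select (suc i) f = begin
    0ℚ * f zero + ∑ (λ j → 𝟙 (i ≡ᵇ j) * f (suc j))  ≡⟨ cong₂ _+_ (ℚ.*-zeroˡ (f zero)) (∑-select i (f ∘ suc)) ⟩
    0ℚ + f (suc i)                                  ≡⟨ ℚ.+-identityˡ (f (suc i)) ⟩
    f (suc i)                                       ∎
    where open ≡-Reasoning

-- Sums over the subsets of a finite set

∑ˢ : (Subset n → ℚ) → ℚ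
∑ˢ {ℕ.zero}  g = g []
∑ˢ {ℕ.suc n} g = ∑ˢ (g ∘ (outside ∷_)) + ∑ˢ (g ∘ (inside ∷_))

∑ˢ-cong : {f g : Subset n → ℚ} → (∀ e → f e ≡ g e) → ∑ˢ f ≡ ∑ˢ g
∑ˢ-cong {ℕ.zero}  f≡g = f≡g []
∑ˢ-cong {ℕ.suc n} f≡g = cong₂ _+_ (∑ˢ-cong (f≡g ∘ (outside ∷_))) (∑ˢ-cong (f≡g ∘ (inside ∷_)))

∑ˢ-linear : ∀ c d (f g : Subset n → ℚ) → ∑ˢ (λ e → c * f e + d * g e) ≡ c * ∑ˢ f + d * ∑ˢ g
∑ˢ-linear {ℕ.zero}  c d f g = refl
∑ˢ-linear {ℕ.suc n} c d f g = trans
  (cong₂ _+_ (∑ˢ-linear c d (f ∘ (outside ∷_)) (g ∘ (outside ∷_)))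
             (∑ˢ-linear c d (f ∘ (inside ∷_)) (g ∘ (inside ∷_))))
  (solve 6 (λ c d f f′ g g′ → (c :* f :+ d :* g) :+ (c :* f′ :+ d :* g′) := c :* (f :+ f′) :+ d :* (g :+ g′)) refl
    c d (∑ˢ (f ∘ (outside ∷_))) (∑ˢ (f ∘ (inside ∷_))) (∑ˢ (g ∘ (outside ∷_))) (∑ˢ (g ∘ (inside ∷_))))

∑ˢ-zero : {f : Subset n → ℚ} → (∀ e → f e ≡ 0ℚ) → ∑ˢ f ≡ 0ℚ
∑ˢ-zero {ℕ.zero}  f≡0 = f≡0 []
∑ˢ-zero {ℕ.suc n} f≡0 = cong₂ _+_ (∑ˢ-zero (f≡0 ∘ (outside ∷_))) (∑ˢ-zero (f≡0 ∘ (inside ∷_)))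

∑ˢ-pull : ∀ c (f : Subset n → ℚ) → ∑ˢ (λ e → c * f e) ≡ c * ∑ˢ f
∑ˢ-pull {ℕ.zero}  c f = refl
∑ˢ-pull {ℕ.suc n} c f = trans
  (cong₂ _+_ (∑ˢ-pull c (f ∘ (outside ∷_))) (∑ˢ-pull c (f ∘ (inside ∷_))))
  (sym (ℚ.*-distribˡ-+ c (∑ˢ (f ∘ (outside ∷_))) (∑ˢ (f ∘ (inside ∷_)))))

-- Multilinear forms and their parts of fixed degree

mono : (Fin n → ℚ) → Subset n → ℚ
mono w []            = 1ℚ
mono w (outside ∷ e) = mono (w ∘ suc) e
mono w (inside ∷ e)  = w zero * mono (w ∘ suc) e

indicator : Subset n → Fin n → ℚ
indicator U i = 𝟙 (lookup U i)

-- A polynomial that is affine in every variable attains its minimum over the cube at a vertex.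
multilinear-min : ∀ (κ : Subset n → ℚ) {b} →
  (∀ U → b ≤ℚ ∑ˢ (λ e → κ e * mono (indicator U) e)) →
  ∀ w → (∀ i → In01 (w i)) → b ≤ℚ ∑ˢ (λ e → κ e * mono w e)
multilinear-min {ℕ.zero}  κ {b} vertices w w∈ = vertices []
multilinear-min {ℕ.suc n} κ {b} vertices w w∈ = begin
  b                          ≡⟨ solve 2 (λ t b → b := (con 1ℚ :- t) :* b :+ t :* b) refl t b ⟩
  (1ℚ - t) * b + t * b       ≤⟨ ℚ.+-mono-≤ (*-monoˡ (≤⇒0≤- (proj₂ (w∈ zero))) b≤S₀) (*-monoˡ (proj₁ (w∈ zero)) b≤S₁) ⟩
  (1ℚ - t) * S κ₀ + t * S κ₁ ≡⟨ cong (λ z → (1ℚ - t) * S κ₀ + t * z) S₁≡ ⟩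
  (1ℚ - t) * S κ₀ + t * (S κ₀ + S κᵢ)
    ≡⟨ solve 3 (λ t a c → (con 1ℚ :- t) :* a :+ t :* (a :+ c) := a :+ t :* c) refl t (S κ₀) (S κᵢ) ⟩
  S κ₀ + t * S κᵢ            ≡⟨ cong₂ _+_ (refl {x = S κ₀}) (∑ˢ-pull t (λ e → κᵢ e * mono w′ e)) ⟨
  S κ₀ + ∑ˢ (λ e → t * (κᵢ e * mono w′ e))
    ≡⟨ cong₂ _+_ (refl {x = S κ₀}) (∑ˢ-cong λ e → solve 3 (λ t a c → t :* (a :* c) := a :* (t :* c)) refl t (κᵢ e) (mono w′ e)) ⟩
  S κ₀ + ∑ˢ (λ e → κᵢ e * (t * mono w′ e)) ∎
  where
  open ℚ.≤-Reasoning
  t  = w zero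
  w′ = w ∘ suc
  κ₀ κᵢ κ₁ : Subset n → ℚ
  κ₀ = κ ∘ (outside ∷_)
  κᵢ = κ ∘ (inside ∷_)
  κ₁ e = κ₀ e + κᵢ e
  S : (Subset n → ℚ) → ℚ
  S κ = ∑ˢ (λ e → κ e * mono w′ e)
  b≤S₀ = multilinear-min κ₀ {b} (λ U → subst (b ≤ℚ_)
    (trans (cong₂ _+_ (refl {x = ∑ˢ (λ e → κ₀ e * mono (indicator U) e)})
             (∑ˢ-zero λ e → solve 2 (λ a c → a :* (con 0ℚ :* c) := con 0ℚ) refl (κᵢ e) (mono (indicator U) e)))
           (ℚ.+-identityʳ (∑ˢ λ e → κ₀ e * mono (indicator U) e)))
    (vertices (outside ∷ U))) w′ (w∈ ∘ suc)
  split : ∀ u → ∑ˢ (λ e → κ₁ e * mono u e) ≡ ∑ˢ (λ e → κ₀ e * mono u e) + ∑ˢ (λ e → κᵢ e * mono u e)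
  split u = trans
    (∑ˢ-cong λ e → solve 3 (λ a b c → (a :+ b) :* c := con 1ℚ :* (a :* c) :+ con 1ℚ :* (b :* c)) refl (κ₀ e) (κᵢ e) (mono u e))
    (trans (∑ˢ-linear 1ℚ 1ℚ (λ e → κ₀ e * mono u e) (λ e → κᵢ e * mono u e)) (cong₂ _+_ (ℚ.*-identityˡ (∑ˢ λ e → κ₀ e * mono u e)) (ℚ.*-identityˡ (∑ˢ λ e → κᵢ e * mono u e))))
  S₁≡ = split w′
  b≤S₁ = multilinear-min κ₁ {b} (λ U → subst (b ≤ℚ_)
    (trans (cong₂ _+_ (refl {x = ∑ˢ (λ e → κ₀ e * mono (indicator U) e)})
             (∑ˢ-cong λ e → cong (κᵢ e *_) (ℚ.*-identityˡ (mono (indicator U) e))))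
           (sym (split (indicator U))))
    (vertices (inside ∷ U))) w′ (w∈ ∘ suc)

-- With `g` constantly one this is the elementary symmetric polynomial of degree `k`; with `g` the
-- edge indicator of a 3-graph `F` and `k = 3` it is λ_F/6. At the indicator of a set it counts the
-- selected `k`-subsets of that set.
∑ᵏ : ℕ → (Subset n → ℚ) → (Fin n → ℚ) → ℚ
∑ᵏ k g w = ∑ˢ (λ e → 𝟙 (∣ e ∣ ℕ.≡ᵇ k) * (g e * mono w e))

∑ᵏ-suc : ∀ k (g : Subset (ℕ.suc n) → ℚ) w → ∑ᵏ (ℕ.suc k) g w ≡
  ∑ᵏ (ℕ.suc k) (g ∘ (outside ∷_)) (w ∘ suc) + w zero * ∑ᵏ k (g ∘ (inside ∷_)) (w ∘ suc)
∑ᵏ-suc k g w = cong₂ _+_ (refl {x = ∑ᵏ (ℕ.suc k) (g ∘ (outside ∷_)) (w ∘ suc)}) (trans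
  (∑ˢ-cong λ e → solve 4 (λ a b t c → a :* (b :* (t :* c)) := t :* (a :* (b :* c))) refl
    (𝟙 (∣ e ∣ ℕ.≡ᵇ k)) (g (inside ∷ e)) (w zero) (mono (w ∘ suc) e))
  (∑ˢ-pull (w zero) (λ e → 𝟙 (∣ e ∣ ℕ.≡ᵇ k) * (g (inside ∷ e) * mono (w ∘ suc) e))))

∑ᵏ-0 : ∀ (g : Subset n → ℚ) w → ∑ᵏ 0 g w ≡ g ∅ˢ
∑ᵏ-0 {ℕ.zero}  g w = solve 1 (λ g → con 1ℚ :* (g :* con 1ℚ) := g) refl (g [])
∑ᵏ-0 {ℕ.suc n} g w = trans
  (cong₂ _+_ (∑ᵏ-0 (g ∘ (outside ∷_)) (w ∘ suc)) (∑ˢ-zero λ e → ℚ.*-zeroˡ (g (inside ∷ e) * mono w (inside ∷ e))))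
  (ℚ.+-identityʳ (g ∅ˢ))

∑ᵏ-1 : ∀ (g : Subset n → ℚ) w → ∑ᵏ 1 g w ≡ ∑ (λ i → g ⁅ i ⁆ * w i)
∑ᵏ-1 {ℕ.zero}  g w = trans (ℚ.*-zeroˡ (g [] * 1ℚ)) (sym (∑-empty (λ i → g ⁅ i ⁆ * w i)))
∑ᵏ-1 {ℕ.suc n} g w = begin
  ∑ᵏ 1 g w  ≡⟨ ∑ᵏ-suc 0 g w ⟩
  ∑ᵏ 1 (g ∘ (outside ∷_)) (w ∘ suc) + w zero * ∑ᵏ 0 (g ∘ (inside ∷_)) (w ∘ suc)
    ≡⟨ cong₂ (λ a b → a + w zero * b) (∑ᵏ-1 (g ∘ (outside ∷_)) (w ∘ suc)) (∑ᵏ-0 (g ∘ (inside ∷_)) (w ∘ suc)) ⟩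
  A + w zero * G
    ≡⟨ solve 3 (λ a t b → a :+ t :* b := b :* t :+ a) refl A (w zero) G ⟩
  G * w zero + A  ≡⟨ ∑-suc (λ i → g ⁅ i ⁆ * w i) ⟨
  ∑ (λ i → g ⁅ i ⁆ * w i) ∎
  where
  open ≡-Reasoning
  G = g (inside ∷ ∅ˢ)
  A = ∑ (λ i → g (outside ∷ ⁅ i ⁆) * w (suc i))

private
  drop-zero : {f : Fin (ℕ.suc n) → ℚ} → f zero ≡ 0ℚ → ∑ f ≡ ∑ (f ∘ suc)
  drop-zero {f = f} f0≡0 = trans (∑-suc f) (trans (cong (_+ ∑ (f ∘ suc)) f0≡0) (ℚ.+-identityˡ (∑ (f ∘ suc))))

∑ᵏ-2 : ∀ (g : Subset n → ℚ) w → ∑ᵏ 2 g w ≡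
  ∑ λ i → ∑ λ j → 𝟙 (toℕ i <ᵇ toℕ j) * (g (⁅ i ⁆ ∪ ⁅ j ⁆) * (w i * w j))
∑ᵏ-2 {ℕ.zero}  g w = trans (ℚ.*-zeroˡ (g [] * 1ℚ)) (sym (∑-empty _))
∑ᵏ-2 {ℕ.suc n} g w = begin
  ∑ᵏ 2 g w  ≡⟨ ∑ᵏ-suc 1 g w ⟩
  ∑ᵏ 2 (g ∘ (outside ∷_)) (w ∘ suc) + w zero * ∑ᵏ 1 (g ∘ (inside ∷_)) (w ∘ suc)
    ≡⟨ cong₂ (λ a b → a + w zero * b) (∑ᵏ-2 (g ∘ (outside ∷_)) (w ∘ suc)) (∑ᵏ-1 (g ∘ (inside ∷_)) (w ∘ suc)) ⟩
  ∑ (λ i → ∑ λ j → F (suc i) (suc j)) + w zero * ∑ (λ i → g (inside ∷ ⁅ i ⁆) * w (suc i))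
    ≡⟨ cong₂ _+_ (∑-cong λ i → sym (drop-zero {f = F (suc i)} (ℚ.*-zeroˡ (g (⁅ suc i ⁆ ∪ ⁅ zero ⁆) * (w (suc i) * w zero)))))
                 (sym (trans (drop-zero {f = F zero} (ℚ.*-zeroˡ (g (⁅ zero ⁆ ∪ ⁅ zero ⁆) * (w zero * w zero)))) row₀)) ⟩
  ∑ (λ i → ∑ (F (suc i))) + ∑ (F zero)
    ≡⟨ ℚ.+-comm (∑ λ i → ∑ (F (suc i))) (∑ (F zero)) ⟩
  ∑ (F zero) + ∑ (λ i → ∑ (F (suc i)))
    ≡⟨ ∑-suc (λ i → ∑ (F i)) ⟨
  ∑ (λ i → ∑ (F i)) ∎
  where
  open ≡-Reasoning
  F : Fin (ℕ.suc n) → Fin (ℕ.suc n) → ℚ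
  F i j = 𝟙 (toℕ i <ᵇ toℕ j) * (g (⁅ i ⁆ ∪ ⁅ j ⁆) * (w i * w j))
  row₀ : ∑ (λ j → F zero (suc j)) ≡ w zero * ∑ (λ i → g (inside ∷ ⁅ i ⁆) * w (suc i))
  row₀ = trans (∑-cong λ j → trans
    (cong (λ e → 1ℚ * (g (inside ∷ e) * (w zero * w (suc j)))) (Subset.∪-identityˡ ⁅ j ⁆))
    (solve 3 (λ g t u → con 1ℚ :* (g :* (t :* u)) := t :* (g :* u)) refl (g (inside ∷ ⁅ j ⁆)) (w zero) (w (suc j))))
    (∑-pull (w zero) (λ i → g (inside ∷ ⁅ i ⁆) * w (suc i)))

triple : Fin n → Fin n → Fin n → Subset n
triple i j k = ⁅ i ⁆ ∪ (⁅ j ⁆ ∪ ⁅ k ⁆)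

increasing : (Fin n → ℕ) → Fin n → Fin n → Fin n → ℚ
increasing pos i j k = 𝟙 (pos i <ᵇ pos j) * 𝟙 (pos j <ᵇ pos k)

-- Passes from sets to index triples, the form into which orders and colours can be inserted. In the
-- triple sum nothing lies below `zero`, so `zero` can occur only as the smallest index, and that
-- row is the degree-two sum of the tail.
∑ᵏ-3 : ∀ (g : Subset n → ℚ) w → ∑ᵏ 3 g w ≡
  ∑ λ i → ∑ λ j → ∑ λ k → increasing toℕ i j k * (g (triple i j k) * (w i * (w j * w k)))
∑ᵏ-3 {ℕ.zero}  g w = trans (ℚ.*-zeroˡ (g [] * 1ℚ)) (sym (∑-empty _))
∑ᵏ-3 {ℕ.suc n} g w = begin
  ∑ᵏ 3 g w  ≡⟨ ∑ᵏ-suc 2 g w ⟩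
  ∑ᵏ 3 (g ∘ (outside ∷_)) (w ∘ suc) + w zero * ∑ᵏ 2 (g ∘ (inside ∷_)) (w ∘ suc)
    ≡⟨ cong₂ (λ a b → a + w zero * b) (∑ᵏ-3 (g ∘ (outside ∷_)) (w ∘ suc)) (∑ᵏ-2 (g ∘ (inside ∷_)) (w ∘ suc)) ⟩
  ∑ (λ i → ∑ λ j → ∑ λ k → F (suc i) (suc j) (suc k)) + w zero * ∑ (λ j → ∑ λ k → G j k)
    ≡⟨ cong₂ _+_ (∑-cong λ i → sym (row (suc i) (∑-zero λ k → F-zero (suc i) k refl)))
                 (sym (trans (row zero (∑-zero λ k → F-zero zero k refl)) row₀)) ⟩
  ∑ (λ i → ∑ λ j → ∑ (F (suc i) j)) + ∑ (λ j → ∑ (F zero j))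
    ≡⟨ ℚ.+-comm (∑ (λ i → ∑ λ j → ∑ (F (suc i) j))) (∑ (λ j → ∑ (F zero j))) ⟩
  ∑ (λ j → ∑ (F zero j)) + ∑ (λ i → ∑ λ j → ∑ (F (suc i) j))
    ≡⟨ ∑-suc (λ i → ∑ λ j → ∑ (F i j)) ⟨
  ∑ (λ i → ∑ λ j → ∑ (F i j)) ∎
  where
  open ≡-Reasoning
  F : Fin (ℕ.suc n) → Fin (ℕ.suc n) → Fin (ℕ.suc n) → ℚ
  F i j k = increasing toℕ i j k * (g (triple i j k) * (w i * (w j * w k)))
  G : Fin n → Fin n → ℚ
  G j k = 𝟙 (toℕ j <ᵇ toℕ k) * (g (inside ∷ (⁅ j ⁆ ∪ ⁅ k ⁆)) * (w (suc j) * w (suc k)))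
  F-zero : ∀ i k → 𝟙 (toℕ i <ᵇ 0) ≡ 0ℚ → F i zero k ≡ 0ℚ
  F-zero i k eq = trans (cong (λ z → z * 𝟙 (0 <ᵇ toℕ k) * (g (triple i zero k) * (w i * (w zero * w k)))) eq)
    (solve 2 (λ a b → con 0ℚ :* a :* b := con 0ℚ) refl (𝟙 (0 <ᵇ toℕ k)) (g (triple i zero k) * (w i * (w zero * w k))))
  row : ∀ i → ∑ (F i zero) ≡ 0ℚ → ∑ (λ j → ∑ (F i j)) ≡ ∑ (λ j → ∑ λ k → F i (suc j) (suc k))
  row i F≡0 = trans (drop-zero {f = λ j → ∑ (F i j)} F≡0) (∑-cong λ j → drop-zero {f = F i (suc j)}
    (solve 2 (λ a b → a :* con 0ℚ :* b := con 0ℚ) refl (𝟙 (toℕ i <ᵇ toℕ (suc j))) (g (triple i (suc j) zero) * (w i * (w (suc j) * w zero)))))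
  row₀ : ∑ (λ j → ∑ λ k → F zero (suc j) (suc k)) ≡ w zero * ∑ (λ j → ∑ λ k → G j k)
  row₀ = trans (∑-cong λ j → trans (∑-cong λ k → trans
      (cong (λ e → 1ℚ * 𝟙 (toℕ j <ᵇ toℕ k) * (g (inside ∷ e) * (w zero * (w (suc j) * w (suc k))))) (Subset.∪-identityˡ (⁅ j ⁆ ∪ ⁅ k ⁆)))
      (solve 4 (λ o g t u → con 1ℚ :* o :* (g :* (t :* u)) := t :* (o :* (g :* u))) refl
        (𝟙 (toℕ j <ᵇ toℕ k)) (g (inside ∷ (⁅ j ⁆ ∪ ⁅ k ⁆))) (w zero) (w (suc j) * w (suc k))))
      (∑-pull (w zero) (G j)))
    (∑-pull (w zero) (λ j → ∑ (G j)))

-- At an indicator the recursion `∑ᵏ-suc` is Pascal's rule.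
∑ᵏ-binomial : ∀ k (U : Subset n) → ∑ᵏ k (const 1ℚ) (indicator U) ≡ natℚ (∣ U ∣ C k)
∑ᵏ-binomial ℕ.zero    U  = trans (∑ᵏ-0 (const 1ℚ) (indicator U)) (sym (trans (cong natℚ (trans (nCk≡nC[n∸k] {n = ∣ U ∣} ℕ.z≤n) (nCn≡1 ∣ U ∣))) natℚ-1))
∑ᵏ-binomial (ℕ.suc k) [] = trans (ℚ.*-zeroˡ (1ℚ * 1ℚ)) (sym natℚ-0)
∑ᵏ-binomial (ℕ.suc k) (outside ∷ U) = trans (∑ᵏ-suc k (const 1ℚ) (indicator (outside ∷ U))) (trans
  (cong₂ _+_ (∑ᵏ-binomial (ℕ.suc k) U) (ℚ.*-zeroˡ (∑ᵏ k (const 1ℚ) (indicator U)))) (ℚ.+-identityʳ (natℚ (∣ U ∣ C ℕ.suc k))))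
∑ᵏ-binomial (ℕ.suc k) (inside ∷ U) = begin
  ∑ᵏ (ℕ.suc k) (const 1ℚ) (indicator (inside ∷ U))
    ≡⟨ ∑ᵏ-suc k (const 1ℚ) (indicator (inside ∷ U)) ⟩
  ∑ᵏ (ℕ.suc k) (const 1ℚ) (indicator U) + 1ℚ * ∑ᵏ k (const 1ℚ) (indicator U)
    ≡⟨ cong₂ _+_ (∑ᵏ-binomial (ℕ.suc k) U) (trans (ℚ.*-identityˡ (∑ᵏ k (const 1ℚ) (indicator U))) (∑ᵏ-binomial k U)) ⟩
  natℚ (∣ U ∣ C ℕ.suc k) + natℚ (∣ U ∣ C k)  ≡⟨ natℚ-+ (∣ U ∣ C ℕ.suc k) (∣ U ∣ C k) ⟨
  natℚ (∣ U ∣ C ℕ.suc k ℕ.+ ∣ U ∣ C k)       ≡⟨ cong natℚ (ℕ.+-comm (∣ U ∣ C ℕ.suc k) (∣ U ∣ C k)) ⟩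
  natℚ (∣ U ∣ C k ℕ.+ ∣ U ∣ C ℕ.suc k)       ≡⟨ cong natℚ (nCk+nC[k+1]≡[n+1]C[k+1] ∣ U ∣ k) ⟩
  natℚ (ℕ.suc ∣ U ∣ C ℕ.suc k)               ∎
  where open ≡-Reasoning

-- Newton's identities in degrees two and three

2ℚ 3ℚ 6ℚ : ℚ
2ℚ = + 2 / 1
3ℚ = + 3 / 1
6ℚ = + 6 / 1

elementary : ℕ → (Fin n → ℚ) → ℚ
elementary k = ∑ᵏ k (const 1ℚ)

elementary-1 : ∀ (w : Fin n → ℚ) → elementary 1 w ≡ ∑ w
elementary-1 w = trans (∑ᵏ-1 (const 1ℚ) w) (∑-cong λ i → ℚ.*-identityˡ (w i))

square cube : ℚ → ℚ
square x = x * x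
cube x   = x * (x * x)

newton₂ : ∀ (w : Fin n → ℚ) → 2ℚ * elementary 2 w + ∑ (square ∘ w) ≡ square (∑ w)
newton₂ {ℕ.zero}  w = trans (cong (λ z → 2ℚ * 0ℚ + z) (∑-empty (square ∘ w))) (sym (cong square (∑-empty w)))
newton₂ {ℕ.suc n} w = begin
  2ℚ * elementary 2 w + ∑ (square ∘ w)
    ≡⟨ cong₂ (λ y z → 2ℚ * y + z) (trans (∑ᵏ-suc 1 (const 1ℚ) w) (cong (λ z → e₂ + t * z) (elementary-1 w′))) (∑-suc (square ∘ w)) ⟩
  2ℚ * (e₂ + t * s) + (t * t + p₂)
    ≡⟨ solve 4 (λ e t s p → con 2ℚ :* (e :+ t :* s) :+ (t :* t :+ p)
         := (con 2ℚ :* e :+ p) :+ (t :* t :+ con 2ℚ :* t :* s)) refl e₂ t s p₂ ⟩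
  (2ℚ * e₂ + p₂) + (t * t + 2ℚ * t * s)
    ≡⟨ cong (_+ (t * t + 2ℚ * t * s)) (newton₂ w′) ⟩
  s * s + (t * t + 2ℚ * t * s)
    ≡⟨ solve 2 (λ t s → s :* s :+ (t :* t :+ con 2ℚ :* t :* s) := (t :+ s) :* (t :+ s)) refl t s ⟩
  square (t + s) ≡⟨ cong square (∑-suc w) ⟨
  square (∑ w)   ∎
  where
  open ≡-Reasoning
  t  = w zero
  w′ = w ∘ suc
  e₂ = elementary 2 w′
  s  = ∑ w′
  p₂ = ∑ (square ∘ w′)

-- Peeling off the first entry brings in `newton₂`. The identity serves to bound `elementary 3` from
-- below: for nonnegative entries the product with the quadratic power sum is the only loss against
-- the cube of the total, and it is small when all entries are.
newton₃ : ∀ (w : Fin n → ℚ) →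
  6ℚ * elementary 3 w + 3ℚ * (∑ w * ∑ (square ∘ w)) ≡ cube (∑ w) + 2ℚ * ∑ (cube ∘ w)
newton₃ {ℕ.zero}  w = trans (cong₂ (λ y z → 6ℚ * 0ℚ + 3ℚ * (y * z)) (∑-empty w) (∑-empty (square ∘ w)))
  (sym (cong₂ (λ y z → cube y + 2ℚ * z) (∑-empty w) (∑-empty (cube ∘ w))))
newton₃ {ℕ.suc n} w = begin
  6ℚ * elementary 3 w + 3ℚ * (∑ w * ∑ (square ∘ w))
    ≡⟨ cong₂ (λ y z → 6ℚ * elementary 3 w + 3ℚ * (y * z)) (∑-suc w) (∑-suc (square ∘ w)) ⟩
  6ℚ * elementary 3 w + 3ℚ * ((t + s) * (t * t + p₂))
    ≡⟨ cong (λ z → 6ℚ * z + 3ℚ * ((t + s) * (t * t + p₂))) (∑ᵏ-suc 2 (const 1ℚ) w) ⟩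
  6ℚ * (e₃ + t * e₂) + 3ℚ * ((t + s) * (t * t + p₂))
    ≡⟨ solve 5 (λ e₃ e₂ t s p → con 6ℚ :* (e₃ :+ t :* e₂) :+ con 3ℚ :* ((t :+ s) :* (t :* t :+ p))
         := (con 6ℚ :* e₃ :+ con 3ℚ :* (s :* p)) :+ con 3ℚ :* t :* (con 2ℚ :* e₂ :+ p) :+ con 3ℚ :* (t :* t) :* (t :+ s))
         refl e₃ e₂ t s p₂ ⟩
  (6ℚ * e₃ + 3ℚ * (s * p₂)) + 3ℚ * t * (2ℚ * e₂ + p₂) + 3ℚ * (t * t) * (t + s)
    ≡⟨ cong₂ (λ x y → x + 3ℚ * t * y + 3ℚ * (t * t) * (t + s)) (newton₃ w′) (newton₂ w′) ⟩
  (s * (s * s) + 2ℚ * p₃) + 3ℚ * t * (s * s) + 3ℚ * (t * t) * (t + s)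
    ≡⟨ solve 3 (λ t s p → (s :* (s :* s) :+ con 2ℚ :* p) :+ con 3ℚ :* t :* (s :* s) :+ con 3ℚ :* (t :* t) :* (t :+ s)
         := (t :+ s) :* ((t :+ s) :* (t :+ s)) :+ con 2ℚ :* (t :* (t :* t) :+ p)) refl t s p₃ ⟩
  cube (t + s) + 2ℚ * (t * (t * t) + p₃)
    ≡⟨ cong₂ (λ y z → cube y + 2ℚ * z) (∑-suc w) (∑-suc (cube ∘ w)) ⟨
  cube (∑ w) + 2ℚ * ∑ (cube ∘ w) ∎
  where
  open ≡-Reasoning
  t  = w zero
  w′ = w ∘ suc
  e₂ = elementary 2 w′
  e₃ = elementary 3 w′
  s  = ∑ w′
  p₂ = ∑ (square ∘ w′)
  p₃ = ∑ (cube ∘ w′)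

-- The edge list of a 3-graph as a polynomial

∑ᴸ : {A : Set} → (A → ℚ) → List A → ℚ
∑ᴸ f = List.foldr (λ x s → f x + s) 0ℚ

∑ᴸ-++ : ∀ {A : Set} (f : A → ℚ) xs ys → ∑ᴸ f (xs ++ ys) ≡ ∑ᴸ f xs + ∑ᴸ f ys
∑ᴸ-++ f []       ys = sym (ℚ.+-identityˡ (∑ᴸ f ys))
∑ᴸ-++ f (x ∷ xs) ys = trans (cong₂ _+_ (refl {x = f x}) (∑ᴸ-++ f xs ys)) (sym (ℚ.+-assoc (f x) (∑ᴸ f xs) (∑ᴸ f ys)))

∑ᴸ-map : ∀ {A B : Set} (f : B → ℚ) (h : A → B) xs → ∑ᴸ f (List.map h xs) ≡ ∑ᴸ (f ∘ h) xs
∑ᴸ-map f h []       = refl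
∑ᴸ-map f h (x ∷ xs) = cong₂ _+_ (refl {x = f (h x)}) (∑ᴸ-map f h xs)

∑ᴸ-filter : ∀ {A : Set} {P : Pred A 0ℓ} (P? : ∀ x → Dec (P x)) (f : A → ℚ) xs →
  ∑ᴸ f (List.filter P? xs) ≡ ∑ᴸ (λ x → 𝟙 (does (P? x)) * f x) xs
∑ᴸ-filter P? f []       = refl
∑ᴸ-filter P? f (x ∷ xs) with does (P? x)
... | true  = cong₂ _+_ (sym (ℚ.*-identityˡ (f x))) (∑ᴸ-filter P? f xs)
... | false = trans (∑ᴸ-filter P? f xs) (sym (trans (cong (_+ S) (ℚ.*-zeroˡ (f x))) (ℚ.+-identityˡ S)))
  where S = ∑ᴸ (λ x → 𝟙 (does (P? x)) * f x) xs

∑ᴸ-length : ∀ {A : Set} (xs : List A) → ∑ᴸ (const 1ℚ) xs ≡ natℚ (length xs)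
∑ᴸ-length []       = sym natℚ-0
∑ᴸ-length (x ∷ xs) = trans (cong₂ _+_ (refl {x = 1ℚ}) (∑ᴸ-length xs)) (sym (natℚ-suc (length xs)))

∑ᴸ-subsets : ∀ n (f : Subset n → ℚ) → ∑ᴸ f (subsets n) ≡ ∑ˢ f
∑ᴸ-subsets ℕ.zero    f = ℚ.+-identityʳ (f [])
∑ᴸ-subsets (ℕ.suc n) f = trans (∑ᴸ-++ f (List.map (outside ∷_) (subsets n)) (List.map (inside ∷_) (subsets n))) (cong₂ _+_
  (trans (∑ᴸ-map f (outside ∷_) (subsets n)) (∑ᴸ-subsets n (f ∘ (outside ∷_))))
  (trans (∑ᴸ-map f (inside ∷_) (subsets n)) (∑ᴸ-subsets n (f ∘ (inside ∷_)))))

edgePolynomial : (H : 3-Graph) → (Fin (order H) → ℚ) → ℚ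
edgePolynomial H = ∑ᵏ 3 (𝟙 ∘ edge H)

-- Uniformity allows the factor that tests the size of a set to be inserted on every edge, which
-- turns the sum over the edge list into the form of degree three.
∑-edges : ∀ H w → ∑ᴸ (mono w) (edges H) ≡ edgePolynomial H w
∑-edges H w = begin
  ∑ᴸ (mono w) (edges H)
    ≡⟨ ∑ᴸ-filter (λ e → T? (edge H e)) (mono w) (subsets (order H)) ⟩
  ∑ᴸ (λ e → 𝟙 (edge H e) * mono w e) (subsets (order H))
    ≡⟨ ∑ᴸ-subsets (order H) (λ e → 𝟙 (edge H e) * mono w e) ⟩
  ∑ˢ (λ e → 𝟙 (edge H e) * mono w e)
    ≡⟨ ∑ˢ-cong (λ e → size3 e (edge H e) (uniform H e)) ⟩
  edgePolynomial H w ∎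
  where
  open ≡-Reasoning
  size3 : ∀ e b → (T b → ∣ e ∣ ≡ 3) → 𝟙 b * mono w e ≡ 𝟙 (∣ e ∣ ℕ.≡ᵇ 3) * (𝟙 b * mono w e)
  size3 e true  ∣e∣≡3 = sym (trans (cong (λ z → 𝟙 (z ℕ.≡ᵇ 3) * (1ℚ * mono w e)) (∣e∣≡3 tt)) (ℚ.*-identityˡ (1ℚ * mono w e)))
  size3 e false _     = solve 2 (λ c x → con 0ℚ :* x := c :* (con 0ℚ :* x)) refl (𝟙 (∣ e ∣ ℕ.≡ᵇ 3)) (mono w e)

mono-indicator : ∀ (e U : Subset n) → mono (indicator U) e ≡ 𝟙 (does (e Subset.⊆? U))
mono-indicator []            []            = refl
mono-indicator (outside ∷ e) (y ∷ U)       = mono-indicator e U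
mono-indicator (inside ∷ e)  (outside ∷ U) = ℚ.*-zeroˡ (mono (indicator U) e)
mono-indicator (inside ∷ e)  (inside ∷ U)  = trans (ℚ.*-identityˡ (mono (indicator U) e)) (mono-indicator e U)

natℚ-edgesWithin : ∀ H U → natℚ (edgesWithin H U) ≡ edgePolynomial H (indicator U)
natℚ-edgesWithin H U = begin
  natℚ (edgesWithin H U)  ≡⟨ ∑ᴸ-length (List.filter (Subset._⊆? U) (edges H)) ⟨
  ∑ᴸ (const 1ℚ) (List.filter (Subset._⊆? U) (edges H))
    ≡⟨ ∑ᴸ-filter (Subset._⊆? U) (const 1ℚ) (edges H) ⟩
  ∑ᴸ (λ e → 𝟙 (does (e Subset.⊆? U)) * 1ℚ) (edges H)
    ≡⟨ List.foldr-cong (λ e s → cong (_+ s) (trans (ℚ.*-identityʳ (𝟙 (does (e Subset.⊆? U)))) (sym (mono-indicator e U)))) refl (edges H) ⟩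
  ∑ᴸ (mono (indicator U)) (edges H)
    ≡⟨ ∑-edges H (indicator U) ⟩
  edgePolynomial H (indicator U) ∎
  where open ≡-Reasoning

-- Sums over triples and symmetric summands

∑³ : (Fin n → Fin n → Fin n → ℚ) → ℚ
∑³ F = ∑ λ i → ∑ λ j → ∑ λ k → F i j k

∑³-cong : {F G : Fin n → Fin n → Fin n → ℚ} → (∀ i j k → F i j k ≡ G i j k) → ∑³ F ≡ ∑³ G
∑³-cong F≡G = ∑-cong λ i → ∑-cong λ j → ∑-cong λ k → F≡G i j k

∑³-mono : {F G : Fin n → Fin n → Fin n → ℚ} → (∀ i j k → F i j k ≤ℚ G i j k) → ∑³ F ≤ℚ ∑³ G
∑³-mono F≤G = ∑-mono λ i → ∑-mono λ j → ∑-mono λ k → F≤G i j k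

∑³-pull : ∀ c (F : Fin n → Fin n → Fin n → ℚ) → ∑³ (λ i j k → c * F i j k) ≡ c * ∑³ F
∑³-pull c F = trans (∑-cong λ i → trans (∑-cong λ j → ∑-pull c (F i j)) (∑-pull c λ j → ∑ (F i j)))
  (∑-pull c λ i → ∑ λ j → ∑ (F i j))

∑³-+ : ∀ (F G : Fin n → Fin n → Fin n → ℚ) → ∑³ (λ i j k → F i j k + G i j k) ≡ ∑³ F + ∑³ G
∑³-+ F G = trans
  (∑-cong λ i → trans (∑-cong λ j → ∑-+ (F i j) (G i j)) (∑-+ (λ j → ∑ (F i j)) (λ j → ∑ (G i j))))
  (∑-+ (λ i → ∑ λ j → ∑ (F i j)) (λ i → ∑ λ j → ∑ (G i j)))

∑³-zero : {F : Fin n → Fin n → Fin n → ℚ} → (∀ i j k → F i j k ≡ 0ℚ) → ∑³ F ≡ 0ℚ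
∑³-zero F≡0 = ∑-zero λ i → ∑-zero λ j → ∑-zero λ k → F≡0 i j k

∑³-swap₁₂ : ∀ (F : Fin n → Fin n → Fin n → ℚ) → ∑³ F ≡ ∑³ (λ i j k → F j i k)
∑³-swap₁₂ F = ∑-swap (λ i j → ∑ (F i j))

∑³-swap₂₃ : ∀ (F : Fin n → Fin n → Fin n → ℚ) → ∑³ F ≡ ∑³ (λ i j k → F i k j)
∑³-swap₂₃ F = ∑-cong λ i → ∑-swap (F i)

record Symmetric (F : Fin n → Fin n → Fin n → ℚ) : Set where
  field
    sym₁₂ : ∀ i j k → F i j k ≡ F j i k
    sym₂₃ : ∀ i j k → F i j k ≡ F i k j

  ∑³-sym₁₂ : ∀ (G : Fin n → Fin n → Fin n → ℚ) → ∑³ (λ i j k → G j i k * F i j k) ≡ ∑³ (λ i j k → G i j k * F i j k)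
  ∑³-sym₁₂ G = trans (∑³-swap₁₂ λ i j k → G j i k * F i j k) (∑³-cong λ i j k → cong (G i j k *_) (sym₁₂ j i k))

  ∑³-sym₂₃ : ∀ (G : Fin n → Fin n → Fin n → ℚ) → ∑³ (λ i j k → G i k j * F i j k) ≡ ∑³ (λ i j k → G i j k * F i j k)
  ∑³-sym₂₃ G = trans (∑³-swap₂₃ λ i j k → G i k j * F i j k) (∑³-cong λ i j k → cong (G i j k *_) (sym₂₃ i k j))

open Symmetric

-- The six relative orders of three naturals

inOrder : ℕ → ℕ → ℕ → Bool
inOrder x y z = (x <ᵇ y) ∧ (y <ᵇ z)

orders : List (ℕ → ℕ → ℕ → Bool)
orders = (λ x y z → inOrder x y z) ∷ (λ x y z → inOrder x z y) ∷ (λ x y z → inOrder y x z)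
       ∷ (λ x y z → inOrder y z x) ∷ (λ x y z → inOrder z x y) ∷ (λ x y z → inOrder z y x) ∷ []

∑-in-order : (Fin n → ℕ) → (Fin n → Fin n → Fin n → ℚ) → (ℕ → ℕ → ℕ → Bool) → ℚ
∑-in-order pos F o = ∑³ λ i j k → 𝟙 (o (pos i) (pos j) (pos k)) * F i j k

-- Each order arises from `inOrder` by at most three adjacent transpositions, and a symmetric `F`
-- absorbs every transposition.
∑-order : ∀ (pos : Fin n → ℕ) F → Symmetric F →
  All (λ o → ∑-in-order pos F o ≡ ∑-in-order pos F inOrder) orders
∑-order pos F symF = refl ∷ ikj ∷ jik ∷ jki ∷ kij ∷ kji ∷ []
  where
  o : Fin _ → Fin _ → Fin _ → ℚ
  o i j k = 𝟙 (inOrder (pos i) (pos j) (pos k))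
  ikj = ∑³-sym₂₃ symF o
  jik = ∑³-sym₁₂ symF o
  jki = trans (∑³-sym₁₂ symF (λ i j k → o i k j)) ikj
  kij = trans (∑³-sym₂₃ symF (λ i j k → o j i k)) jik
  kji = trans (∑³-sym₁₂ symF (λ i j k → o k i j)) kij

∑-orders : ∀ (pos : Fin n → ℕ) F {S} os →
  All (λ o → ∑-in-order pos F o ≡ S) os →
  ∑³ (λ i j k → ∑ᴸ (λ o → 𝟙 (o (pos i) (pos j) (pos k))) os * F i j k) ≡ natℚ (length os) * S
∑-orders pos F {S} []       []         =
  trans (∑³-zero λ i j k → ℚ.*-zeroˡ (F i j k)) (sym (trans (cong (_* S) natℚ-0) (ℚ.*-zeroˡ S)))
∑-orders pos F {S} (o ∷ os) (eq ∷ eqs) = begin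
  ∑³ (λ i j k → (A i j k + B i j k) * F i j k)
    ≡⟨ ∑³-cong (λ i j k → ℚ.*-distribʳ-+ (F i j k) (A i j k) (B i j k)) ⟩
  ∑³ (λ i j k → A i j k * F i j k + B i j k * F i j k)
    ≡⟨ ∑³-+ (λ i j k → A i j k * F i j k) (λ i j k → B i j k * F i j k) ⟩
  ∑³ (λ i j k → A i j k * F i j k) + ∑³ (λ i j k → B i j k * F i j k)
    ≡⟨ cong₂ _+_ eq (∑-orders pos F os eqs) ⟩
  S + natℚ (length os) * S
    ≡⟨ solve 2 (λ s l → s :+ l :* s := (con 1ℚ :+ l) :* s) refl S (natℚ (length os)) ⟩
  (1ℚ + natℚ (length os)) * S
    ≡⟨ cong (_* S) (natℚ-suc (length os)) ⟨
  natℚ (length (o ∷ os)) * S ∎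
  where
  open ≡-Reasoning
  A B : _ → _ → _ → ℚ
  A i j k = 𝟙 (o (pos i) (pos j) (pos k))
  B i j k = ∑ᴸ (λ o → 𝟙 (o (pos i) (pos j) (pos k))) os

-- Comparison indicators

lt : ℕ → ℕ → ℚ
lt x y = 𝟙 (x <ᵇ y)

lt-true : ∀ {x y} → x ℕ.< y → lt x y ≡ 1ℚ
lt-true {x} {y} x<y with x <ᵇ y | ℕ.<⇒<ᵇ x<y
... | true | _ = refl

lt-false : ∀ {x y} → ¬ x ℕ.< y → lt x y ≡ 0ℚ
lt-false {x} {y} x≮y with x <ᵇ y | ℕ.<ᵇ⇒< x y
... | false | _ = refl
... | true  | f = contradiction (f tt) x≮y

chain : ∀ x y z → lt x y * lt y z * lt x z ≡ lt x y * lt y z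
chain x y z with x ℕ.<? y | y ℕ.<? z
... | no ¬p | _    rewrite lt-false ¬p = solve 2 (λ a b → con 0ℚ :* a :* b := con 0ℚ :* a) refl (lt y z) (lt x z)
... | yes _ | no ¬p rewrite lt-false ¬p = solve 2 (λ a b → a :* con 0ℚ :* b := a :* con 0ℚ) refl (lt x y) (lt x z)
... | yes p | yes q rewrite lt-true (ℕ.<-trans p q) = ℚ.*-identityʳ (lt x y * lt y z)

cycle : ∀ x y z → lt x y * lt y z * lt z x ≡ 0ℚ
cycle x y z with x ℕ.<? y | y ℕ.<? z
... | no ¬p | _    rewrite lt-false ¬p = solve 2 (λ a b → con 0ℚ :* a :* b := con 0ℚ) refl (lt y z) (lt z x)
... | yes _ | no ¬p rewrite lt-false ¬p = solve 2 (λ a b → a :* con 0ℚ :* b := con 0ℚ) refl (lt x y) (lt z x)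
... | yes p | yes q rewrite lt-false (ℕ.<-asym (ℕ.<-trans p q)) = ℚ.*-zeroʳ (lt x y * lt y z)

comparable : ℕ → ℕ → ℚ
comparable x y = 𝟙 (x <ᵇ y) + 𝟙 (y <ᵇ x)

comparable-≢ : ∀ {x y} → x ≢ y → comparable x y ≡ 1ℚ
comparable-≢ {x} {y} x≢y with ℕ.<-cmp x y
... | tri< p _ q = cong₂ _+_ (lt-true p) (lt-false q)
... | tri≈ _ p _ = contradiction p x≢y
... | tri> p _ q = cong₂ _+_ (lt-false p) (lt-true q)

comparable-≡ : ∀ {x y} → x ≡ y → comparable x y ≡ 0ℚ
comparable-≡ {x} refl = cong₂ _+_ (lt-false (ℕ.<-irrefl {x} refl)) (lt-false (ℕ.<-irrefl {x} refl))

01-comparable : ∀ x y → In01 (comparable x y)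
01-comparable x y with x ℕ.≟ y
... | yes p = subst In01 (sym (comparable-≡ p)) (01-𝟙 false)
... | no ¬p = subst In01 (sym (comparable-≢ ¬p)) (01-𝟙 true)

-- Expanding the product gives the eight tournaments on three points. The six transitive ones are
-- the orders, where `chain` supplies the third comparison; the two cyclic ones vanish by `cycle`.
∑-all-orders : ∀ x y z → ∑ᴸ (λ o → 𝟙 (o x y z)) orders ≡ comparable x y * (comparable y z * comparable x z)
∑-all-orders x y z = begin
  ∑ᴸ (λ o → 𝟙 (o x y z)) orders
    ≡⟨ cong₂ _+_ (inO x y z) (cong₂ _+_ (inO x z y) (cong₂ _+_ (inO y x z) (cong₂ _+_ (inO y z x) (cong₂ _+_ (inO z x y) (cong (_+ 0ℚ) (inO z y x)))))) ⟩
  lt x y * lt y z + (lt x z * lt z y + (lt y x * lt x z + (lt y z * lt z x + (lt z x * lt x y + (lt z y * lt y x + 0ℚ)))))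
    ≡⟨ cong₂ _+_ (chain x y z) (cong₂ _+_ (chain x z y) (cong₂ _+_ (chain y x z) (cong₂ _+_ (chain y z x) (cong₂ _+_ (chain z x y) (cong₂ _+_ (chain z y x) (cong₂ _+_ (cycle x y z) (cycle x z y))))))) ⟨
  lt x y * lt y z * lt x z + (lt x z * lt z y * lt x y + (lt y x * lt x z * lt y z + (lt y z * lt z x * lt y x
    + (lt z x * lt x y * lt z y + (lt z y * lt y x * lt z x + (lt x y * lt y z * lt z x + lt x z * lt z y * lt y x))))))
    ≡⟨ solve 6 (λ a a′ b b′ c c′ →
         a :* b :* c :+ (c :* b′ :* a :+ (a′ :* c :* b :+ (b :* c′ :* a′ :+ (c′ :* a :* b′ :+ (b′ :* a′ :* c′ :+ (a :* b :* c′ :+ c :* b′ :* a′))))))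
         := (a :+ a′) :* ((b :+ b′) :* (c :+ c′)))
         refl (lt x y) (lt y x) (lt y z) (lt z y) (lt x z) (lt z x) ⟩
  comparable x y * (comparable y z * comparable x z) ∎
  where
  open ≡-Reasoning
  inO : ∀ x y z → 𝟙 (inOrder x y z) ≡ lt x y * lt y z
  inO x y z = 𝟙-∧ (x <ᵇ y) (y <ᵇ z)

-- Any two injective positions define the same sum over increasing triples, since six
-- times either of them is the sum over all triples of distinct elements.
∑-increasing : ∀ (pos pos′ : Fin n → ℕ) → Injective _≡_ _≡_ pos → Injective _≡_ _≡_ pos′ → ∀ {F} → Symmetric F →
  ∑³ (λ i j k → increasing pos i j k * F i j k) ≡ ∑³ (λ i j k → increasing pos′ i j k * F i j k)
∑-increasing {n} pos pos′ inj inj′ {F} symF = ℚ.≤-antisym (half pos pos′ inj inj′) (half pos′ pos inj′ inj)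
  where
  S : (Fin n → ℕ) → ℚ
  S p = ∑³ (λ i j k → increasing p i j k * F i j k)
  S′ : ∀ p → ∑³ (λ i j k → 𝟙 (inOrder (p i) (p j) (p k)) * F i j k) ≡ S p
  S′ p = ∑³-cong λ i j k → cong (_* F i j k) (𝟙-∧ (p i <ᵇ p j) (p j <ᵇ p k))
  D : (Fin n → ℕ) → Fin n → Fin n → Fin n → ℚ
  D p i j k = comparable (p i) (p j) * (comparable (p j) (p k) * comparable (p i) (p k))
  distinct : ∀ p → Injective _≡_ _≡_ p → ∀ i j → comparable (p i) (p j) ≡ 𝟙 (not (i ≡ᵇ j))
  distinct p inj i j with i Fin.≟ j
  ... | yes i≡j = comparable-≡ (cong p i≡j)
  ... | no i≢j  = comparable-≢ (i≢j ∘ inj)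
  6S : ∀ p → natℚ 6 * S p ≡ ∑³ (λ i j k → D p i j k * F i j k)
  6S p = sym (trans (∑³-cong λ i j k → cong (_* F i j k) (sym (∑-all-orders (p i) (p j) (p k))))
    (∑-orders p F orders (All.map (λ eq → trans eq (S′ p)) (∑-order p F symF))))
  D≡ : ∀ p q → Injective _≡_ _≡_ p → Injective _≡_ _≡_ q → ∀ i j k → D p i j k ≡ D q i j k
  D≡ p q inj inj′ i j k = cong₂ _*_ (c i j) (cong₂ _*_ (c j k) (c i k))
    where
    c : ∀ i j → comparable (p i) (p j) ≡ comparable (q i) (q j)
    c i j = trans (distinct p inj i j) (sym (distinct q inj′ i j))
  half : ∀ p q → Injective _≡_ _≡_ p → Injective _≡_ _≡_ q → S p ≤ℚ S q
  half p q inj inj′ = *-cancelˡ-≤ (0<nat 6) (ℚ.≤-reflexive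
    (trans (6S p) (trans (∑³-cong λ i j k → cong (_* F i j k) (D≡ p q inj inj′ i j k)) (sym (6S q)))))

triple-symmetric : ∀ (g : Subset n → ℚ) (w : Fin n → ℚ) →
  Symmetric (λ i j k → g (triple i j k) * (w i * (w j * w k)))
triple-symmetric g w = record
  { sym₁₂ = λ i j k → cong₂ _*_ (cong g (swap ⁅ i ⁆ ⁅ j ⁆ ⁅ k ⁆))
      (solve 3 (λ a b c → a :* (b :* c) := b :* (a :* c)) refl (w i) (w j) (w k))
  ; sym₂₃ = λ i j k → cong₂ _*_ (cong (λ e → g (⁅ i ⁆ ∪ e)) (Subset.∪-comm ⁅ j ⁆ ⁅ k ⁆))
      (cong (w i *_) (ℚ.*-comm (w j) (w k)))
  }
  where
  swap : ∀ (a b c : Subset _) → a ∪ (b ∪ c) ≡ b ∪ (a ∪ c)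
  swap a b c = trans (sym (Subset.∪-assoc a b c)) (trans (cong (_∪ c) (Subset.∪-comm a b)) (Subset.∪-assoc b a c))

∈-triple⁻ : ∀ {x : Fin n} i j k → x ∈ˢ triple i j k → x ≡ i ⊎ x ≡ j ⊎ x ≡ k
∈-triple⁻ i j k x∈ with Subset.x∈p∪q⁻ ⁅ i ⁆ (⁅ j ⁆ ∪ ⁅ k ⁆) x∈
... | inj₁ x∈i = inj₁ (Subset.x∈⁅y⁆⇒x≡y i x∈i)
... | inj₂ x∈jk = inj₂ (Sum.map (Subset.x∈⁅y⁆⇒x≡y j) (Subset.x∈⁅y⁆⇒x≡y k) (Subset.x∈p∪q⁻ ⁅ j ⁆ ⁅ k ⁆ x∈jk))

∈-triple⁺ : ∀ {x : Fin n} i j k → x ≡ i ⊎ x ≡ j ⊎ x ≡ k → x ∈ˢ triple i j k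
∈-triple⁺ i j k (inj₁ refl)        = Subset.x∈p∪q⁺ (inj₁ (Subset.x∈⁅x⁆ i))
∈-triple⁺ i j k (inj₂ (inj₁ refl)) = Subset.x∈p∪q⁺ (inj₂ (Subset.x∈p∪q⁺ (inj₁ (Subset.x∈⁅x⁆ j))))
∈-triple⁺ i j k (inj₂ (inj₂ refl)) = Subset.x∈p∪q⁺ {p = ⁅ i ⁆} (inj₂ (Subset.x∈p∪q⁺ {p = ⁅ j ⁆} (inj₂ (Subset.x∈⁅x⁆ k))))

-- Palettes, and the palette realising t of the six orders of every edge of a 3-graph

Palette : ℕ → Set
Palette r = Fin r → Fin r → Fin r → Bool

paletteDensity : Palette r → (Fin r → ℚ) → ℚ
paletteDensity P x = ∑³ λ a b c → 𝟙 (P a b c) * (x a * (x b * x c))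

orderedPalette : ℕ → (F : 3-Graph) → Palette (order F)
orderedPalette t F a b c =
  any (λ o → o (toℕ a) (toℕ b) (toℕ c)) (List.take t orders) ∧ edge F (triple a b c)

private
  -- A sum at most one means that no two alternatives hold together, so the indicator of the
  -- disjunction is additive.
  𝟙-any : ∀ {A : Set} (f : A → Bool) xs → ∑ᴸ (𝟙 ∘ f) xs ≤ℚ 1ℚ → 𝟙 (any f xs) ≡ ∑ᴸ (𝟙 ∘ f) xs
  𝟙-any f []       _  = refl
  𝟙-any f (x ∷ xs) ≤1 with f x
  ... | false = trans (𝟙-any f xs (subst (_≤ℚ 1ℚ) (ℚ.+-identityˡ (∑ᴸ (𝟙 ∘ f) xs)) ≤1)) (sym (ℚ.+-identityˡ (∑ᴸ (𝟙 ∘ f) xs)))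
  ... | true  = ℚ.≤-antisym (≤-offset (∑ᴸ (𝟙 ∘ f) xs) (0≤∑ᴸ xs) refl) ≤1
    where
    0≤∑ᴸ : ∀ xs → 0ℚ ≤ℚ ∑ᴸ (𝟙 ∘ f) xs
    0≤∑ᴸ []       = ℚ.≤-refl
    0≤∑ᴸ (x ∷ xs) = 0≤+ (0≤𝟙 (f x)) (0≤∑ᴸ xs)

  ∑ᴸ-take : ∀ {A : Set} {f : A → ℚ} → (∀ x → 0ℚ ≤ℚ f x) → ∀ t xs → ∑ᴸ f (List.take t xs) ≤ℚ ∑ᴸ f xs
  ∑ᴸ-take 0≤f ℕ.zero    []       = ℚ.≤-refl
  ∑ᴸ-take 0≤f ℕ.zero    (x ∷ xs) = 0≤+ (0≤f x) (∑ᴸ-take 0≤f 0 xs)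
  ∑ᴸ-take 0≤f (ℕ.suc t) []       = ℚ.≤-refl
  ∑ᴸ-take {f = f} 0≤f (ℕ.suc t) (x ∷ xs) = ℚ.+-monoʳ-≤ (f x) (∑ᴸ-take 0≤f t xs)

  All-take : ∀ {A : Set} {Q : Pred A 0ℓ} t {xs} → All Q xs → All Q (List.take t xs)
  All-take ℕ.zero    _          = []
  All-take (ℕ.suc t) []         = []
  All-take (ℕ.suc t) (px ∷ pxs) = px ∷ All-take t pxs

-- The orders exclude one another, so the indicator of their disjunction splits into a sum. By
-- symmetry each order contributes the same amount, the whole edge polynomial, so it is immaterial
-- which `t` of them are taken.
orderedPalette-density : ∀ {t} → t ≤ 6 → ∀ F x →
  paletteDensity (orderedPalette t F) x ≡ natℚ t * edgePolynomial F x
orderedPalette-density {t} t≤6 F x = begin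
  ∑³ (λ a b c → 𝟙 (orderedPalette t F a b c) * (x a * (x b * x c)))
    ≡⟨ ∑³-cong (λ a b c → trans (cong (_* (x a * (x b * x c))) (𝟙-palette a b c)) (ℚ.*-assoc (T′ a b c) (𝟙 (edge F (triple a b c))) (x a * (x b * x c)))) ⟩
  ∑³ (λ a b c → T′ a b c * F′ a b c)
    ≡⟨ ∑-orders toℕ F′ (List.take t orders) (All-take {Q = λ o → ∑-in-order toℕ F′ o ≡ ∑-in-order toℕ F′ inOrder} t (∑-order toℕ F′ (triple-symmetric (𝟙 ∘ edge F) x))) ⟩
  natℚ (length (List.take t orders)) * ∑-in-order toℕ F′ inOrder
    ≡⟨ cong₂ (λ l s → natℚ l * s) (trans (List.length-take t orders) (ℕ.m≤n⇒m⊓n≡m t≤6))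
         (trans (∑³-cong λ a b c → cong (_* F′ a b c) (𝟙-∧ (toℕ a <ᵇ toℕ b) (toℕ b <ᵇ toℕ c))) (sym (∑ᵏ-3 (𝟙 ∘ edge F) x))) ⟩
  natℚ t * edgePolynomial F x ∎
  where
  open ≡-Reasoning
  F′ T′ : _ → _ → _ → ℚ
  F′ a b c = 𝟙 (edge F (triple a b c)) * (x a * (x b * x c))
  T′ a b c = ∑ᴸ (λ o → 𝟙 (o (toℕ a) (toℕ b) (toℕ c))) (List.take t orders)
  T′≤1 : ∀ a b c → T′ a b c ≤ℚ 1ℚ
  T′≤1 a b c = ℚ.≤-trans (∑ᴸ-take {f = λ o → 𝟙 (o (toℕ a) (toℕ b) (toℕ c))} (λ o → 0≤𝟙 (o (toℕ a) (toℕ b) (toℕ c))) t orders)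
    (subst (_≤ℚ 1ℚ) (sym (∑-all-orders (toℕ a) (toℕ b) (toℕ c)))
      (proj₂ (01-* (01-comparable (toℕ a) (toℕ b)) (01-* (01-comparable (toℕ b) (toℕ c)) (01-comparable (toℕ a) (toℕ c))))))
  𝟙-palette : ∀ a b c → 𝟙 (orderedPalette t F a b c) ≡ T′ a b c * 𝟙 (edge F (triple a b c))
  𝟙-palette a b c = trans (𝟙-∧ (any atOrder (List.take t orders)) (edge F (triple a b c)))
    (cong (_* 𝟙 (edge F (triple a b c))) (𝟙-any atOrder (List.take t orders) (T′≤1 a b c)))
    where
    atOrder : (ℕ → ℕ → ℕ → Bool) → Bool
    atOrder o = o (toℕ a) (toℕ b) (toℕ c)

-- Triangle counting from one-sided cut-norm bounds

cutSum : (Fin n → Fin n → ℚ) → (Fin n → ℚ) → (Fin n → ℚ) → ℚ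
cutSum κ X Y = ∑ λ u → ∑ λ v → κ u v * (X u * Y v)

-- One-sided, since only an excess has to be bounded: of colour classes over their means in the
-- upper bound, of the model over the actual colouring in the lower bound. Test functions take
-- values in [0,1] because mean densities occur among the factors that `triangle-counting` uses as
-- tests.
CutBounded : (Fin n → Fin n → ℚ) → ℚ → Set
CutBounded κ E = ∀ X Y → (∀ u → In01 (X u)) → (∀ v → In01 (Y v)) → cutSum κ X Y ≤ℚ E

private
  -- For fixed `w` the inner double sum is a cut sum whose test functions are the slices `X w` and
  -- `Y w`.
  outer-bound : ∀ {δ : Fin n → ℚ} {κ : Fin n → Fin n → ℚ} {M E} {X Y : Fin n → Fin n → ℚ} →
    (∀ w → 0ℚ ≤ℚ δ w) → ∑ δ ≤ℚ M → 0ℚ ≤ℚ E → CutBounded κ E →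
    (∀ w u → In01 (X w u)) → (∀ w v → In01 (Y w v)) →
    ∑³ (λ w u v → δ w * (κ u v * (X w u * Y w v))) ≤ℚ M * E
  outer-bound {δ = δ} {κ} {M} {E} {X} {Y} 0≤δ ∑δ≤M 0≤E cut X∈ Y∈ = begin
    ∑³ (λ w u v → δ w * (κ u v * (X w u * Y w v)))
      ≡⟨ ∑-cong (λ w → trans (∑-cong λ u → ∑-pull (δ w) (λ v → κ u v * (X w u * Y w v))) (∑-pull (δ w) (λ u → ∑ λ v → κ u v * (X w u * Y w v)))) ⟩
    ∑ (λ w → δ w * cutSum κ (X w) (Y w))
      ≤⟨ ∑-mono (λ w → ℚ.≤-trans (*-monoˡ (0≤δ w) (cut (X w) (Y w) (X∈ w) (Y∈ w))) (ℚ.≤-reflexive (ℚ.*-comm (δ w) E))) ⟩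
    ∑ (λ w → E * δ w)  ≡⟨ ∑-pull E δ ⟩
    E * ∑ δ            ≤⟨ *-monoˡ 0≤E ∑δ≤M ⟩
    E * M              ≡⟨ ℚ.*-comm E M ⟩
    M * E              ∎
    where open ℚ.≤-Reasoning

module _ {α β γ : Fin n → ℚ} {M : ℚ}
  (0≤α : ∀ u → 0ℚ ≤ℚ α u) (0≤β : ∀ u → 0ℚ ≤ℚ β u) (0≤γ : ∀ u → 0ℚ ≤ℚ γ u)
  (∑α≤M : ∑ α ≤ℚ M) (∑β≤M : ∑ β ≤ℚ M) (∑γ≤M : ∑ γ ≤ℚ M)
  where

  -- Replace the factors one at a time: fgh - f′g′h′ = (f - f′)gh + (g - g′)f′h + (h - h′)f′g′. Each
  -- difference involves two of the vertices; once the third is fixed, the two remaining factors are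
  -- test functions of one vertex each.
  triangle-counting : ∀ {E} (f g h f′ g′ h′ : Fin n → Fin n → ℚ) → 0ℚ ≤ℚ E →
    (∀ u v → In01 (g u v)) → (∀ u v → In01 (h u v)) → (∀ u v → In01 (f′ u v)) → (∀ u v → In01 (g′ u v)) →
    CutBounded (λ u v → α u * β v * (f u v - f′ u v)) E →
    CutBounded (λ u w → α u * γ w * (g u w - g′ u w)) E →
    CutBounded (λ v w → β v * γ w * (h v w - h′ v w)) E →
    ∑³ (λ u v w → (α u * (β v * γ w)) * (f u v * (g u w * h v w))) ≤ℚ
    ∑³ (λ u v w → (α u * (β v * γ w)) * (f′ u v * (g′ u w * h′ v w))) + 3ℚ * (M * E)
  triangle-counting {E} f g h f′ g′ h′ 0≤E g∈ h∈ f′∈ g′∈ cutf cutg cuth = begin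
    ∑³ (λ u v w → (α u * (β v * γ w)) * (f u v * (g u w * h v w)))
      ≡⟨ ∑³-cong telescope ⟩
    ∑³ (λ u v w → S₀ u v w + (S₁ u v w + (S₂ u v w + S₃ u v w)))
      ≡⟨ trans (∑³-+ S₀ (λ u v w → S₁ u v w + (S₂ u v w + S₃ u v w))) (cong₂ _+_ (refl {x = ∑³ S₀})
           (trans (∑³-+ S₁ (λ u v w → S₂ u v w + S₃ u v w)) (cong₂ _+_ (refl {x = ∑³ S₁}) (∑³-+ S₂ S₃)))) ⟩
    ∑³ S₀ + (∑³ S₁ + (∑³ S₂ + ∑³ S₃))
      ≤⟨ ℚ.+-monoʳ-≤ (∑³ S₀) (ℚ.+-mono-≤ S₁≤ (ℚ.+-mono-≤ S₂≤ S₃≤)) ⟩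
    ∑³ S₀ + (M * E + (M * E + M * E))
      ≡⟨ solve 2 (λ t x → t :+ (x :+ (x :+ x)) := t :+ con 3ℚ :* x) refl (∑³ S₀) (M * E) ⟩
    ∑³ S₀ + 3ℚ * (M * E) ∎
    where
    open ℚ.≤-Reasoning
    S₀ S₁ S₂ S₃ : Fin n → Fin n → Fin n → ℚ
    S₀ u v w = (α u * (β v * γ w)) * (f′ u v * (g′ u w * h′ v w))
    S₁ u v w = γ w * (α u * β v * (f u v - f′ u v) * (g u w * h v w))
    S₂ u v w = β v * (α u * γ w * (g u w - g′ u w) * (f′ u v * h v w))
    S₃ u v w = α u * (β v * γ w * (h v w - h′ v w) * (f′ u v * g′ u w))
    telescope : ∀ u v w → (α u * (β v * γ w)) * (f u v * (g u w * h v w)) ≡ S₀ u v w + (S₁ u v w + (S₂ u v w + S₃ u v w))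
    telescope u v w = solve 9 (λ a b c f g h f′ g′ h′ →
      (a :* (b :* c)) :* (f :* (g :* h)) := (a :* (b :* c)) :* (f′ :* (g′ :* h′)) :+
        (c :* (a :* b :* (f :- f′) :* (g :* h)) :+ (b :* (a :* c :* (g :- g′) :* (f′ :* h)) :+ a :* (b :* c :* (h :- h′) :* (f′ :* g′)))))
      refl (α u) (β v) (γ w) (f u v) (g u w) (h v w) (f′ u v) (g′ u w) (h′ v w)
    S₁≤ : ∑³ S₁ ≤ℚ M * E
    S₁≤ = ℚ.≤-trans (ℚ.≤-reflexive (trans (∑³-swap₂₃ S₁) (∑³-swap₁₂ (λ u w v → S₁ u v w))))
      (outer-bound {κ = λ u v → α u * β v * (f u v - f′ u v)} 0≤γ ∑γ≤M 0≤E cutf (λ w u → g∈ u w) (λ w v → h∈ v w))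
    S₂≤ : ∑³ S₂ ≤ℚ M * E
    S₂≤ = ℚ.≤-trans (ℚ.≤-reflexive (∑³-swap₁₂ S₂))
      (outer-bound {κ = λ u w → α u * γ w * (g u w - g′ u w)} 0≤β ∑β≤M 0≤E cutg (λ v u → f′∈ u v) (λ v w → h∈ v w))
    S₃≤ : ∑³ S₃ ≤ℚ M * E
    S₃≤ = outer-bound {κ = λ v w → β v * γ w * (h v w - h′ v w)} 0≤α ∑α≤M 0≤E cuth (λ u v → f′∈ u v) (λ u w → g′∈ u w)

-- Energy increment

Measures : ℕ → ℕ → Set
Measures R n = Fin R → Fin n → ℚ

pairing : (Fin n → Fin n → ℚ) → (Fin n → ℚ) → (Fin n → ℚ) → ℚ
pairing κ μ ν = ∑ λ u → ∑ λ v → (μ u * ν v) * κ u v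

_·ᵖ_ : (Fin n → ℚ) → (Fin n → ℚ) → Fin n → ℚ
(μ ·ᵖ f) u = μ u * f u

∑∑-linear : ∀ c (F G : Fin m → Fin n → ℚ) →
  ∑ (λ u → ∑ λ v → F u v + c * G u v) ≡ ∑ (λ u → ∑ λ v → F u v) + c * ∑ (λ u → ∑ λ v → G u v)
∑∑-linear c F G = trans
  (∑-cong λ u → trans (∑-+ (F u) (λ v → c * G u v)) (cong₂ _+_ (refl {x = ∑ (F u)}) (∑-pull c (G u))))
  (trans (∑-+ (λ u → ∑ (F u)) (λ u → c * ∑ (G u))) (cong₂ _+_ (refl {x = ∑ λ u → ∑ (F u)}) (∑-pull c (λ u → ∑ (G u)))))

sign : Bool → ℚ
sign true  = 1ℚ
sign false = - 1ℚ

-- The indicator leaves every measure except the `i`-th unchanged, so that all measures obey a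
-- single formula.
tilt : Measures R n → Fin R → (Fin n → ℚ) → ℚ → Measures R n
tilt M i f s k u = M k u * (1ℚ + s * (𝟙 (i ≡ᵇ k) * f u))

≡ᵇ-refl : (i : Fin n) → 𝟙 (i ≡ᵇ i) ≡ 1ℚ
≡ᵇ-refl i = cong 𝟙 (dec-true (i Fin.≟ i) refl)

≡ᵇ-≢ : {i j : Fin n} → i ≢ j → 𝟙 (i ≡ᵇ j) ≡ 0ℚ
≡ᵇ-≢ {i = i} {j} i≢j = cong 𝟙 (dec-false (i Fin.≟ j) i≢j)

tilt-≢ : ∀ (M : Measures R n) {i k} f s → i ≢ k → ∀ u → tilt M i f s k u ≡ M k u
tilt-≢ M {i} {k} f s i≢k u = trans (cong (λ z → M k u * (1ℚ + s * (z * f u))) (≡ᵇ-≢ i≢k))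
  (solve 3 (λ m s f → m :* (con 1ℚ :+ s :* (con 0ℚ :* f)) := m) refl (M k u) s (f u))

tilt-≡ : ∀ (M : Measures R n) i f s u → tilt M i f s i u ≡ M i u * (1ℚ + s * f u)
tilt-≡ M i f s u = trans (cong (λ z → M i u * (1ℚ + s * (z * f u))) (≡ᵇ-refl i))
  (cong (λ z → M i u * (1ℚ + s * z)) (ℚ.*-identityˡ (f u)))

toℕ-<⇒≢ : {i j : Fin n} → toℕ i ℕ.< toℕ j → i ≢ j
toℕ-<⇒≢ i<j refl = ℕ.<-irrefl refl i<j

module _ {n r} (κ : Fin r → Fin n → Fin n → ℚ) (κ∈ : ∀ a u v → In01 (κ a u v)) where

  -- Summing over `k` before `l` keeps the two measures of a pair distinct and reads colours in the
  -- direction of the ordering.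
  energy : Measures R n → ℚ
  energy M = ∑ λ k → ∑ λ l → 𝟙 (toℕ k <ᵇ toℕ l) * ∑ λ a → square (pairing (κ a) (M k) (M l))

  -- The derivative of the pairing of `k` and `l` in the tilt parameter. For `k ≠ l` at most one of
  -- the two terms is present.
  slope : Measures R n → Fin R → (Fin n → ℚ) → Fin R → Fin R → Fin r → ℚ
  slope M i f k l a = 𝟙 (i ≡ᵇ k) * pairing (κ a) (M k ·ᵖ f) (M l) + 𝟙 (i ≡ᵇ l) * pairing (κ a) (M k) (M l ·ᵖ f)

  -- At most one of the two measures of a pair k < l is tilted, so the pairing is affine in s.
  pairing-tilt : ∀ (M : Measures R n) i f s {k l} → toℕ k ℕ.< toℕ l → ∀ a →
    pairing (κ a) (tilt M i f s k) (tilt M i f s l) ≡ pairing (κ a) (M k) (M l) + s * slope M i f k l a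
  pairing-tilt M i f s {k} {l} k<l a = begin
    pairing (κ a) (tilt M i f s k) (tilt M i f s l)
      ≡⟨ ∑-cong (λ u → ∑-cong λ v → expand u v) ⟩
    ∑ (λ u → ∑ λ v → (M k u * M l v) * κ a u v + s * (A u v + δˡ * B u v))
      ≡⟨ ∑∑-linear s (λ u v → (M k u * M l v) * κ a u v) (λ u v → A u v + δˡ * B u v) ⟩
    D + s * ∑ (λ u → ∑ λ v → A u v + δˡ * B u v)
      ≡⟨ cong (λ z → D + s * z) (∑∑-linear δˡ A B) ⟩
    D + s * (∑ (λ u → ∑ (A u)) + δˡ * ∑ (λ u → ∑ (B u)))
      ≡⟨ cong (λ z → D + s * (z + δˡ * ∑ (λ u → ∑ (B u)))) (trans (∑-cong λ u → ∑-pull δᵏ (A′ u)) (∑-pull δᵏ (λ u → ∑ (A′ u)))) ⟩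
    D + s * slope M i f k l a ∎
    where
    open ≡-Reasoning
    D = pairing (κ a) (M k) (M l)
    δᵏ = 𝟙 (i ≡ᵇ k)
    δˡ = 𝟙 (i ≡ᵇ l)
    A A′ B : Fin n → Fin n → ℚ
    A′ u v = ((M k u * f u) * M l v) * κ a u v
    A u v = δᵏ * A′ u v
    B u v = (M k u * (M l v * f v)) * κ a u v
    δδ≡0 : δᵏ * δˡ ≡ 0ℚ
    δδ≡0 with i Fin.≟ k
    ... | no _     = ℚ.*-zeroˡ δˡ
    ... | yes refl = trans (ℚ.*-identityˡ δˡ) (≡ᵇ-≢ (toℕ-<⇒≢ k<l))
    expand : ∀ u v → (tilt M i f s k u * tilt M i f s l v) * κ a u v ≡ (M k u * M l v) * κ a u v + s * (A u v + δˡ * B u v)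
    expand u v = trans
      (solve 8 (λ m m′ f f′ s d d′ c →
        ((m :* (con 1ℚ :+ s :* (d :* f))) :* (m′ :* (con 1ℚ :+ s :* (d′ :* f′)))) :* c :=
        ((m :* m′) :* c :+ s :* (d :* (((m :* f) :* m′) :* c) :+ d′ :* ((m :* (m′ :* f′)) :* c))) :+ (d :* d′) :* (s :* s :* m :* m′ :* f :* f′ :* c))
        refl (M k u) (M l v) (f u) (f v) s δᵏ δˡ (κ a u v))
      (trans (cong (λ z → ((M k u * M l v) * κ a u v + s * (A u v + δˡ * B u v)) + z * X) δδ≡0)
        (trans (cong₂ _+_ (refl {x = Y}) (ℚ.*-zeroˡ X)) (ℚ.+-identityʳ Y)))
      where
      X = s * s * M k u * M l v * f u * f v * κ a u v
      Y = (M k u * M l v) * κ a u v + s * (A u v + δˡ * B u v)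

  -- By `pairing-tilt` every pairing moves from D to D ± S, and (D + S)² + (D - S)² = 2D² + 2S².
  -- Neither sign alone is known to raise the energy, but the two together do. Of all the squares S²
  -- only the one at `k`, `l`, `a` is kept.
  energy-tilt : ∀ (M : Measures R n) i f {k l} a → toℕ k ℕ.< toℕ l →
    2ℚ * energy M + 2ℚ * square (slope M i f k l a) ≤ℚ energy (tilt M i f 1ℚ) + energy (tilt M i f (- 1ℚ))
  energy-tilt {R} M i f {k} {l} a k<l = begin
    2ℚ * energy M + 2ℚ * square (slope M i f k l a)
      ≤⟨ ℚ.+-monoʳ-≤ (2ℚ * energy M) (*-monoˡ {2ℚ} (ℚ.nonNegative⁻¹ 2ℚ) slope≤) ⟩
    2ℚ * energy M + 2ℚ * ∑ (λ k → ∑ λ l → G k l)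
      ≡⟨ solve 2 (λ e g → con 2ℚ :* e :+ con 2ℚ :* g := con 2ℚ :* (e :+ con 1ℚ :* g)) refl (energy M) (∑ λ k → ∑ λ l → G k l) ⟩
    2ℚ * (energy M + 1ℚ * ∑ (λ k → ∑ λ l → G k l))
      ≡⟨ cong (2ℚ *_) (∑∑-linear 1ℚ (W M) G) ⟨
    2ℚ * ∑ (λ k → ∑ λ l → W M k l + 1ℚ * G k l)
      ≡⟨ trans (∑-cong λ k → ∑-pull 2ℚ (λ l → W M k l + 1ℚ * G k l)) (∑-pull 2ℚ (λ k → ∑ λ l → W M k l + 1ℚ * G k l)) ⟨
    ∑ (λ k → ∑ λ l → 2ℚ * (W M k l + 1ℚ * G k l))
      ≡⟨ ∑-cong (λ k → ∑-cong λ l → parallelogram k l) ⟩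
    ∑ (λ k → ∑ λ l → W M⁺ k l + 1ℚ * W M⁻ k l)
      ≡⟨ ∑∑-linear 1ℚ (W M⁺) (W M⁻) ⟩
    energy M⁺ + 1ℚ * energy M⁻
      ≡⟨ cong₂ _+_ (refl {x = energy M⁺}) (ℚ.*-identityˡ (energy M⁻)) ⟩
    energy M⁺ + energy M⁻ ∎
    where
    open ℚ.≤-Reasoning
    M⁺ M⁻ : Measures R n
    M⁺ = tilt M i f 1ℚ
    M⁻ = tilt M i f (- 1ℚ)
    W : Measures R n → Fin R → Fin R → ℚ
    W M k l = 𝟙 (toℕ k <ᵇ toℕ l) * ∑ λ a → square (pairing (κ a) (M k) (M l))
    S : Fin R → Fin R → Fin r → ℚ
    S k l a = square (slope M i f k l a)
    G : Fin R → Fin R → ℚ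
    G k l = 𝟙 (toℕ k <ᵇ toℕ l) * ∑ (S k l)
    0≤G : ∀ k l → 0ℚ ≤ℚ G k l
    0≤G k l = 0≤* (0≤𝟙 (toℕ k <ᵇ toℕ l)) (0≤∑ λ a → 0≤square (slope M i f k l a))
    slope≤ : square (slope M i f k l a) ≤ℚ ∑ (λ k → ∑ λ l → G k l)
    slope≤ = begin
      S k l a                    ≤⟨ term≤∑ (λ a → 0≤square (slope M i f k l a)) a ⟩
      ∑ (S k l)                  ≡⟨ ℚ.*-identityˡ (∑ (S k l)) ⟨
      1ℚ * ∑ (S k l)             ≡⟨ cong (λ z → 𝟙 z * ∑ (S k l)) (Equivalence.to T-≡ (ℕ.<⇒<ᵇ k<l)) ⟨
      G k l                      ≤⟨ term≤∑ (0≤G k) l ⟩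
      ∑ (G k)                    ≤⟨ term≤∑ (λ k → 0≤∑ (0≤G k)) k ⟩
      ∑ (λ k → ∑ λ l → G k l)    ∎
    parallelogram : ∀ k l → 2ℚ * (W M k l + 1ℚ * G k l) ≡ W M⁺ k l + 1ℚ * W M⁻ k l
    parallelogram k l = trans
      (solve 3 (λ d x y → con 2ℚ :* (d :* x :+ con 1ℚ :* (d :* y)) := d :* (con 2ℚ :* (x :+ con 1ℚ :* y))) refl
        δ (∑ (Q M)) (∑ (S k l)))
      (trans (guard (toℕ k <ᵇ toℕ l) λ lt → sums (ℕ.<ᵇ⇒< (toℕ k) (toℕ l) lt))
        (solve 3 (λ d x y → d :* (x :+ con 1ℚ :* y) := d :* x :+ con 1ℚ :* (d :* y)) refl δ (∑ (Q M⁺)) (∑ (Q M⁻))))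
      where
      δ = 𝟙 (toℕ k <ᵇ toℕ l)
      Q : Measures R n → Fin r → ℚ
      Q M a = square (pairing (κ a) (M k) (M l))
      guard : ∀ b {x y} → (T b → x ≡ y) → 𝟙 b * x ≡ 𝟙 b * y
      guard true          x≡y = cong (1ℚ *_) (x≡y tt)
      guard false {x} {y} _   = trans (ℚ.*-zeroˡ x) (sym (ℚ.*-zeroˡ y))
      ∑-1* : ∀ (f g : Fin r → ℚ) → ∑ (λ a → f a + 1ℚ * g a) ≡ ∑ f + 1ℚ * ∑ g
      ∑-1* f g = trans (∑-+ f (λ a → 1ℚ * g a)) (cong₂ _+_ (refl {x = ∑ f}) (∑-pull 1ℚ g))
      sums : toℕ k ℕ.< toℕ l → 2ℚ * (∑ (Q M) + 1ℚ * ∑ (S k l)) ≡ ∑ (Q M⁺) + 1ℚ * ∑ (Q M⁻)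
      sums k<l = trans (cong (2ℚ *_) (sym (∑-1* (Q M) (S k l)))) (trans (sym (∑-pull 2ℚ (λ a → Q M a + 1ℚ * S k l a)))
        (trans (∑-cong λ a → trans
          (solve 2 (λ d e → con 2ℚ :* (d :* d :+ con 1ℚ :* (e :* e)) :=
             (d :+ con 1ℚ :* e) :* (d :+ con 1ℚ :* e) :+ con 1ℚ :* ((d :+ con (- 1ℚ) :* e) :* (d :+ con (- 1ℚ) :* e))) refl
             (pairing (κ a) (M k) (M l)) (slope M i f k l a))
          (sym (cong₂ (λ x y → square x + 1ℚ * square y) (pairing-tilt M i f 1ℚ k<l a) (pairing-tilt M i f (- 1ℚ) k<l a))))
          (∑-1* (Q M⁺) (Q M⁻))))

-- Probability measures and their tilts

record Probability (μ : Fin n → ℚ) : Set where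
  constructor probability
  field
    nonNegative : ∀ u → 0ℚ ≤ℚ μ u
    mass        : ∑ μ ≡ 1ℚ

open Probability

∑∑-product : ∀ (f : Fin m → ℚ) (g : Fin n → ℚ) → ∑ (λ u → ∑ λ v → f u * g v) ≡ ∑ f * ∑ g
∑∑-product f g = trans (∑-cong λ u → trans (∑-pull (f u) g) (ℚ.*-comm (f u) (∑ g)))
  (trans (∑-pull (∑ g) f) (ℚ.*-comm (∑ g) (∑ f)))

weighted-01 : ∀ {μ X : Fin n → ℚ} → Probability μ → (∀ u → In01 (X u)) → In01 (∑ (μ ·ᵖ X))
weighted-01 {μ = μ} {X} μ-prob X∈ = 0≤∑ (λ u → 0≤* (nonNegative μ-prob u) (proj₁ (X∈ u))) , (begin
  ∑ (λ u → μ u * X u)  ≤⟨ ∑-mono (λ u → *-monoˡ (nonNegative μ-prob u) (proj₂ (X∈ u))) ⟩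
  ∑ (λ u → μ u * 1ℚ)   ≡⟨ ∑-cong (λ u → ℚ.*-identityʳ (μ u)) ⟩
  ∑ μ                  ≡⟨ mass μ-prob ⟩
  1ℚ                   ∎)
  where open ℚ.≤-Reasoning

pairing-01 : ∀ {κ : Fin n → Fin n → ℚ} {μ ν} → (∀ u v → In01 (κ u v)) → Probability μ → Probability ν → In01 (pairing κ μ ν)
pairing-01 {κ = κ} {μ} {ν} κ∈ μ-prob ν-prob = subst In01
  (∑-cong λ u → trans (sym (∑-pull (μ u) (λ v → ν v * κ u v))) (∑-cong λ v → sym (ℚ.*-assoc (μ u) (ν v) (κ u v))))
  (weighted-01 μ-prob λ u → weighted-01 ν-prob (κ∈ u))

Within1 : Pred ℚ 0ℓ
Within1 x = - 1ℚ ≤ℚ x × x ≤ℚ 1ℚ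

sign-Within1 : ∀ b {x} → Within1 x → Within1 (sign b * x)
sign-Within1 true  {x} w = subst Within1 (sym (ℚ.*-identityˡ x)) w
sign-Within1 false {x} (-1≤x , x≤1) = subst Within1 (solve 1 (λ x → :- x := con (- 1ℚ) :* x) refl x)
  (ℚ.neg-antimono-≤ x≤1 , ℚ.neg-antimono-≤ -1≤x)

𝟙-Within1 : ∀ b {x} → Within1 x → Within1 (𝟙 b * x)
𝟙-Within1 true  {x} w = subst Within1 (sym (ℚ.*-identityˡ x)) w
𝟙-Within1 false {x} w = subst Within1 (sym (ℚ.*-zeroˡ x)) (ℚ.<⇒≤ (ℚ.negative⁻¹ (- 1ℚ)) , 0≤1)

01-difference : ∀ {p q} → In01 p → In01 q → Within1 (p - q)
01-difference {p} {q} (0≤p , p≤1) (0≤q , q≤1) =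
  subst (_≤ℚ p - q) (ℚ.+-identityˡ (- 1ℚ)) (ℚ.+-mono-≤ 0≤p (ℚ.neg-antimono-≤ q≤1)) ,
  subst (p - q ≤ℚ_) (ℚ.+-identityʳ 1ℚ) (ℚ.+-mono-≤ p≤1 (ℚ.neg-antimono-≤ 0≤q))

-- Mean zero keeps the total mass equal to one under a tilt, and values within [-1,1] keep the
-- factor 1 ± f between 0 and 2.
centred : (Fin n → ℚ) → (Fin n → ℚ) → Fin n → ℚ
centred μ X u = X u - ∑ (μ ·ᵖ X)

centred-mean : ∀ {μ : Fin n → ℚ} X → Probability μ → ∑ (μ ·ᵖ centred μ X) ≡ 0ℚ
centred-mean {μ = μ} X μ-prob = begin
  ∑ (λ u → μ u * (X u - p))          ≡⟨ ∑-cong (λ u → solve 3 (λ m x p → m :* (x :- p) := con 1ℚ :* (m :* x) :+ (:- p) :* m) refl (μ u) (X u) p) ⟩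
  ∑ (λ u → 1ℚ * (μ u * X u) + (- p) * μ u) ≡⟨ ∑-linear 1ℚ (- p) (μ ·ᵖ X) μ ⟩
  1ℚ * p + (- p) * ∑ μ               ≡⟨ cong (λ z → 1ℚ * p + (- p) * z) (mass μ-prob) ⟩
  1ℚ * p + (- p) * 1ℚ                ≡⟨ solve 1 (λ p → con 1ℚ :* p :+ (:- p) :* con 1ℚ := con 0ℚ) refl p ⟩
  0ℚ                                 ∎
  where
  open ≡-Reasoning
  p = ∑ (μ ·ᵖ X)

-- Domination has two purposes: it confines `M k` to the support of `b k`, so that the intervals
-- keep their order, and it bounds the peaks of `M k`.
record Dominated (b : Measures R n) (B : ℚ) (M : Measures R n) : Set where
  constructor dominated
  field
    prob  : ∀ k → Probability (M k)
    upper : ∀ k u → M k u ≤ℚ B * b k u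

open Dominated

tilt-dominated : ∀ {b : Measures R n} {B M} i f s → Dominated b B M → (∀ u → Within1 (f u)) → ∑ (M i ·ᵖ f) ≡ 0ℚ →
  Dominated b (2ℚ * B) (tilt M i f (sign s))
tilt-dominated {b = b} {B} {M} i f s dom f∈ mean≡0 = dominated
  (λ k → probability
    (λ u → 0≤* (nonNegative (prob dom k) u) (subst (_≤ℚ 1ℚ + x k u) (ℚ.+-inverseʳ 1ℚ) (ℚ.+-monoʳ-≤ 1ℚ (proj₁ (x∈ k u)))))
    (begin-equality
      ∑ (λ u → M k u * (1ℚ + x k u))
        ≡⟨ ∑-cong (λ u → solve 4 (λ m s d f → m :* (con 1ℚ :+ s :* (d :* f)) := con 1ℚ :* m :+ (s :* d) :* (m :* f)) refl (M k u) (sign s) (𝟙 (i ≡ᵇ k)) (f u)) ⟩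
      ∑ (λ u → 1ℚ * M k u + (sign s * 𝟙 (i ≡ᵇ k)) * (M k u * f u))
        ≡⟨ ∑-linear 1ℚ (sign s * 𝟙 (i ≡ᵇ k)) (M k) (M k ·ᵖ f) ⟩
      1ℚ * ∑ (M k) + (sign s * 𝟙 (i ≡ᵇ k)) * ∑ (M k ·ᵖ f)
        ≡⟨ cong₂ _+_ (cong (1ℚ *_) (mass (prob dom k))) (δmean k) ⟩
      1ℚ * 1ℚ + 0ℚ ∎))
  (λ k u → begin
    M k u * (1ℚ + x k u)  ≤⟨ *-monoˡ (nonNegative (prob dom k) u) (ℚ.+-monoʳ-≤ 1ℚ (proj₂ (x∈ k u))) ⟩
    M k u * 2ℚ            ≤⟨ *-monoʳ (ℚ.nonNegative⁻¹ 2ℚ) (upper dom k u) ⟩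
    B * b k u * 2ℚ        ≡⟨ solve 2 (λ B b → B :* b :* con 2ℚ := con 2ℚ :* B :* b) refl B (b k u) ⟩
    2ℚ * B * b k u        ∎)
  where
  open ℚ.≤-Reasoning
  x : Fin _ → Fin _ → ℚ
  x k u = sign s * (𝟙 (i ≡ᵇ k) * f u)
  x∈ : ∀ k u → Within1 (x k u)
  x∈ k u = sign-Within1 s (𝟙-Within1 (i ≡ᵇ k) (f∈ u))
  δmean : ∀ k → (sign s * 𝟙 (i ≡ᵇ k)) * ∑ (M k ·ᵖ f) ≡ 0ℚ
  δmean k with i Fin.≟ k
  ... | yes refl = trans (cong ((sign s * 1ℚ) *_) mean≡0) (ℚ.*-zeroʳ (sign s * 1ℚ))
  ... | no _     = solve 2 (λ s m → (s :* con 0ℚ) :* m := con 0ℚ) refl (sign s) (∑ (M k ·ᵖ f))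

-- Each step makes two tilts, and a tilt at most doubles a measure. The accumulating form agrees
-- definitionally with the recursive call in `regularity`.
quadruple : ℕ → ℚ → ℚ
quadruple ℕ.zero    B = B
quadruple (ℕ.suc s) B = quadruple s (2ℚ * (2ℚ * B))

private
  B≤4B : ∀ {B} → 0ℚ ≤ℚ B → B ≤ℚ 2ℚ * (2ℚ * B)
  B≤4B {B} 0≤B = ≤-offset (3ℚ * B) (0≤* (ℚ.nonNegative⁻¹ 3ℚ) 0≤B)
    (solve 1 (λ B → B :+ con 3ℚ :* B := con 2ℚ :* (con 2ℚ :* B)) refl B)

≤-quadruple : ∀ s {B} → 0ℚ ≤ℚ B → B ≤ℚ quadruple s B
≤-quadruple ℕ.zero    0≤B = ℚ.≤-refl
≤-quadruple (ℕ.suc s) 0≤B = ℚ.≤-trans (B≤4B 0≤B) (≤-quadruple s (ℚ.≤-trans 0≤B (B≤4B 0≤B)))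

some-≥-average : ∀ {a b c d x} → x + (x + (x + x)) ≤ℚ a + (b + (c + d)) → x ≤ℚ a ⊎ x ≤ℚ b ⊎ x ≤ℚ c ⊎ x ≤ℚ d
some-≥-average {a} {b} {c} {d} {x} avg with x ℚ.≤? a | x ℚ.≤? b | x ℚ.≤? c | x ℚ.≤? d
... | yes p | _ | _ | _ = inj₁ p
... | no _ | yes p | _ | _ = inj₂ (inj₁ p)
... | no _ | no _ | yes p | _ = inj₂ (inj₂ (inj₁ p))
... | no _ | no _ | no _ | yes p = inj₂ (inj₂ (inj₂ p))
... | no p | no q | no r | no s = contradiction (ℚ.<-≤-trans
  (ℚ.+-mono-< (ℚ.≰⇒> p) (ℚ.+-mono-< (ℚ.≰⇒> q) (ℚ.+-mono-< (ℚ.≰⇒> r) (ℚ.≰⇒> s)))) avg) (ℚ.<-irrefl refl)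

-- Irregular pairs raise the energy

module _ {n r} (κ : Fin r → Fin n → Fin n → ℚ) (κ∈ : ∀ a u v → In01 (κ a u v)) where

  deviation : (μ ν : Fin n → ℚ) → Fin r → Fin n → Fin n → ℚ
  deviation μ ν a u v = μ u * ν v * (κ a u v - pairing (κ a) μ ν)

  Regular : ℚ → Measures R n → Set
  Regular ε M = ∀ {k l} → toℕ k ℕ.< toℕ l → ∀ a → CutBounded (deviation (M k) (M l) a) ε

  energy-bound : ∀ {M : Measures R n} → (∀ k → Probability (M k)) → energy κ κ∈ M ≤ℚ natℚ R * (natℚ R * natℚ r)
  energy-bound {R} {M} M-prob = ∑-bound (natℚ R * natℚ r) λ k → ∑-bound (natℚ r) λ l →
    ℚ.≤-trans (*-mono (0≤𝟙 (toℕ k <ᵇ toℕ l)) (0≤nat r) (proj₂ (01-𝟙 (toℕ k <ᵇ toℕ l)))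
      (ℚ.≤-trans (∑-bound 1ℚ λ a → proj₂ (01-* (D∈ k l a) (D∈ k l a))) (ℚ.≤-reflexive (ℚ.*-identityʳ (natℚ r)))))
      (ℚ.≤-reflexive (ℚ.*-identityˡ (natℚ r)))
    where
    D∈ : ∀ k l a → In01 (pairing (κ a) (M k) (M l))
    D∈ k l a = pairing-01 (κ∈ a) (M-prob k) (M-prob l)

  -- Write X = f + p and Y = g + q with means `p` and `q`. Of the four products, the constant one
  -- contributes pq times the density of the pair, and this is exactly what the subtracted mean
  -- removes.
  cut-decomposition : ∀ μ ν a X Y → let f = centred μ X; g = centred ν Y in
    cutSum (deviation μ ν a) X Y ≡
    pairing (κ a) (μ ·ᵖ f) (ν ·ᵖ g) + ∑ (ν ·ᵖ Y) * pairing (κ a) (μ ·ᵖ f) ν + ∑ (μ ·ᵖ X) * pairing (κ a) μ (ν ·ᵖ g)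
  cut-decomposition μ ν a X Y = begin
    cutSum (deviation μ ν a) X Y
      ≡⟨ ∑-cong (λ u → ∑-cong λ v → solve 8 (λ m n k d x y p q →
           (m :* n :* (k :- d)) :* (x :* y) :=
           (((((m :* (x :- p)) :* (n :* (y :- q))) :* k :+ q :* (((m :* (x :- p)) :* n) :* k)) :+ p :* ((m :* (n :* (y :- q))) :* k))
             :+ (p :* q) :* ((m :* n) :* k)) :+ (:- d) :* ((m :* x) :* (n :* y)))
           refl (μ u) (ν v) (κ a u v) D (X u) (Y v) p q) ⟩
    ∑ (λ u → ∑ λ v → (((C₀ u v + q * A u v) + p * B u v) + (p * q) * K u v) + (- D) * P u v)
      ≡⟨ ∑∑-linear (- D) (λ u v → ((C₀ u v + q * A u v) + p * B u v) + (p * q) * K u v) P ⟩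
    ∑ (λ u → ∑ λ v → ((C₀ u v + q * A u v) + p * B u v) + (p * q) * K u v) + (- D) * ∑ (λ u → ∑ (P u))
      ≡⟨ cong₂ (λ x y → x + (- D) * y) (trans (∑∑-linear (p * q) (λ u v → (C₀ u v + q * A u v) + p * B u v) K)
           (cong (_+ (p * q) * D) (trans (∑∑-linear p (λ u v → C₀ u v + q * A u v) B)
             (cong (_+ p * ∑ (λ u → ∑ (B u))) (∑∑-linear q C₀ A))))) (∑∑-product (μ ·ᵖ X) (ν ·ᵖ Y)) ⟩
    (((ΣC + q * ΣA) + p * ΣB) + (p * q) * D) + (- D) * (p * q)
      ≡⟨ solve 3 (λ x d pq → (x :+ pq :* d) :+ (:- d) :* pq := x) refl ((ΣC + q * ΣA) + p * ΣB) D (p * q) ⟩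
    ΣC + q * ΣA + p * ΣB ∎
    where
    open ≡-Reasoning
    p = ∑ (μ ·ᵖ X)
    q = ∑ (ν ·ᵖ Y)
    f = centred μ X
    g = centred ν Y
    D = pairing (κ a) μ ν
    A B C₀ K P : Fin n → Fin n → ℚ
    C₀ u v = ((μ ·ᵖ f) u * (ν ·ᵖ g) v) * κ a u v
    A u v = ((μ ·ᵖ f) u * ν v) * κ a u v
    B u v = (μ u * (ν ·ᵖ g) v) * κ a u v
    K u v = (μ u * ν v) * κ a u v
    P u v = (μ ·ᵖ X) u * (ν ·ᵖ Y) v
    ΣA = ∑ λ u → ∑ (A u)
    ΣB = ∑ λ u → ∑ (B u)
    ΣC = ∑ λ u → ∑ (C₀ u)

module _ {n r} (κ : Fin r → Fin n → Fin n → ℚ) (κ∈ : ∀ a u v → In01 (κ a u v)) where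

  private
    -- Cauchy-Schwarz for three terms: 3(x² + y² + z²) exceeds (x + y + z)² by the squares of the
    -- three differences. The factors `p` and `q` in [0,1] can only shrink a square.
    square-sum≤ : ∀ {ε} a b c {p q} → 0ℚ ≤ℚ ε → In01 p → In01 q → ε ≤ℚ c + q * a + p * b →
      square ε ≤ℚ 3ℚ * (square a + square b + square c)
    square-sum≤ {ε} a b c {p} {q} 0≤ε p∈ q∈ ε≤Δ = begin
      ε * ε
        ≤⟨ *-mono 0≤ε (ℚ.≤-trans 0≤ε ε≤Δ) ε≤Δ ε≤Δ ⟩
      Δ * Δ
        ≤⟨ ≤-offset (square (c - q * a) + (square (q * a - p * b) + square (c - p * b)))
             (0≤+ (0≤square (c - q * a)) (0≤+ (0≤square (q * a - p * b)) (0≤square (c - p * b))))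
             (solve 3 (λ x y z → (x :+ y :+ z) :* (x :+ y :+ z) :+ ((x :- y) :* (x :- y) :+ ((y :- z) :* (y :- z) :+ (x :- z) :* (x :- z)))
                := con 3ℚ :* (y :* y :+ z :* z :+ x :* x)) refl c (q * a) (p * b)) ⟩
      3ℚ * (square (q * a) + square (p * b) + square c)
        ≤⟨ *-monoˡ {3ℚ} (ℚ.nonNegative⁻¹ 3ℚ) (ℚ.+-monoˡ-≤ (square c) (ℚ.+-mono-≤ (scale q∈ a) (scale p∈ b))) ⟩
      3ℚ * (square a + square b + square c) ∎
      where
      open ℚ.≤-Reasoning
      Δ = c + q * a + p * b
      scale : ∀ {q} → In01 q → ∀ a → square (q * a) ≤ℚ square a
      scale {q} q∈ a = begin
        (q * a) * (q * a)  ≡⟨ solve 2 (λ q a → (q :* a) :* (q :* a) := (q :* q) :* (a :* a)) refl q a ⟩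
        (q * q) * (a * a)  ≤⟨ *-monoʳ (0≤square a) (proj₂ (01-* q∈ q∈)) ⟩
        1ℚ * (a * a)       ≡⟨ ℚ.*-identityˡ (a * a) ⟩
        a * a              ∎

  -- By `cut-decomposition` the irregularity is a combination of `Kf`, `Kg` and `Kfg`, hence Kf² +
  -- Kg² + Kfg² ≥ ε²/3 = `gain`. Tilting `l` by ±g gains Kg² on average. After that, tilting `k` by
  -- ±f has slope Kf ± Kfg, and these squares average to Kf² + Kfg². So the four sign choices gain
  -- at least `gain` on average, and one of them reaches it.
  energy-increment : ∀ {M : Measures R n} {ε gain} → 0ℚ ≤ℚ ε → 3ℚ * gain ≡ square ε → (∀ k → Probability (M k)) →
    ∀ {k l} → toℕ k ℕ.< toℕ l → ∀ a X Y → (∀ u → In01 (X u)) → (∀ v → In01 (Y v)) →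
    ε ≤ℚ cutSum (deviation κ κ∈ (M k) (M l) a) X Y →
    let f = centred (M k) X; g = centred (M l) Y in
    ∃[ s ] ∃[ s′ ] energy κ κ∈ M + gain ≤ℚ energy κ κ∈ (tilt (tilt M l g (sign s′)) k f (sign s))
  energy-increment {R} {M} {ε} {gain} 0≤ε gain≡ M-prob {k} {l} k<l a X Y X∈ Y∈ ε≤ =
    pick (some-≥-average average)
    where
    f = centred (M k) X
    g = centred (M l) Y
    p∈ = weighted-01 (M-prob k) X∈
    q∈ = weighted-01 (M-prob l) Y∈
    Kf = pairing (κ a) (M k ·ᵖ f) (M l)
    Kg = pairing (κ a) (M k) (M l ·ᵖ g)
    Kfg = pairing (κ a) (M k ·ᵖ f) (M l ·ᵖ g)
    M₁ : Bool → Measures R n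
    M₁ s′ = tilt M l g (sign s′)
    e₀ = energy κ κ∈ M
    e₁ : Bool → ℚ
    e₁ s′ = energy κ κ∈ (M₁ s′)
    e₂ : Bool → Bool → ℚ
    e₂ s′ s = energy κ κ∈ (tilt (M₁ s′) k f (sign s))
    gain≤ : gain ≤ℚ square Kf + square Kg + square Kfg
    gain≤ = *-cancelˡ-≤ {3ℚ} (ℚ.positive⁻¹ 3ℚ) (subst (_≤ℚ 3ℚ * (square Kf + square Kg + square Kfg)) (sym gain≡)
      (square-sum≤ Kf Kg Kfg 0≤ε p∈ q∈ (subst (ε ≤ℚ_) (cut-decomposition κ κ∈ (M k) (M l) a X Y) ε≤)))
    k≢l = toℕ-<⇒≢ k<l
    slope₁ : slope κ κ∈ M l g k l a ≡ Kg
    slope₁ = trans (cong₂ (λ x y → x * pairing (κ a) (M k ·ᵖ g) (M l) + y * Kg) (≡ᵇ-≢ (k≢l ∘ sym)) (≡ᵇ-refl l))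
      (solve 2 (λ x y → con 0ℚ :* x :+ con 1ℚ :* y := y) refl (pairing (κ a) (M k ·ᵖ g) (M l)) Kg)
    slope₂ : ∀ s′ → slope κ κ∈ (M₁ s′) k f k l a ≡ Kf + sign s′ * Kfg
    slope₂ s′ = trans (cong₂ (λ x y → x * K + y * K′) (≡ᵇ-refl k) (≡ᵇ-≢ k≢l))
      (trans (solve 2 (λ x y → con 1ℚ :* x :+ con 0ℚ :* y := x) refl K K′)
        (trans (∑-cong λ u → ∑-cong λ v → trans
            (cong₂ (λ x y → x * f u * y * κ a u v) (tilt-≢ M g (sign s′) (k≢l ∘ sym) u) (tilt-≡ M l g (sign s′) v))
            (solve 6 (λ m n f g s c → m :* f :* (n :* (con 1ℚ :+ s :* g)) :* c := ((m :* f) :* n) :* c :+ s :* (((m :* f) :* (n :* g)) :* c)) refl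
              (M k u) (M l v) (f u) (g v) (sign s′) (κ a u v)))
          (∑∑-linear (sign s′) (λ u v → ((M k ·ᵖ f) u * M l v) * κ a u v) (λ u v → ((M k ·ᵖ f) u * (M l ·ᵖ g) v) * κ a u v))))
      where
      K  = pairing (κ a) (M₁ s′ k ·ᵖ f) (M₁ s′ l)
      K′ = pairing (κ a) (M₁ s′ k) (M₁ s′ l ·ᵖ f)
    step₁ : 2ℚ * e₀ + 2ℚ * square Kg ≤ℚ e₁ true + e₁ false
    step₁ = subst (λ z → 2ℚ * e₀ + 2ℚ * square z ≤ℚ e₁ true + e₁ false) slope₁ (energy-tilt κ κ∈ M l g a k<l)
    step₂ : ∀ s′ → 2ℚ * e₁ s′ + 2ℚ * square (Kf + sign s′ * Kfg) ≤ℚ e₂ s′ true + e₂ s′ false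
    step₂ s′ = subst (λ z → 2ℚ * e₁ s′ + 2ℚ * square z ≤ℚ e₂ s′ true + e₂ s′ false) (slope₂ s′) (energy-tilt κ κ∈ (M₁ s′) k f a k<l)
    average : (e₀ + gain) + ((e₀ + gain) + ((e₀ + gain) + (e₀ + gain))) ≤ℚ
      e₂ true true + (e₂ true false + (e₂ false true + e₂ false false))
    average = begin
      (e₀ + gain) + ((e₀ + gain) + ((e₀ + gain) + (e₀ + gain)))
        ≤⟨ ℚ.+-mono-≤ x≤ (ℚ.+-mono-≤ x≤ (ℚ.+-mono-≤ x≤ x≤)) ⟩
      x + (x + (x + x))
        ≡⟨ solve 4 (λ e a b c → let x = e :+ (a :* a :+ b :* b :+ c :* c) in x :+ (x :+ (x :+ x)) :=
             con 2ℚ :* (con 2ℚ :* e :+ con 2ℚ :* (b :* b)) :+ (con 2ℚ :* ((a :+ con 1ℚ :* c) :* (a :+ con 1ℚ :* c)) :+ con 2ℚ :* ((a :+ con (- 1ℚ) :* c) :* (a :+ con (- 1ℚ) :* c))))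
             refl e₀ Kf Kg Kfg ⟩
      2ℚ * (2ℚ * e₀ + 2ℚ * square Kg) + (2ℚ * square (Kf + 1ℚ * Kfg) + 2ℚ * square (Kf + - 1ℚ * Kfg))
        ≤⟨ ℚ.+-monoˡ-≤ (2ℚ * square (Kf + 1ℚ * Kfg) + 2ℚ * square (Kf + - 1ℚ * Kfg)) (*-monoˡ {2ℚ} (ℚ.nonNegative⁻¹ 2ℚ) step₁) ⟩
      2ℚ * (e₁ true + e₁ false) + (2ℚ * square (Kf + 1ℚ * Kfg) + 2ℚ * square (Kf + - 1ℚ * Kfg))
        ≡⟨ solve 4 (λ x y a b → con 2ℚ :* (x :+ y) :+ (a :+ b) := (con 2ℚ :* x :+ a) :+ (con 2ℚ :* y :+ b)) refl
             (e₁ true) (e₁ false) (2ℚ * square (Kf + 1ℚ * Kfg)) (2ℚ * square (Kf + - 1ℚ * Kfg)) ⟩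
      (2ℚ * e₁ true + 2ℚ * square (Kf + 1ℚ * Kfg)) + (2ℚ * e₁ false + 2ℚ * square (Kf + - 1ℚ * Kfg))
        ≤⟨ ℚ.+-mono-≤ (step₂ true) (step₂ false) ⟩
      (e₂ true true + e₂ true false) + (e₂ false true + e₂ false false)
        ≡⟨ ℚ.+-assoc (e₂ true true) (e₂ true false) (e₂ false true + e₂ false false) ⟩
      e₂ true true + (e₂ true false + (e₂ false true + e₂ false false)) ∎
      where
      open ℚ.≤-Reasoning
      x = e₀ + (square Kf + square Kg + square Kfg)
      x≤ = ℚ.+-monoʳ-≤ e₀ gain≤
    pick : _ → _
    pick (inj₁ h)               = true , true , h
    pick (inj₂ (inj₁ h))        = false , true , h
    pick (inj₂ (inj₂ (inj₁ h))) = true , false , h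
    pick (inj₂ (inj₂ (inj₂ h))) = false , false , h

  -- Stated with an empty conclusion, so that irregularity comes with an explicit witness.
  regularity : ∀ {b : Measures R n} {ε gain} → 0ℚ ≤ℚ ε → 3ℚ * gain ≡ square ε → (∀ k u → 0ℚ ≤ℚ b k u) →
    ∀ s {M B} → 0ℚ ≤ℚ B → Dominated b B M → natℚ R * (natℚ R * natℚ r) <ℚ energy κ κ∈ M + natℚ s * gain →
    ¬ (∀ M′ → Dominated b (quadruple s B) M′ → ¬ Regular κ κ∈ ε M′)
  -- The invariant says that the energy together with the gains still to come exceeds the largest
  -- possible energy. Every increment preserves it, and with no step left it contradicts
  -- `energy-bound`.
  regularity {R} {gain = gain} 0≤ε gain≡ 0≤b ℕ.zero {M} 0≤B dom bound avoid =
    ℚ.<-irrefl refl (ℚ.<-≤-trans (subst (natℚ R * (natℚ R * natℚ r) <ℚ_)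
      (trans (cong (λ z → energy κ κ∈ M + z * gain) natℚ-0) (solve 2 (λ e g → e :+ con 0ℚ :* g := e) refl (energy κ κ∈ M) gain)) bound)
      (energy-bound κ κ∈ (Dominated.prob dom)))
  regularity {R} {b} {ε} {gain} 0≤ε gain≡ 0≤b (ℕ.suc s) {M} {B} 0≤B dom bound avoid =
    avoid M (dominated prob′ (λ k u → ℚ.≤-trans (upper′ k u) (*-monoʳ (0≤b k u) (≤-quadruple (ℕ.suc s) 0≤B)))) regular
    where
    prob′  = Dominated.prob dom
    upper′ = Dominated.upper dom
    regular : Regular κ κ∈ ε M
    -- A single instance of the bound compares two rationals and is decidable; a failing instance
    -- hands its `X` and `Y` to `energy-increment`.
    regular {k} {l} k<l a X Y X∈ Y∈ with cutSum (deviation κ κ∈ (M k) (M l) a) X Y ℚ.≤? ε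
    ... | yes ≤ε = ≤ε
    ... | no ≰ε  = ⊥-elim (continue (energy-increment 0≤ε gain≡ prob′ k<l a X Y X∈ Y∈ (ℚ.<⇒≤ (ℚ.≰⇒> ≰ε))))
      where
      f = centred (M k) X
      g = centred (M l) Y
      f∈ : ∀ u → Within1 (f u)
      f∈ u = 01-difference (X∈ u) (weighted-01 (prob′ k) X∈)
      g∈ : ∀ v → Within1 (g v)
      g∈ v = 01-difference (Y∈ v) (weighted-01 (prob′ l) Y∈)
      continue : ¬ (∃[ s ] ∃[ s′ ] energy κ κ∈ M + gain ≤ℚ energy κ κ∈ (tilt (tilt M l g (sign s′)) k f (sign s)))
      continue (σ , σ′ , increased) = regularity 0≤ε gain≡ 0≤b s
        (0≤* {2ℚ} (ℚ.nonNegative⁻¹ 2ℚ) (0≤* {2ℚ} (ℚ.nonNegative⁻¹ 2ℚ) 0≤B))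
        (tilt-dominated k f σ (tilt-dominated l g σ′ dom g∈ (centred-mean Y (prob′ l))) f∈
          (trans (∑-cong λ u → cong (_* f u) (tilt-≢ M g (sign σ′) (toℕ-<⇒≢ k<l ∘ sym) u)) (centred-mean X (prob′ k))))
        (ℚ.<-≤-trans bound (ℚ.≤-trans (ℚ.≤-reflexive (trans (cong (λ z → energy κ κ∈ M + z * gain) (natℚ-suc s))
          (solve 3 (λ e s g → e :+ (con 1ℚ :+ s) :* g := (e :+ g) :+ s :* g) refl (energy κ κ∈ M) (natℚ s) gain)))
          (ℚ.+-monoˡ-≤ (natℚ s * gain) increased)))
        avoid

-- Ramsey's theorem for lists

AllPairs-resp-⊆ : ∀ {A : Set} {Q : A → A → Set} {xs ys} → ys ⊆ᴸ xs → AllPairs Q xs → AllPairs Q ys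
AllPairs-resp-⊆ []         []         = []
AllPairs-resp-⊆ (_ ∷ʳ τ)   (_ ∷ pxs)  = AllPairs-resp-⊆ τ pxs
AllPairs-resp-⊆ (refl ∷ τ) (px ∷ pxs) = Sublist.All-resp-⊆ τ px ∷ AllPairs-resp-⊆ τ pxs

ramseyNumber : ℕ → ℕ → ℕ
ramseyNumber ℕ.zero    b         = 0
ramseyNumber (ℕ.suc a) ℕ.zero    = 0
ramseyNumber (ℕ.suc a) (ℕ.suc b) = ℕ.suc (ramseyNumber a (ℕ.suc b) ℕ.+ ramseyNumber (ℕ.suc a) b)

-- `AllPairs` relates an element only to later ones and a sublist keeps the order, so `Q` may depend
-- on the direction of a pair, as colour densities do.
HomogeneousSublist : {A : Set} → (A → A → Set) → ℕ → List A → Set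
HomogeneousSublist Q a xs = ∃[ ys ] ys ⊆ᴸ xs × a ≤ length ys × AllPairs Q ys

private
  ⊆-[] : ∀ {A : Set} (xs : List A) → [] ⊆ᴸ xs
  ⊆-[] []       = []
  ⊆-[] (x ∷ xs) = x ∷ʳ ⊆-[] xs

  partition : ∀ {A : Set} {P : A → Set} (P? : ∀ x → Dec (P x)) xs → ∃[ ts ] ∃[ fs ]
    ts ⊆ᴸ xs × fs ⊆ᴸ xs × All P ts × All (¬_ ∘ P) fs × length xs ≡ length ts ℕ.+ length fs
  partition P? []       = [] , [] , [] , [] , [] , [] , refl
  partition P? (x ∷ xs) with P? x | partition P? xs
  ... | yes px | ts , fs , τ , φ , pts , pfs , eq = x ∷ ts , fs , refl ∷ τ , x ∷ʳ φ , px ∷ pts , pfs , cong ℕ.suc eq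
  ... | no ¬px | ts , fs , τ , φ , pts , pfs , eq = ts , x ∷ fs , x ∷ʳ τ , refl ∷ φ , pts , ¬px ∷ pfs ,
    trans (cong ℕ.suc eq) (sym (ℕ.+-suc (length ts) (length fs)))

  +-≤-⊎ : ∀ a b {c d} → a ℕ.+ b ≤ c ℕ.+ d → a ≤ c ⊎ b ≤ d
  +-≤-⊎ a b {c} {d} a+b≤c+d with a ℕ.≤? c
  ... | yes a≤c = inj₁ a≤c
  ... | no a≰c  = inj₂ (ℕ.≮⇒≥ λ d<b → ℕ.<⇒≱ (ℕ.+-mono-< (ℕ.≰⇒> a≰c) d<b) a+b≤c+d)

-- Split the tail by its relation to the head. One of the two parts is long enough for the
-- induction, and a homogeneous list of the matching kind found there is extended by the head.
ramsey : ∀ {A : Set} a b {Q : A → A → Set} (Q? : ∀ x y → Dec (Q x y)) xs → ramseyNumber a b ≤ length xs →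
  HomogeneousSublist Q a xs ⊎ HomogeneousSublist (λ x y → ¬ Q x y) b xs
ramsey ℕ.zero    b         Q? xs _ = inj₁ ([] , ⊆-[] xs , ℕ.z≤n , [])
ramsey (ℕ.suc a) ℕ.zero    Q? xs _ = inj₂ ([] , ⊆-[] xs , ℕ.z≤n , [])
ramsey (ℕ.suc a) (ℕ.suc b) Q? (x ∷ xs) (ℕ.s≤s N≤) with partition (Q? x) xs
... | ts , fs , τ , φ , pts , pfs , eq
  with +-≤-⊎ (ramseyNumber a (ℕ.suc b)) (ramseyNumber (ℕ.suc a) b) (subst (_ ≤_) eq N≤)
...   | inj₁ N≤ts with ramsey a (ℕ.suc b) Q? ts N≤ts
...     | inj₁ (ys , σ , a≤ , Qys) = inj₁ (x ∷ ys , refl ∷ Sublist.⊆-trans σ τ , ℕ.s≤s a≤ , Sublist.All-resp-⊆ σ pts ∷ Qys)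
...     | inj₂ (ys , σ , b≤ , Qys) = inj₂ (ys , x ∷ʳ Sublist.⊆-trans σ τ , b≤ , Qys)
ramsey (ℕ.suc a) (ℕ.suc b) Q? (x ∷ xs) (ℕ.s≤s N≤) | ts , fs , τ , φ , pts , pfs , eq
      | inj₂ N≤fs with ramsey (ℕ.suc a) b Q? fs N≤fs
...     | inj₁ (ys , σ , a≤ , Qys) = inj₁ (ys , x ∷ʳ Sublist.⊆-trans σ φ , a≤ , Qys)
...     | inj₂ (ys , σ , b≤ , Qys) = inj₂ (x ∷ ys , refl ∷ Sublist.⊆-trans σ φ , ℕ.s≤s b≤ , Sublist.All-resp-⊆ σ pfs ∷ Qys)

Between : ℚ → ℚ → ℚ → Set
Between l h x = l ≤ℚ x × x ≤ℚ h

intervalNumber : ℕ → ℕ → ℕ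
intervalNumber ℕ.zero    m = m
intervalNumber (ℕ.suc s) m = ramseyNumber m (intervalNumber s m)

InInterval : {A : Set} → (A → A → ℚ) → ℚ → ℚ → A → A → Set
InInterval f l h x y = Between l h (f x y)

-- Peel off the lowest slab of width `δ`. Either `m` elements have all their pairs in it, or a long
-- sublist has all its pairs above it, where one slab fewer remains.
interval-ramsey : ∀ {A : Set} s m (f : A → A → ℚ) l δ xs → intervalNumber s m ≤ length xs →
  AllPairs (InInterval f l (l + (1ℚ + natℚ s) * δ)) xs →
  ∃[ l′ ] HomogeneousSublist (InInterval f l′ (l′ + δ)) m xs
interval-ramsey ℕ.zero    m f l δ xs N≤ between = l , xs , Sublist.⊆-refl , N≤ ,
  subst (λ h → AllPairs (InInterval f l h) xs) width between
  where
  width : l + (1ℚ + natℚ 0) * δ ≡ l + δ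
  width = trans (cong (λ z → l + (1ℚ + z) * δ) natℚ-0) (solve 2 (λ l δ → l :+ (con 1ℚ :+ con 0ℚ) :* δ := l :+ δ) refl l δ)
interval-ramsey (ℕ.suc s) m f l δ xs N≤ between =
  Sum.[ lower-part , upper-part ] (ramsey m (intervalNumber s m) (λ x y → f x y ℚ.≤? l + δ) xs N≤)
  where
  width : l + (1ℚ + natℚ (ℕ.suc s)) * δ ≡ (l + δ) + (1ℚ + natℚ s) * δ
  width = trans (cong (λ z → l + (1ℚ + z) * δ) (natℚ-suc s))
    (solve 3 (λ l s δ → l :+ (con 1ℚ :+ (con 1ℚ :+ s)) :* δ := (l :+ δ) :+ (con 1ℚ :+ s) :* δ) refl l (natℚ s) δ)
  between′ : AllPairs (InInterval f l ((l + δ) + (1ℚ + natℚ s) * δ)) xs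
  between′ = subst (λ h → AllPairs (InInterval f l h) xs) width between
  lower-part : HomogeneousSublist (λ x y → f x y ≤ℚ l + δ) m xs → ∃[ l′ ] HomogeneousSublist (InInterval f l′ (l′ + δ)) m xs
  lower-part (ys , σ , m≤ , low) = l , ys , σ , m≤ ,
    AllPairs.zipWith (λ (l≤x≤h , x≤l+δ) → proj₁ l≤x≤h , x≤l+δ) (AllPairs-resp-⊆ σ between , low)
  upper-part : HomogeneousSublist (λ x y → ¬ (f x y ≤ℚ l + δ)) (intervalNumber s m) xs →
    ∃[ l′ ] HomogeneousSublist (InInterval f l′ (l′ + δ)) m xs
  upper-part (ys , σ , N≤′ , high) =
    let l′ , zs , σ′ , m≤ , hom = interval-ramsey s m f (l + δ) δ ys N≤′
          (AllPairs.zipWith (λ (l≤x≤h , x≰l+δ) → ℚ.<⇒≤ (ℚ.≰⇒> x≰l+δ) , proj₂ l≤x≤h) (AllPairs-resp-⊆ σ between′ , high))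
    in l′ , zs , Sublist.⊆-trans σ′ σ , m≤ , hom

multiNumber : ℕ → ℕ → ℕ → ℕ
multiNumber ℕ.zero    s m = m
multiNumber (ℕ.suc r) s m = intervalNumber s (multiNumber r s m)

InIntervals : {A : Set} → (Fin r → A → A → ℚ) → (Fin r → ℚ) → ℚ → A → A → Set
InIntervals f l δ x y = ∀ a → InInterval (f a) (l a) (l a + δ) x y

-- The functions are treated one after another; passing to a sublist preserves the intervals already
-- found.
multi-ramsey : ∀ {A : Set} r s m (f : Fin r → A → A → ℚ) l δ xs → multiNumber r s m ≤ length xs →
  (∀ a → AllPairs (InInterval (f a) l (l + (1ℚ + natℚ s) * δ)) xs) →
  Σ[ l′ ∈ (Fin r → ℚ) ] HomogeneousSublist (InIntervals f l′ δ) m xs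
multi-ramsey ℕ.zero    s m f l δ xs N≤ between = l′ , xs , Sublist.⊆-refl , N≤ , all xs
  where
  l′ : Fin 0 → ℚ
  l′ ()
  all : ∀ xs → AllPairs (InIntervals f l′ δ) xs
  all []       = []
  all (x ∷ xs) = All.universal (λ _ ()) xs ∷ all xs
multi-ramsey (ℕ.suc r) s m f l δ xs N≤ between =
  let l₀ , ys , σ , N≤′ , hom₀ = interval-ramsey s (multiNumber r s m) (f zero) l δ xs N≤ (between zero)
      l₁ , zs , σ′ , m≤ , hom₁ = multi-ramsey r s m (f ∘ suc) l δ ys N≤′ (λ a → AllPairs-resp-⊆ σ (between (suc a)))
  in cons l₀ l₁ , zs , Sublist.⊆-trans σ′ σ , m≤ ,
     AllPairs.zipWith (λ { (p , q) zero → p ; (p , q) (suc a) → q a }) (AllPairs-resp-⊆ σ′ hom₀ , hom₁)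
  where
  cons : ℚ → (Fin r → ℚ) → Fin (ℕ.suc r) → ℚ
  cons l₀ l₁ zero    = l₀
  cons l₀ l₁ (suc a) = l₁ a

-- Trilinear forms on sums of ordered measures

total : List (Fin n → ℚ) → Fin n → ℚ
total []       u = 0ℚ
total (μ ∷ νs) u = μ u + total νs u

record Additive (φ : (Fin n → ℚ) → ℚ) : Set where
  field
    +-homo : ∀ f g → φ (λ u → f u + g u) ≡ φ f + φ g
    0-homo : φ (λ _ → 0ℚ) ≡ 0ℚ

  total-bound : ∀ {c} νs → All (λ ν → φ ν ≤ℚ c) νs → φ (total νs) ≤ℚ natℚ (length νs) * c
  total-bound {c} []       []         = ℚ.≤-reflexive (trans 0-homo (sym (trans (cong (_* c) natℚ-0) (ℚ.*-zeroˡ c))))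
  total-bound {c} (ν ∷ νs) (ν≤ ∷ νs≤) = begin
    φ (total (ν ∷ νs))                  ≡⟨ +-homo ν (total νs) ⟩
    φ ν + φ (total νs)                  ≤⟨ ℚ.+-mono-≤ ν≤ (total-bound νs νs≤) ⟩
    c + natℚ (length νs) * c            ≡⟨ solve 2 (λ c k → c :+ k :* c := (con 1ℚ :+ k) :* c) refl c (natℚ (length νs)) ⟩
    (1ℚ + natℚ (length νs)) * c         ≡⟨ cong (_* c) (natℚ-suc (length νs)) ⟨
    natℚ (length (ν ∷ νs)) * c          ∎
    where open ℚ.≤-Reasoning

  total-zero : ∀ νs → All (λ ν → φ ν ≡ 0ℚ) νs → φ (total νs) ≡ 0ℚ
  total-zero []       []         = 0-homo
  total-zero (ν ∷ νs) (ν≡ ∷ νs≡) = trans (+-homo ν (total νs)) (cong₂ _+_ ν≡ (total-zero νs νs≡))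

module OrderedTrilinear
  (Tr : (Fin n → ℚ) → (Fin n → ℚ) → (Fin n → ℚ) → ℚ)
  (additive₁ : ∀ y z → Additive (λ x → Tr x y z))
  (additive₂ : ∀ x z → Additive (λ y → Tr x y z))
  (additive₃ : ∀ x y → Additive (λ z → Tr x y z))
  (Good : (Fin n → ℚ) → (Fin n → ℚ) → Set) (Unit : (Fin n → ℚ) → Set) {L : ℚ} (0≤L : 0ℚ ≤ℚ L)
  (triple≤ : ∀ {x y z} → Good x y → Good x z → Good y z → Tr x y z ≤ℚ L)
  (trivial≤ : ∀ {x y z} → Unit x → Unit y → Unit z → Tr x y z ≤ℚ 1ℚ)
  (vanish₁₂ : ∀ {x y} z → Good x y → Tr y x z ≡ 0ℚ)
  (vanish₂₃ : ∀ {x y} z → Good x y → Tr z y x ≡ 0ℚ)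
  where

  open Additive
  open ℚ.≤-Reasoning

  private
    -- The count for the last two arguments with the first one fixed: of k measures, k(k - 1)/2
    -- increasing pairs cost `L` each and k diagonal pairs cost 1 each.
    2^ : ∀ μ νs → Unit μ → All Unit νs → All (Good μ) νs → AllPairs Good νs →
      2ℚ * Tr μ (total νs) (total νs) ≤ℚ L * square (natℚ (length νs)) + 2ℚ * natℚ (length νs)
    2^ μ []       uμ us gs ps = ℚ.≤-reflexive (trans (cong (2ℚ *_) (0-homo (additive₂ μ (λ _ → 0ℚ))))
      (sym (trans (cong (λ z → L * square z + 2ℚ * z) natℚ-0) (solve 1 (λ L → L :* con 0ℚ :+ con 0ℚ := con 0ℚ) refl L))))
    2^ μ (ν ∷ νs) uμ (uν ∷ us) (g ∷ gs) (h ∷ ps) = begin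
      2ℚ * Tr μ (total (ν ∷ νs)) (total (ν ∷ νs))
        ≡⟨ cong (2ℚ *_) (trans (+-homo (additive₂ μ (total (ν ∷ νs))) ν W)
             (cong₂ _+_ (+-homo (additive₃ μ ν) ν W) (+-homo (additive₃ μ W) ν W))) ⟩
      2ℚ * ((Tr μ ν ν + Tr μ ν W) + (Tr μ W ν + Tr μ W W))
        ≡⟨ cong (λ z → 2ℚ * ((Tr μ ν ν + Tr μ ν W) + (z + Tr μ W W))) (total-zero (additive₂ μ ν) νs (All.map (λ g → vanish₂₃ μ g) h)) ⟩
      2ℚ * ((Tr μ ν ν + Tr μ ν W) + (0ℚ + Tr μ W W))
        ≡⟨ solve 3 (λ a b c → con 2ℚ :* ((a :+ b) :+ (con 0ℚ :+ c)) := con 2ℚ :* a :+ con 2ℚ :* b :+ con 2ℚ :* c) refl (Tr μ ν ν) (Tr μ ν W) (Tr μ W W) ⟩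
      2ℚ * Tr μ ν ν + 2ℚ * Tr μ ν W + 2ℚ * Tr μ W W
        ≤⟨ ℚ.+-mono-≤ (ℚ.+-mono-≤ (*-monoˡ 0≤2 (trivial≤ uμ uν uν))
             (*-monoˡ 0≤2 (total-bound (additive₃ μ ν) νs (All.zipWith (λ (g′ , h′) → triple≤ g g′ h′) (gs , h)))))
             (2^ μ νs uμ us gs ps) ⟩
      2ℚ * 1ℚ + 2ℚ * (k * L) + (L * (k * k) + 2ℚ * k)
        ≤⟨ ≤-offset L 0≤L (solve 2 (λ k L → (con 2ℚ :* con 1ℚ :+ con 2ℚ :* (k :* L) :+ (L :* (k :* k) :+ con 2ℚ :* k)) :+ L :=
             L :* ((con 1ℚ :+ k) :* (con 1ℚ :+ k)) :+ con 2ℚ :* (con 1ℚ :+ k)) refl k L) ⟩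
      L * square (1ℚ + k) + 2ℚ * (1ℚ + k)
        ≡⟨ cong (λ z → L * square z + 2ℚ * z) (natℚ-suc (length νs)) ⟨
      L * square (natℚ (length (ν ∷ νs))) + 2ℚ * natℚ (length (ν ∷ νs)) ∎
      where
      W = total νs
      k = natℚ (length νs)
      0≤2 = ℚ.nonNegative⁻¹ 2ℚ

  -- An index triple that is not nondecreasing has an adjacent descent, so the two vanishing laws
  -- remove it. Among ℓ measures at most ℓ³/6 triples are strictly increasing, each worth at most
  -- `L`; exactly ℓ² nondecreasing triples repeat an index, each worth at most 1.
  total³-bound : ∀ νs → All Unit νs → AllPairs Good νs →
    6ℚ * Tr (total νs) (total νs) (total νs) ≤ℚ L * cube (natℚ (length νs)) + 6ℚ * square (natℚ (length νs))
  total³-bound [] us ps = ℚ.≤-reflexive (trans (cong (6ℚ *_) (0-homo (additive₂ (λ _ → 0ℚ) (λ _ → 0ℚ))))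
      (sym (trans (cong (λ z → L * cube z + 6ℚ * square z) natℚ-0) (solve 1 (λ L → L :* con 0ℚ :+ con 0ℚ := con 0ℚ) refl L))))
  total³-bound (μ ∷ νs) (uμ ∷ us) (g ∷ ps) = begin
    6ℚ * Tr (total (μ ∷ νs)) (total (μ ∷ νs)) (total (μ ∷ νs))
      ≡⟨ cong (6ℚ *_) expand ⟩
    6ℚ * (((Tr μ μ μ + Tr μ μ W) + (0ℚ + Tr μ W W)) + ((0ℚ + 0ℚ) + (0ℚ + Tr W W W)))
      ≡⟨ solve 4 (λ a b c d → con 6ℚ :* (((a :+ b) :+ (con 0ℚ :+ c)) :+ ((con 0ℚ :+ con 0ℚ) :+ (con 0ℚ :+ d))) :=
           con 6ℚ :* a :+ con 6ℚ :* b :+ con 3ℚ :* (con 2ℚ :* c) :+ con 6ℚ :* d) refl (Tr μ μ μ) (Tr μ μ W) (Tr μ W W) (Tr W W W) ⟩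
    6ℚ * Tr μ μ μ + 6ℚ * Tr μ μ W + 3ℚ * (2ℚ * Tr μ W W) + 6ℚ * Tr W W W
      ≤⟨ ℚ.+-mono-≤ (ℚ.+-mono-≤ (ℚ.+-mono-≤ (*-monoˡ 0≤6 (trivial≤ uμ uμ uμ))
           (*-monoˡ 0≤6 (total-bound (additive₃ μ μ) νs (All.map (λ uν → trivial≤ uμ uμ uν) us))))
           (*-monoˡ 0≤3 (2^ μ νs uμ us g ps)))
           (total³-bound νs us ps) ⟩
    6ℚ * 1ℚ + 6ℚ * (k * 1ℚ) + 3ℚ * (L * (k * k) + 2ℚ * k) + (L * (k * (k * k)) + 6ℚ * (k * k))
      ≤⟨ ≤-offset (L * (3ℚ * k + 1ℚ)) (0≤* 0≤L (0≤+ (0≤* 0≤3 (0≤nat (length νs))) 0≤1))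
           (solve 2 (λ k L → (con 6ℚ :* con 1ℚ :+ con 6ℚ :* (k :* con 1ℚ) :+ con 3ℚ :* (L :* (k :* k) :+ con 2ℚ :* k) :+ (L :* (k :* (k :* k)) :+ con 6ℚ :* (k :* k)))
              :+ L :* (con 3ℚ :* k :+ con 1ℚ) :=
              L :* ((con 1ℚ :+ k) :* ((con 1ℚ :+ k) :* (con 1ℚ :+ k))) :+ con 6ℚ :* ((con 1ℚ :+ k) :* (con 1ℚ :+ k))) refl k L) ⟩
    L * cube (1ℚ + k) + 6ℚ * square (1ℚ + k)
      ≡⟨ cong (λ z → L * cube z + 6ℚ * square z) (natℚ-suc (length νs)) ⟨
    L * cube (natℚ (length (μ ∷ νs))) + 6ℚ * square (natℚ (length (μ ∷ νs))) ∎
    where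
    W = total νs
    S = total (μ ∷ νs)
    k = natℚ (length νs)
    0≤3 = ℚ.nonNegative⁻¹ 3ℚ
    0≤6 = ℚ.nonNegative⁻¹ 6ℚ
    Wμ : ∀ z → Tr W μ z ≡ 0ℚ
    Wμ z = total-zero (additive₁ μ z) νs (All.map (vanish₁₂ z) g)
    ·Wμ : ∀ z → Tr z W μ ≡ 0ℚ
    ·Wμ z = total-zero (additive₂ z μ) νs (All.map (vanish₂₃ z) g)
    expand : Tr S S S ≡ ((Tr μ μ μ + Tr μ μ W) + (0ℚ + Tr μ W W)) + ((0ℚ + 0ℚ) + (0ℚ + Tr W W W))
    expand = trans (+-homo (additive₁ S S) μ W) (cong₂ _+_
      (trans (+-homo (additive₂ μ S) μ W) (cong₂ _+_ (+-homo (additive₃ μ μ) μ W)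
        (trans (+-homo (additive₃ μ W) μ W) (cong (_+ Tr μ W W) (·Wμ μ)))))
      (trans (+-homo (additive₂ W S) μ W) (cong₂ _+_ (trans (+-homo (additive₃ W μ) μ W) (cong₂ _+_ (Wμ μ) (Wμ W)))
        (trans (+-homo (additive₃ W W) μ W) (cong (_+ Tr W W W) (·Wμ W))))))

-- Palette colourings

-- Colours are read only on pairs in increasing position, so `colour` carries no symmetry condition.
-- A position is an arbitrary injection into the naturals rather than a permutation, so that it
-- restricts to a subhypergraph by composition.
record Colouring (P : Palette r) (H : 3-Graph) : Set where
  field
    position           : Fin (order H) → ℕ
    position-injective : Injective _≡_ _≡_ position
    colour             : Fin (order H) → Fin (order H) → Fin r
    edge-colours       : ∀ i j k → T (edge H (triple i j k)) → position i ℕ.< position j → position j ℕ.< position k →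
                         T (P (colour i j) (colour i k) (colour j k))

private
  𝟙-guard : ∀ a b c d {w} → 0ℚ ≤ℚ w → (T a → T b → T c → T d) → 𝟙 a * 𝟙 b * (𝟙 c * w) ≤ℚ 𝟙 a * 𝟙 b * 𝟙 d * w
  𝟙-guard false b c d {w} 0≤w f = ℚ.≤-reflexive
    (solve 4 (λ b c d w → con 0ℚ :* b :* (c :* w) := con 0ℚ :* b :* d :* w) refl (𝟙 b) (𝟙 c) (𝟙 d) w)
  𝟙-guard true false c d {w} 0≤w f = ℚ.≤-reflexive
    (solve 3 (λ c d w → con 1ℚ :* con 0ℚ :* (c :* w) := con 1ℚ :* con 0ℚ :* d :* w) refl (𝟙 c) (𝟙 d) w)
  𝟙-guard true true c d {w} 0≤w f = begin
    1ℚ * 1ℚ * (𝟙 c * w)  ≡⟨ solve 2 (λ c w → con 1ℚ :* con 1ℚ :* (c :* w) := c :* w) refl (𝟙 c) w ⟩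
    𝟙 c * w              ≤⟨ *-monoʳ 0≤w (𝟙-mono (f tt tt)) ⟩
    𝟙 d * w              ≡⟨ cong (_* w) (ℚ.*-identityˡ (𝟙 d)) ⟨
    1ℚ * 1ℚ * 𝟙 d * w    ∎
    where open ℚ.≤-Reasoning

-- Counting palette patterns between measures

∑-∑³-swap : ∀ (F : Fin m → Fin n → Fin n → Fin n → ℚ) →
  ∑ (λ u → ∑³ (F u)) ≡ ∑³ (λ a b c → ∑ λ u → F u a b c)
∑-∑³-swap F = trans (∑-swap (λ u a → ∑ λ b → ∑ λ c → F u a b c)) (∑-cong λ a →
  trans (∑-swap (λ u b → ∑ λ c → F u a b c)) (∑-cong λ b → ∑-swap (λ u c → F u a b c)))

∑³-∑³-swap : ∀ (F : Fin m → Fin m → Fin m → Fin n → Fin n → Fin n → ℚ) →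
  ∑³ (λ u v w → ∑³ (F u v w)) ≡ ∑³ (λ a b c → ∑³ λ u v w → F u v w a b c)
∑³-∑³-swap F = trans (∑-cong λ u → trans (∑-cong λ v → ∑-∑³-swap (F u v)) (∑-∑³-swap (λ v a b c → ∑ λ w → F u v w a b c)))
  (∑-∑³-swap (λ u a b c → ∑ λ v → ∑ λ w → F u v w a b c))

∑³-product : ∀ (α β γ : Fin n → ℚ) → ∑³ (λ u v w → α u * (β v * γ w)) ≡ ∑ α * (∑ β * ∑ γ)
∑³-product α β γ = trans (∑-cong λ u → trans (∑-cong λ v → ∑-pull (α u) (λ w → β v * γ w)) (trans (∑-pull (α u) (λ v → ∑ λ w → β v * γ w))
  (trans (cong (α u *_) (∑∑-product β γ)) (ℚ.*-comm (α u) (∑ β * ∑ γ)))))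
  (trans (∑-pull (∑ β * ∑ γ) α) (ℚ.*-comm (∑ β * ∑ γ) (∑ α)))

∑³-bound : ∀ {F : Fin n → Fin n → Fin n → ℚ} c → (∀ i j k → F i j k ≤ℚ c) → ∑³ F ≤ℚ natℚ n * (natℚ n * (natℚ n * c))
∑³-bound {n} c F≤c = ∑-bound (natℚ n * (natℚ n * c)) λ i → ∑-bound (natℚ n * c) λ j → ∑-bound c λ k → F≤c i j k

colourClass : (Fin n → Fin n → Fin r) → Fin r → Fin n → Fin n → ℚ
colourClass c a u v = 𝟙 (c u v ≡ᵇ a)

colourClass-01 : ∀ (c : Fin n → Fin n → Fin r) a u v → In01 (colourClass c a u v)
colourClass-01 c a u v = 01-𝟙 (c u v ≡ᵇ a)

-- Exactly one colour triple fits three given colours. The expansion turns the pattern condition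
-- into products of colour classes, to which `triangle-counting` applies.
palette-expansion : ∀ (P : Palette r) a₀ b₀ c₀ →
  𝟙 (P a₀ b₀ c₀) ≡ ∑³ (λ a b c → 𝟙 (P a b c) * (𝟙 (a₀ ≡ᵇ a) * (𝟙 (b₀ ≡ᵇ b) * 𝟙 (c₀ ≡ᵇ c))))
palette-expansion P a₀ b₀ c₀ = sym (begin
  ∑³ (λ a b c → 𝟙 (P a b c) * (𝟙 (a₀ ≡ᵇ a) * (𝟙 (b₀ ≡ᵇ b) * 𝟙 (c₀ ≡ᵇ c))))
    ≡⟨ ∑³-cong (λ a b c → solve 4 (λ p x y z → p :* (x :* (y :* z)) := x :* (y :* (z :* p))) refl (𝟙 (P a b c)) (𝟙 (a₀ ≡ᵇ a)) (𝟙 (b₀ ≡ᵇ b)) (𝟙 (c₀ ≡ᵇ c))) ⟩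
  ∑³ (λ a b c → 𝟙 (a₀ ≡ᵇ a) * (𝟙 (b₀ ≡ᵇ b) * (𝟙 (c₀ ≡ᵇ c) * 𝟙 (P a b c))))
    ≡⟨ ∑-cong (λ a → trans (∑-cong λ b → trans (∑-pull (𝟙 (a₀ ≡ᵇ a)) (λ c → 𝟙 (b₀ ≡ᵇ b) * (𝟙 (c₀ ≡ᵇ c) * 𝟙 (P a b c))))
         (cong (𝟙 (a₀ ≡ᵇ a) *_) (trans (∑-pull (𝟙 (b₀ ≡ᵇ b)) (λ c → 𝟙 (c₀ ≡ᵇ c) * 𝟙 (P a b c))) (cong (𝟙 (b₀ ≡ᵇ b) *_) (∑-select c₀ (λ c → 𝟙 (P a b c)))))))
         (trans (∑-pull (𝟙 (a₀ ≡ᵇ a)) (λ b → 𝟙 (b₀ ≡ᵇ b) * 𝟙 (P a b c₀))) (cong (𝟙 (a₀ ≡ᵇ a) *_) (∑-select b₀ (λ b → 𝟙 (P a b c₀)))))) ⟩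
  ∑ (λ a → 𝟙 (a₀ ≡ᵇ a) * 𝟙 (P a b₀ c₀))
    ≡⟨ ∑-select a₀ (λ a → 𝟙 (P a b₀ c₀)) ⟩
  𝟙 (P a₀ b₀ c₀) ∎)
  where open ≡-Reasoning

module Pattern (P : Palette r) {n} (pos : Fin n → ℕ) (c : Fin n → Fin n → Fin r) where

  kernel : Fin n → Fin n → Fin n → ℚ
  kernel u v w = increasing pos u v w * 𝟙 (P (c u v) (c u w) (c v w))

  Tr : (Fin n → ℚ) → (Fin n → ℚ) → (Fin n → ℚ) → ℚ
  Tr α β γ = ∑³ λ u v w → kernel u v w * (α u * (β v * γ w))

  Tr-additive₁ : ∀ β γ → Additive (λ α → Tr α β γ)
  Tr-additive₁ β γ = record
    { +-homo = λ f g → trans (∑³-cong λ u v w → solve 5 (λ k x y b c → k :* ((x :+ y) :* (b :* c)) := k :* (x :* (b :* c)) :+ k :* (y :* (b :* c))) refl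
                 (kernel u v w) (f u) (g u) (β v) (γ w))
               (∑³-+ (λ u v w → kernel u v w * (f u * (β v * γ w))) (λ u v w → kernel u v w * (g u * (β v * γ w))))
    ; 0-homo = ∑³-zero λ u v w → solve 3 (λ k b c → k :* (con 0ℚ :* (b :* c)) := con 0ℚ) refl (kernel u v w) (β v) (γ w)
    }

  Tr-additive₂ : ∀ α γ → Additive (λ β → Tr α β γ)
  Tr-additive₂ α γ = record
    { +-homo = λ f g → trans (∑³-cong λ u v w → solve 5 (λ k x y a c → k :* (a :* ((x :+ y) :* c)) := k :* (a :* (x :* c)) :+ k :* (a :* (y :* c))) refl
                 (kernel u v w) (f v) (g v) (α u) (γ w))
               (∑³-+ (λ u v w → kernel u v w * (α u * (f v * γ w))) (λ u v w → kernel u v w * (α u * (g v * γ w))))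
    ; 0-homo = ∑³-zero λ u v w → solve 3 (λ k a c → k :* (a :* (con 0ℚ :* c)) := con 0ℚ) refl (kernel u v w) (α u) (γ w)
    }

  Tr-additive₃ : ∀ α β → Additive (λ γ → Tr α β γ)
  Tr-additive₃ α β = record
    { +-homo = λ f g → trans (∑³-cong λ u v w → solve 5 (λ k x y a b → k :* (a :* (b :* (x :+ y))) := k :* (a :* (b :* x)) :+ k :* (a :* (b :* y))) refl
                 (kernel u v w) (f w) (g w) (α u) (β v))
               (∑³-+ (λ u v w → kernel u v w * (α u * (β v * f w))) (λ u v w → kernel u v w * (α u * (β v * g w))))
    ; 0-homo = ∑³-zero λ u v w → solve 3 (λ k a b → k :* (a :* (b :* con 0ℚ)) := con 0ℚ) refl (kernel u v w) (α u) (β v)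
    }

  -- β precedes α: no point of β lies to the right of a point of α.
  Before : (Fin n → ℚ) → (Fin n → ℚ) → Set
  Before β α = ∀ u v → pos u ℕ.< pos v → α u * β v ≡ 0ℚ

  private
    lt-guard : ∀ a b x → (T (a <ᵇ b) → x ≡ 0ℚ) → 𝟙 (a <ᵇ b) * x ≡ 0ℚ
    lt-guard a b x x≡0 with a <ᵇ b
    ... | true  = trans (ℚ.*-identityˡ x) (x≡0 tt)
    ... | false = ℚ.*-zeroˡ x

  Tr-vanish₁₂ : ∀ {β α} γ → Before β α → Tr α β γ ≡ 0ℚ
  Tr-vanish₁₂ {β} {α} γ before = ∑³-zero λ u v w → trans
    (solve 6 (λ x y p a b c → x :* y :* p :* (a :* (b :* c)) := (x :* (a :* b)) :* (y :* p :* c)) refl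
      (𝟙 (pos u <ᵇ pos v)) (𝟙 (pos v <ᵇ pos w)) (𝟙 (P (c u v) (c u w) (c v w))) (α u) (β v) (γ w))
    (trans (cong (_* (𝟙 (pos v <ᵇ pos w) * 𝟙 (P (c u v) (c u w) (c v w)) * γ w))
      (lt-guard (pos u) (pos v) (α u * β v) (before u v ∘ ℕ.<ᵇ⇒< (pos u) (pos v))))
      (ℚ.*-zeroˡ (𝟙 (pos v <ᵇ pos w) * 𝟙 (P (c u v) (c u w) (c v w)) * γ w)))

  Tr-vanish₂₃ : ∀ {γ β} α → Before γ β → Tr α β γ ≡ 0ℚ
  Tr-vanish₂₃ {γ} {β} α before = ∑³-zero λ u v w → trans
    (solve 6 (λ x y p a b c → x :* y :* p :* (a :* (b :* c)) := (y :* (b :* c)) :* (x :* p :* a)) refl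
      (𝟙 (pos u <ᵇ pos v)) (𝟙 (pos v <ᵇ pos w)) (𝟙 (P (c u v) (c u w) (c v w))) (α u) (β v) (γ w))
    (trans (cong (_* (𝟙 (pos u <ᵇ pos v) * 𝟙 (P (c u v) (c u w) (c v w)) * α u))
      (lt-guard (pos v) (pos w) (β v * γ w) (before v w ∘ ℕ.<ᵇ⇒< (pos v) (pos w))))
      (ℚ.*-zeroˡ (𝟙 (pos u <ᵇ pos v) * 𝟙 (P (c u v) (c u w) (c v w)) * α u)))

  open Probability

  private
    kernel≤ : ∀ u v w → kernel u v w ≤ℚ 𝟙 (P (c u v) (c u w) (c v w))
    kernel≤ u v w = ℚ.≤-trans (*-monoʳ (0≤𝟙 (P (c u v) (c u w) (c v w))) (proj₂ (01-* (01-𝟙 (pos u <ᵇ pos v)) (01-𝟙 (pos v <ᵇ pos w)))))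
      (ℚ.≤-reflexive (ℚ.*-identityˡ (𝟙 (P (c u v) (c u w) (c v w)))))

    0≤αβγ : ∀ {α β γ : Fin n → ℚ} → Probability α → Probability β → Probability γ → ∀ u v w → 0ℚ ≤ℚ α u * (β v * γ w)
    0≤αβγ α-prob β-prob γ-prob u v w = 0≤* (nonNegative α-prob u) (0≤* (nonNegative β-prob v) (nonNegative γ-prob w))

    unit-mass : ∀ {α β γ : Fin n → ℚ} → Probability α → Probability β → Probability γ → ∑³ (λ u v w → α u * (β v * γ w)) ≡ 1ℚ
    unit-mass {α} {β} {γ} α-prob β-prob γ-prob = trans (∑³-product α β γ)
      (cong₂ _*_ (mass α-prob) (cong₂ _*_ (mass β-prob) (mass γ-prob)))

  Tr≤1 : ∀ {α β γ : Fin n → ℚ} → Probability α → Probability β → Probability γ → Tr α β γ ≤ℚ 1ℚ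
  Tr≤1 {α} {β} {γ} α-prob β-prob γ-prob = ℚ.≤-trans
    (∑³-mono λ u v w → ℚ.≤-trans (*-monoʳ (0≤αβγ α-prob β-prob γ-prob u v w)
        (ℚ.≤-trans (kernel≤ u v w) (proj₂ (01-𝟙 (P (c u v) (c u w) (c v w))))))
      (ℚ.≤-reflexive (ℚ.*-identityˡ (α u * (β v * γ w)))))
    (ℚ.≤-reflexive (unit-mass α-prob β-prob γ-prob))

  private
    κ  = colourClass c
    κ∈ = colourClass-01 c

  -- Discarding the order indicators only increases the sum. What remains is, for each of at most r³
  -- colour triples, a triangle count between colour classes; replacing its three factors by their
  -- mean densities costs `ε` each.
  Tr-regular : ∀ {α β γ : Fin n → ℚ} {ε} → 0ℚ ≤ℚ ε → Probability α → Probability β → Probability γ →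
    (∀ a → CutBounded (deviation κ κ∈ α β a) ε) → (∀ a → CutBounded (deviation κ κ∈ α γ a) ε) → (∀ a → CutBounded (deviation κ κ∈ β γ a) ε) →
    Tr α β γ ≤ℚ ∑³ (λ a b d → 𝟙 (P a b d) * (pairing (κ a) α β * (pairing (κ b) α γ * pairing (κ d) β γ)))
      + natℚ r * (natℚ r * (natℚ r * (3ℚ * ε)))
  Tr-regular {α} {β} {γ} {ε} 0≤ε α-prob β-prob γ-prob cutαβ cutαγ cutβγ = begin
    Tr α β γ
      ≤⟨ ∑³-mono (λ u v w → *-monoʳ (0≤αβγ α-prob β-prob γ-prob u v w) (kernel≤ u v w)) ⟩
    ∑³ (λ u v w → 𝟙 (P (c u v) (c u w) (c v w)) * αβγ u v w)
      ≡⟨ ∑³-cong (λ u v w → trans (cong (_* αβγ u v w) (palette-expansion P (c u v) (c u w) (c v w)))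
           (trans (ℚ.*-comm (∑³ λ a b d → 𝟙 (P a b d) * κκκ u v w a b d) (αβγ u v w)) (sym (∑³-pull (αβγ u v w) (λ a b d → 𝟙 (P a b d) * κκκ u v w a b d))))) ⟩
    ∑³ (λ u v w → ∑³ λ a b d → αβγ u v w * (𝟙 (P a b d) * κκκ u v w a b d))
      ≡⟨ ∑³-∑³-swap (λ u v w a b d → αβγ u v w * (𝟙 (P a b d) * κκκ u v w a b d)) ⟩
    ∑³ (λ a b d → ∑³ λ u v w → αβγ u v w * (𝟙 (P a b d) * κκκ u v w a b d))
      ≡⟨ ∑³-cong (λ a b d → trans
           (∑³-cong λ u v w → solve 3 (λ x p k → x :* (p :* k) := p :* (x :* k)) refl (αβγ u v w) (𝟙 (P a b d)) (κκκ u v w a b d))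
           (∑³-pull (𝟙 (P a b d)) (λ u v w → αβγ u v w * κκκ u v w a b d))) ⟩
    ∑³ (λ a b d → 𝟙 (P a b d) * ∑³ (λ u v w → αβγ u v w * κκκ u v w a b d))
      ≤⟨ ∑³-mono (λ a b d → *-monoˡ (0≤𝟙 (P a b d)) (counted a b d)) ⟩
    ∑³ (λ a b d → 𝟙 (P a b d) * (D a b d + 3ℚ * ε))
      ≤⟨ ∑³-mono (λ a b d → ℚ.≤-trans (ℚ.≤-reflexive (ℚ.*-distribˡ-+ (𝟙 (P a b d)) (D a b d) (3ℚ * ε)))
           (ℚ.+-monoʳ-≤ (𝟙 (P a b d) * D a b d) (ℚ.≤-trans (*-monoʳ (0≤* (ℚ.nonNegative⁻¹ 3ℚ) 0≤ε) (proj₂ (01-𝟙 (P a b d)))) (ℚ.≤-reflexive (ℚ.*-identityˡ (3ℚ * ε)))))) ⟩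
    ∑³ (λ a b d → 𝟙 (P a b d) * D a b d + 3ℚ * ε)
      ≡⟨ ∑³-+ (λ a b d → 𝟙 (P a b d) * D a b d) (λ _ _ _ → 3ℚ * ε) ⟩
    ∑³ (λ a b d → 𝟙 (P a b d) * D a b d) + ∑³ {r} (λ _ _ _ → 3ℚ * ε)
      ≤⟨ ℚ.+-monoʳ-≤ (∑³ λ a b d → 𝟙 (P a b d) * D a b d) (∑³-bound (3ℚ * ε) λ _ _ _ → ℚ.≤-refl) ⟩
    ∑³ (λ a b d → 𝟙 (P a b d) * D a b d) + natℚ r * (natℚ r * (natℚ r * (3ℚ * ε))) ∎
    where
    open ℚ.≤-Reasoning
    αβγ : Fin n → Fin n → Fin n → ℚ
    αβγ u v w = α u * (β v * γ w)
    κκκ : Fin n → Fin n → Fin n → Fin r → Fin r → Fin r → ℚ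
    κκκ u v w a b d = κ a u v * (κ b u w * κ d v w)
    D : Fin r → Fin r → Fin r → ℚ
    D a b d = pairing (κ a) α β * (pairing (κ b) α γ * pairing (κ d) β γ)
    counted : ∀ a b d → ∑³ (λ u v w → αβγ u v w * κκκ u v w a b d) ≤ℚ D a b d + 3ℚ * ε
    counted a b d = begin
      ∑³ (λ u v w → αβγ u v w * κκκ u v w a b d)
        ≤⟨ triangle-counting (nonNegative α-prob) (nonNegative β-prob) (nonNegative γ-prob)
             (ℚ.≤-reflexive (mass α-prob)) (ℚ.≤-reflexive (mass β-prob)) (ℚ.≤-reflexive (mass γ-prob))
             (κ a) (κ b) (κ d) (λ _ _ → pairing (κ a) α β) (λ _ _ → pairing (κ b) α γ) (λ _ _ → pairing (κ d) β γ) 0≤ε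
             (κ∈ b) (κ∈ d) (λ _ _ → pairing-01 (κ∈ a) α-prob β-prob) (λ _ _ → pairing-01 (κ∈ b) α-prob γ-prob)
             (cutαβ a) (cutαγ b) (cutβγ d) ⟩
      ∑³ (λ u v w → αβγ u v w * D a b d) + 3ℚ * (1ℚ * ε)
        ≡⟨ cong₂ (λ x y → x + 3ℚ * y) (trans (∑³-cong λ u v w → ℚ.*-comm (αβγ u v w) (D a b d)) (trans (∑³-pull (D a b d) αβγ)
             (trans (cong (D a b d *_) (unit-mass α-prob β-prob γ-prob)) (ℚ.*-identityʳ (D a b d))))) (ℚ.*-identityˡ ε) ⟩
      D a b d + 3ℚ * ε ∎

-- `∑-increasing` exchanges the order of the labels for that of the colouring. In the latter every
-- edge shows a colour triple of `P`, so its term is among those counted by `Tr`.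
edgePolynomial≤Tr : ∀ {P : Palette r} {H} (col : Colouring P H) → let open Colouring col; open Pattern P position colour in
  ∀ w → (∀ i → 0ℚ ≤ℚ w i) → edgePolynomial H w ≤ℚ Tr w w w
edgePolynomial≤Tr {P = P} {H} col w 0≤w = begin
  edgePolynomial H w
    ≡⟨ ∑ᵏ-3 (𝟙 ∘ edge H) w ⟩
  ∑³ (λ i j k → increasing toℕ i j k * (𝟙 (edge H (triple i j k)) * (w i * (w j * w k))))
    ≡⟨ ∑-increasing toℕ position Fin.toℕ-injective position-injective (triple-symmetric (𝟙 ∘ edge H) w) ⟩
  ∑³ (λ i j k → increasing position i j k * (𝟙 (edge H (triple i j k)) * (w i * (w j * w k))))
    ≤⟨ ∑³-mono (λ i j k → 𝟙-guard (position i <ᵇ position j) (position j <ᵇ position k) (edge H (triple i j k))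
         (P (colour i j) (colour i k) (colour j k)) (0≤* (0≤w i) (0≤* (0≤w j) (0≤w k)))
         λ i<j j<k e → edge-colours i j k e (ℕ.<ᵇ⇒< (position i) (position j) i<j) (ℕ.<ᵇ⇒< (position j) (position k) j<k)) ⟩
  Tr w w w ∎
  where
  open ℚ.≤-Reasoning
  open Colouring col
  open Pattern P position colour

-- Equal consecutive intervals of an injective position

natℚ-cancel-≤ : ∀ {a b} → natℚ a ≤ℚ natℚ b → a ≤ b
natℚ-cancel-≤ {a} {b} a≤b = ℕ.≮⇒≥ λ b<a → ℚ.<-irrefl refl (ℚ.<-≤-trans
  (subst (natℚ b <ℚ_) (sym (natℚ-suc b)) (subst (_<ℚ 1ℚ + natℚ b) (ℚ.+-identityˡ (natℚ b)) (ℚ.+-monoˡ-< (natℚ b) (ℚ.positive⁻¹ 1ℚ))))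
  (ℚ.≤-trans (natℚ-mono b<a) a≤b))

count-ℕ : (b : Fin n → Bool) → ∃[ c ] ∑ (𝟙 ∘ b) ≡ natℚ c
count-ℕ {ℕ.zero}  b = 0 , trans (∑-empty (𝟙 ∘ b)) (sym natℚ-0)
count-ℕ {ℕ.suc n} b with b zero in eq | count-ℕ (b ∘ suc)
... | true  | c , ∑≡c = ℕ.suc c , trans (∑-suc (𝟙 ∘ b)) (trans (cong₂ (λ x y → 𝟙 x + y) eq ∑≡c) (sym (natℚ-suc c)))
... | false | c , ∑≡c = c , trans (∑-suc (𝟙 ∘ b)) (trans (cong₂ (λ x y → 𝟙 x + y) eq ∑≡c) (ℚ.+-identityˡ (natℚ c)))

upper-bound : (f : Fin n → ℕ) → ∃[ t ] ∀ u → f u ℕ.< t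
upper-bound {ℕ.zero}  f = 0 , λ ()
upper-bound {ℕ.suc n} f with upper-bound (f ∘ suc)
... | t , f<t = ℕ.suc (f zero) ℕ.⊔ t , λ where
  zero    → ℕ.m≤m⊔n (ℕ.suc (f zero)) t
  (suc u) → ℕ.<-≤-trans (f<t u) (ℕ.m≤n⊔m (ℕ.suc (f zero)) t)

interval-indicator : ∀ x {s e} → s ≤ e → 𝟙 (not (x <ᵇ s) ∧ (x <ᵇ e)) ≡ 1ℚ * 𝟙 (x <ᵇ e) + (- 1ℚ) * 𝟙 (x <ᵇ s)
interval-indicator x {s} {e} s≤e with x <ᵇ s | ℕ.<ᵇ⇒< x s
... | true  | x<s = sym (cong (λ z → 1ℚ * 𝟙 z + (- 1ℚ) * 1ℚ) (Equivalence.to T-≡ (ℕ.<⇒<ᵇ (ℕ.<-≤-trans (x<s tt) s≤e))))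
... | false | _   = solve 1 (λ x → x := con 1ℚ :* x :+ con (- 1ℚ) :* con 0ℚ) refl (𝟙 (x <ᵇ e))

module _ (pos : Fin n → ℕ) (pos-injective : Injective _≡_ _≡_ pos) where

  private
    below : ℕ → ℚ
    below t = ∑ λ u → 𝟙 (pos u <ᵇ t)

    below-mono : ∀ {s t} → s ≤ t → below s ≤ℚ below t
    below-mono {s} {t} s≤t = ∑-mono λ u → 𝟙-mono λ p → ℕ.<⇒<ᵇ (ℕ.<-≤-trans (ℕ.<ᵇ⇒< (pos u) s p) s≤t)

    below-suc : ∀ t → below (ℕ.suc t) ≤ℚ below t + 1ℚ
    below-suc t = ℚ.≤-trans (∑-mono pointwise) (ℚ.≤-trans (ℚ.≤-reflexive (∑-+ (λ u → 𝟙 (pos u <ᵇ t)) (λ u → 𝟙 (does (pos u ℕ.≟ t)))))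
      (ℚ.+-monoʳ-≤ (below t) at-most-one))
      where
      pointwise : ∀ u → 𝟙 (pos u <ᵇ ℕ.suc t) ≤ℚ 𝟙 (pos u <ᵇ t) + 𝟙 (does (pos u ℕ.≟ t))
      pointwise u = case pos u ℕ.≟ t of λ where
        (yes ≡t) → ≤-offset (𝟙 (pos u <ᵇ t) + (1ℚ - 𝟙 (pos u <ᵇ ℕ.suc t)))
          (0≤+ (0≤𝟙 (pos u <ᵇ t)) (≤⇒0≤- (proj₂ (01-𝟙 (pos u <ᵇ ℕ.suc t)))))
          (trans (solve 2 (λ x y → x :+ (y :+ (con 1ℚ :- x)) := y :+ con 1ℚ) refl (𝟙 (pos u <ᵇ ℕ.suc t)) (𝟙 (pos u <ᵇ t)))
            (cong (λ z → 𝟙 (pos u <ᵇ t) + 𝟙 z) (sym (dec-true (pos u ℕ.≟ t) ≡t))))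
        (no ≢t) → ℚ.≤-trans (𝟙-mono λ p → ℕ.<⇒<ᵇ (ℕ.≤∧≢⇒< (ℕ.≤-pred (ℕ.<ᵇ⇒< (pos u) (ℕ.suc t) p)) ≢t))
          (≤-offset (𝟙 (does (pos u ℕ.≟ t))) (0≤𝟙 (does (pos u ℕ.≟ t))) refl)
      at-most-one : ∑ (λ u → 𝟙 (does (pos u ℕ.≟ t))) ≤ℚ 1ℚ
      at-most-one with Fin.any? (λ u → pos u ℕ.≟ t)
      ... | yes (u₀ , pos≡t) = ℚ.≤-reflexive (trans (∑-cong same) (∑-select u₀ (λ _ → 1ℚ)))
        where
        same : ∀ u → 𝟙 (does (pos u ℕ.≟ t)) ≡ 𝟙 (u₀ ≡ᵇ u) * 1ℚ
        same u with u₀ Fin.≟ u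
        ... | yes refl = cong 𝟙 (dec-true (pos u ℕ.≟ t) pos≡t)
        ... | no u₀≢u  = cong 𝟙 (dec-false (pos u ℕ.≟ t) λ pos≡t′ → u₀≢u (pos-injective (trans pos≡t (sym pos≡t′))))
      ... | no none = ℚ.≤-trans (ℚ.≤-reflexive (∑-zero λ u → cong 𝟙 (dec-false (pos u ℕ.≟ t) (λ eq → none (u , eq))))) 0≤1

    -- A discrete intermediate value argument: `below` starts at zero, and since positions are
    -- injective it rises by at most one per step.
    attained-below : ∀ k t → natℚ k ≤ℚ below t → ∃[ t′ ] below t′ ≡ natℚ k
    attained-below k ℕ.zero k≤ = 0 , ℚ.≤-antisym (ℚ.≤-trans (ℚ.≤-reflexive (∑-zero {f = λ u → 𝟙 (pos u <ᵇ 0)} λ _ → refl)) (0≤nat k)) k≤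
    attained-below k (ℕ.suc t) k≤ with natℚ k ℚ.≤? below t
    ... | yes k≤t = attained-below k t k≤t
    ... | no k≰t  = ℕ.suc t , ℚ.≤-antisym suc≤k k≤
      where
      c = proj₁ (count-ℕ (λ u → pos u <ᵇ t))
      below≡c : below t ≡ natℚ c
      below≡c = proj₂ (count-ℕ (λ u → pos u <ᵇ t))
      c<k : c ℕ.< k
      c<k = ℕ.≰⇒> λ k≤c → k≰t (subst (natℚ k ≤ℚ_) (sym below≡c) (natℚ-mono k≤c))
      suc≤k : below (ℕ.suc t) ≤ℚ natℚ k
      suc≤k = ℚ.≤-trans (below-suc t) (ℚ.≤-trans (ℚ.≤-reflexive (trans (cong (_+ 1ℚ) below≡c)
        (trans (ℚ.+-comm (natℚ c) 1ℚ) (sym (natℚ-suc c))))) (natℚ-mono c<k))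

    attained : ∀ k → k ≤ n → ∃[ t ] below t ≡ natℚ k
    attained k k≤n with upper-bound pos
    ... | t , pos<t = attained-below k t (ℚ.≤-trans (natℚ-mono k≤n) (ℚ.≤-reflexive (sym (trans
      (∑-cong λ u → cong 𝟙 (Equivalence.to T-≡ (ℕ.<⇒<ᵇ (pos<t u)))) (trans (∑-const n 1ℚ) (ℚ.*-identityʳ (natℚ n)))))))

  private
    cut-mono : ∀ {k size} .{{_ : ℕ.NonZero size}} (cut : Fin k → ℕ) → (∀ i → below (cut i) ≡ natℚ (toℕ i ℕ.* size)) →
      ∀ {i j} → toℕ i ≤ toℕ j → cut i ≤ cut j
    cut-mono {size = size} cut below-cut {i} {j} i≤j with ℕ.m≤n⇒m<n∨m≡n i≤j
    ... | inj₂ i≡j = ℕ.≤-reflexive (cong cut (Fin.toℕ-injective i≡j))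
    ... | inj₁ i<j = ℕ.≮⇒≥ λ t<s → ℕ.<⇒≱ i<j (ℕ.*-cancelʳ-≤ (toℕ j) (toℕ i) size
      (natℚ-cancel-≤ (subst₂ _≤ℚ_ (below-cut j) (below-cut i) (below-mono (ℕ.<⇒≤ t<s)))))

  intervals-between : ∀ {R size} .{{_ : ℕ.NonZero size}} (cut : Fin (ℕ.suc R) → ℕ) → (∀ i → below (cut i) ≡ natℚ (toℕ i ℕ.* size)) →
    Σ[ b ∈ (Fin R → Fin n → Bool) ] (∀ k → ∑ (𝟙 ∘ b k) ≡ natℚ size) ×
      (∀ {k l} → toℕ k ℕ.< toℕ l → ∀ u v → pos u ℕ.< pos v → T (b l u) → ¬ T (b k v))
  intervals-between {R} {size} cut below-cut = b , b-size , b-order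
    where
    start end : Fin R → ℕ
    start k = cut (Fin.inject₁ k)
    end k   = cut (suc k)
    b : Fin R → Fin n → Bool
    b k u = not (pos u <ᵇ start k) ∧ (pos u <ᵇ end k)
    b-size : ∀ k → ∑ (𝟙 ∘ b k) ≡ natℚ size
    b-size k = begin
      ∑ (𝟙 ∘ b k)
        ≡⟨ ∑-cong (λ u → interval-indicator (pos u) start≤end) ⟩
      ∑ (λ u → 1ℚ * 𝟙 (pos u <ᵇ end k) + (- 1ℚ) * 𝟙 (pos u <ᵇ start k))
        ≡⟨ ∑-linear 1ℚ (- 1ℚ) (λ u → 𝟙 (pos u <ᵇ end k)) (λ u → 𝟙 (pos u <ᵇ start k)) ⟩
      1ℚ * below (end k) + (- 1ℚ) * below (start k)
        ≡⟨ cong₂ (λ x y → 1ℚ * x + (- 1ℚ) * y) (trans (below-cut (suc k)) (natℚ-+ size (toℕ k ℕ.* size)))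
             (trans (below-cut (Fin.inject₁ k)) (cong (λ i → natℚ (i ℕ.* size)) (Fin.toℕ-inject₁ k))) ⟩
      1ℚ * (natℚ size + natℚ (toℕ k ℕ.* size)) + (- 1ℚ) * natℚ (toℕ k ℕ.* size)
        ≡⟨ solve 2 (λ s x → con 1ℚ :* (s :+ x) :+ con (- 1ℚ) :* x := s) refl (natℚ size) (natℚ (toℕ k ℕ.* size)) ⟩
      natℚ size ∎
      where
      open ≡-Reasoning
      start≤end = cut-mono cut below-cut {Fin.inject₁ k} {suc k} (ℕ.≤-trans (ℕ.≤-reflexive (Fin.toℕ-inject₁ k)) (ℕ.n≤1+n (toℕ k)))
    b-order : ∀ {k l} → toℕ k ℕ.< toℕ l → ∀ u v → pos u ℕ.< pos v → T (b l u) → ¬ T (b k v)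
    b-order {k} {l} k<l u v u<v u∈ v∈ = T-not (pos u <ᵇ start l) (T-∧ˡ (not (pos u <ᵇ start l)) u∈)
      (ℕ.<⇒<ᵇ (ℕ.<-≤-trans (ℕ.<-trans u<v (ℕ.<ᵇ⇒< (pos v) (end k) (T-∧ʳ (not (pos v <ᵇ start k)) v∈))) end≤start))
      where
      end≤start = cut-mono cut below-cut {suc k} {Fin.inject₁ l} (ℕ.≤-trans k<l (ℕ.≤-reflexive (sym (Fin.toℕ-inject₁ l))))
      T-not : ∀ b → T (not b) → ¬ T b
      T-not false _ ()
      T-∧ˡ : ∀ a {b} → T (a ∧ b) → T a
      T-∧ˡ true _ = tt
      T-∧ʳ : ∀ a {b} → T (a ∧ b) → T b
      T-∧ʳ true t = t

  opaque
    intervals : ∀ R size .{{_ : ℕ.NonZero size}} → R ℕ.* size ≤ n →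
      Σ[ b ∈ (Fin R → Fin n → Bool) ] (∀ k → ∑ (𝟙 ∘ b k) ≡ natℚ size) ×
        (∀ {k l} → toℕ k ℕ.< toℕ l → ∀ u v → pos u ℕ.< pos v → T (b l u) → ¬ T (b k v))
    intervals R size R*size≤n = intervals-between (proj₁ ∘ cut) (proj₂ ∘ cut)
      where
      cut : (i : Fin (ℕ.suc R)) → ∃[ t ] below t ≡ natℚ (toℕ i ℕ.* size)
      cut i = attained (toℕ i ℕ.* size) (ℕ.≤-trans (ℕ.*-monoˡ-≤ size (Fin.toℕ≤pred[n] i)) R*size≤n)

-- Dense colourable 3-graphs

opaque
  reciprocal : ∀ {p} → 0ℚ <ℚ p → ∃[ q ] 0ℚ <ℚ q × p * q ≡ 1ℚ
  reciprocal {p} 0<p = ℚ.1/ p , ℚ.positive⁻¹ (ℚ.1/ p) {{ℚ.1/pos⇒pos p}} , ℚ.*-inverseʳ p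
    where instance
      p-positive : ℚ.Positive p
      p-positive = ℚ.positive 0<p
      p-nonZero : ℚ.NonZero p
      p-nonZero = ℚ.pos⇒nonZero p

7ℚ : ℚ
7ℚ = + 7 / 1

private
  -- Besides xyz the expansion has seven terms, each at most `δ` when all quantities lie in [0,1].
  shift-product : ∀ {x y z δ} → In01 x → In01 y → In01 z → In01 δ →
    (x + δ) * ((y + δ) * (z + δ)) ≤ℚ x * (y * z) + 7ℚ * δ
  shift-product {x} {y} {z} {δ} x∈ y∈ z∈ δ∈ = ≤-offset
    (δ * ((1ℚ - x * y) + (1ℚ - y * z) + (1ℚ - x * z) + (1ℚ - δ * x) + (1ℚ - δ * y) + (1ℚ - δ * z) + (1ℚ - δ * δ)))
    (0≤* (proj₁ δ∈) (0≤+ (0≤+ (0≤+ (0≤+ (0≤+ (0≤+ (c x∈ y∈) (c y∈ z∈)) (c x∈ z∈)) (c δ∈ x∈)) (c δ∈ y∈)) (c δ∈ z∈)) (c δ∈ δ∈)))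
    (solve 4 (λ x y z δ → (x :+ δ) :* ((y :+ δ) :* (z :+ δ)) :+
        δ :* ((con 1ℚ :- x :* y) :+ (con 1ℚ :- y :* z) :+ (con 1ℚ :- x :* z) :+ (con 1ℚ :- δ :* x) :+ (con 1ℚ :- δ :* y) :+ (con 1ℚ :- δ :* z) :+ (con 1ℚ :- δ :* δ))
        := x :* (y :* z) :+ con 7ℚ :* δ) refl x y z δ)
    where
    c : ∀ {p q} → In01 p → In01 q → 0ℚ ≤ℚ 1ℚ - p * q
    c p∈ q∈ = ≤⇒0≤- (proj₂ (01-* p∈ q∈))

paletteDensity-shift : ∀ (P : Palette r) {x δ} → (∀ a → In01 (x a)) → In01 δ →
  paletteDensity P (λ a → x a + δ) ≤ℚ paletteDensity P x + natℚ r * (natℚ r * (natℚ r * (7ℚ * δ)))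
paletteDensity-shift {r} P {x} {δ} x∈ δ∈ = begin
  paletteDensity P (λ a → x a + δ)
    ≤⟨ ∑³-mono (λ a b c → *-monoˡ (0≤𝟙 (P a b c)) (shift-product (x∈ a) (x∈ b) (x∈ c) δ∈)) ⟩
  ∑³ (λ a b c → 𝟙 (P a b c) * (x a * (x b * x c) + 7ℚ * δ))
    ≤⟨ ∑³-mono (λ a b c → ℚ.≤-trans (ℚ.≤-reflexive (ℚ.*-distribˡ-+ (𝟙 (P a b c)) (x a * (x b * x c)) (7ℚ * δ)))
         (ℚ.+-monoʳ-≤ (𝟙 (P a b c) * (x a * (x b * x c))) (ℚ.≤-trans (*-monoʳ (0≤* (ℚ.nonNegative⁻¹ 7ℚ) (proj₁ δ∈)) (proj₂ (01-𝟙 (P a b c))))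
           (ℚ.≤-reflexive (ℚ.*-identityˡ (7ℚ * δ)))))) ⟩
  ∑³ (λ a b c → 𝟙 (P a b c) * (x a * (x b * x c)) + 7ℚ * δ)
    ≡⟨ ∑³-+ (λ a b c → 𝟙 (P a b c) * (x a * (x b * x c))) (λ _ _ _ → 7ℚ * δ) ⟩
  paletteDensity P x + ∑³ {r} (λ _ _ _ → 7ℚ * δ)
    ≤⟨ ℚ.+-monoʳ-≤ (paletteDensity P x) (∑³-bound (7ℚ * δ) λ _ _ _ → ℚ.≤-refl) ⟩
  paletteDensity P x + natℚ r * (natℚ r * (natℚ r * (7ℚ * δ))) ∎
  where open ℚ.≤-Reasoning

Probability⇒01 : ∀ {μ : Fin n → ℚ} → Probability μ → ∀ u → In01 (μ u)
Probability⇒01 {μ = μ} (probability 0≤μ ∑μ≡1) u = 0≤μ u , subst (μ u ≤ℚ_) ∑μ≡1 (term≤∑ 0≤μ u)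

-- Uniform density for weights

Dense : ℚ → ℚ → 3-Graph → Set
Dense d η H = ∀ (U : Subset (order H)) →
  d * natℚ (∣ U ∣ C 3) ≤ℚ natℚ (edgesWithin H U) + η * cube (natℚ (order H))

-- Subtracting d times the elementary polynomial leaves a multilinear form with coefficient
-- `𝟙 (edge H e) - d` on every triple. `Dense` bounds it from below at all indicators, and
-- `multilinear-min` carries the bound into the cube.
dense-weighted : ∀ {d η} H → Dense d η H → ∀ w → (∀ i → In01 (w i)) →
  d * elementary 3 w ≤ℚ edgePolynomial H w + η * cube (natℚ (order H))
dense-weighted {d} {η} H dense w w∈ = begin
  d * elementary 3 w
    ≡⟨ solve 3 (λ x e p → x := e :+ p :+ ((:- p) :- (e :+ (:- con 1ℚ) :* x))) refl (d * elementary 3 w) (edgePolynomial H w) ηN ⟩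
  edgePolynomial H w + ηN + ((- ηN) - (edgePolynomial H w + (- 1ℚ) * (d * elementary 3 w)))
    ≤⟨ ℚ.+-monoʳ-≤ (edgePolynomial H w + ηN) (≤0 (subst (- ηN ≤ℚ_) (split w)
         (multilinear-min κ (λ U → subst (- ηN ≤ℚ_) (sym (split (indicator U))) (vertex U)) w w∈))) ⟩
  edgePolynomial H w + ηN + 0ℚ  ≡⟨ ℚ.+-identityʳ (edgePolynomial H w + ηN) ⟩
  edgePolynomial H w + ηN ∎
  where
  open ℚ.≤-Reasoning
  ηN = η * cube (natℚ (order H))
  κ : Subset (order H) → ℚ
  κ e = 𝟙 (∣ e ∣ ℕ.≡ᵇ 3) * (𝟙 (edge H e) - d)
  ≤0 : ∀ {p q} → p ≤ℚ q → p - q ≤ℚ 0ℚ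
  ≤0 {p} {q} p≤q = subst (p - q ≤ℚ_) (ℚ.+-inverseʳ q) (ℚ.+-monoˡ-≤ (- q) p≤q)
  split : ∀ w → ∑ˢ (λ e → κ e * mono w e) ≡ edgePolynomial H w + (- 1ℚ) * (d * elementary 3 w)
  split w = trans
    (∑ˢ-cong λ e → solve 4 (λ s g d m → (s :* (g :- d)) :* m := con 1ℚ :* (s :* (g :* m)) :+ (:- d) :* (s :* (con 1ℚ :* m))) refl
      (𝟙 (∣ e ∣ ℕ.≡ᵇ 3)) (𝟙 (edge H e)) d (mono w e))
    (trans (∑ˢ-linear 1ℚ (- d) (λ e → 𝟙 (∣ e ∣ ℕ.≡ᵇ 3) * (𝟙 (edge H e) * mono w e)) (λ e → 𝟙 (∣ e ∣ ℕ.≡ᵇ 3) * (1ℚ * mono w e)))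
      (solve 3 (λ g d e → con 1ℚ :* g :+ (:- d) :* e := g :+ con (- 1ℚ) :* (d :* e)) refl (edgePolynomial H w) d (elementary 3 w)))
  vertex : ∀ U → - ηN ≤ℚ edgePolynomial H (indicator U) + (- 1ℚ) * (d * elementary 3 (indicator U))
  vertex U = begin
    - ηN
      ≡⟨ solve 2 (λ x p → :- p := x :+ con (- 1ℚ) :* (x :+ p)) refl (natℚ (edgesWithin H U)) ηN ⟩
    natℚ (edgesWithin H U) + (- 1ℚ) * (natℚ (edgesWithin H U) + ηN)
      ≤⟨ ℚ.+-monoʳ-≤ (natℚ (edgesWithin H U)) (ℚ.*-monoˡ-≤-nonPos (- 1ℚ) (dense U)) ⟩
    natℚ (edgesWithin H U) + (- 1ℚ) * (d * natℚ (∣ U ∣ C 3))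
      ≡⟨ cong₂ (λ x y → x + (- 1ℚ) * (d * y)) (natℚ-edgesWithin H U) (sym (∑ᵏ-binomial 3 U)) ⟩
    edgePolynomial H (indicator U) + (- 1ℚ) * (d * elementary 3 (indicator U)) ∎

∑ᵏ-3-scale : ∀ (g : Subset n → ℚ) c w → ∑ᵏ 3 g (λ i → c * w i) ≡ cube c * ∑ᵏ 3 g w
∑ᵏ-3-scale g c w = begin
  ∑ᵏ 3 g (λ i → c * w i)
    ≡⟨ ∑ᵏ-3 g (λ i → c * w i) ⟩
  ∑³ (λ i j k → increasing toℕ i j k * (g (triple i j k) * ((c * w i) * ((c * w j) * (c * w k)))))
    ≡⟨ ∑³-cong (λ i j k → solve 6 (λ o g c x y z → o :* (g :* ((c :* x) :* ((c :* y) :* (c :* z)))) := (c :* (c :* c)) :* (o :* (g :* (x :* (y :* z))))) refl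
         (increasing toℕ i j k) (g (triple i j k)) c (w i) (w j) (w k)) ⟩
  ∑³ (λ i j k → cube c * (increasing toℕ i j k * (g (triple i j k) * (w i * (w j * w k)))))
    ≡⟨ ∑³-pull (cube c) (λ i j k → increasing toℕ i j k * (g (triple i j k) * (w i * (w j * w k)))) ⟩
  cube c * ∑³ (λ i j k → increasing toℕ i j k * (g (triple i j k) * (w i * (w j * w k))))
    ≡⟨ cong (cube c *_) (∑ᵏ-3 g w) ⟨
  cube c * ∑ᵏ 3 g w ∎
  where open ≡-Reasoning

0<cube : ∀ {p} → 0ℚ <ℚ p → 0ℚ <ℚ cube p
0<cube 0<p = 0<* 0<p (0<* 0<p 0<p)

-- Dividing by `y` brings `w` into the unit cube. Both forms are cubic, so in effect only the error
-- changes, from n³ to (ny)³ for n vertices, which stays bounded when the peak `y` is of order 1/n.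
dense-bounded : ∀ {d η} H → Dense d η H → ∀ w y → 0ℚ <ℚ y → (∀ i → 0ℚ ≤ℚ w i) → (∀ i → w i ≤ℚ y) →
  d * elementary 3 w ≤ℚ edgePolynomial H w + η * cube (natℚ (order H) * y)
dense-bounded {d} {η} H dense w y 0<y 0≤w w≤y with reciprocal 0<y
... | c , 0<c , yc≡1 = *-cancelˡ-≤ (0<cube 0<c) (begin
  cube c * (d * elementary 3 w)
    ≡⟨ solve 3 (λ c d e → c :* (d :* e) := d :* (c :* e)) refl (cube c) d (elementary 3 w) ⟩
  d * (cube c * elementary 3 w)
    ≡⟨ cong (d *_) (∑ᵏ-3-scale (const 1ℚ) c w) ⟨
  d * elementary 3 (λ i → c * w i)
    ≤⟨ dense-weighted {d} {η} H dense (λ i → c * w i) (λ i → 0≤* (ℚ.<⇒≤ 0<c) (0≤w i) ,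
         ℚ.≤-trans (*-monoˡ (ℚ.<⇒≤ 0<c) (w≤y i)) (ℚ.≤-reflexive (trans (ℚ.*-comm c y) yc≡1))) ⟩
  edgePolynomial H (λ i → c * w i) + η * cube (natℚ (order H))
    ≡⟨ cong₂ _+_ (∑ᵏ-3-scale (𝟙 ∘ edge H) c w) rescale ⟩
  cube c * edgePolynomial H w + cube c * (η * cube (natℚ (order H) * y))
    ≡⟨ ℚ.*-distribˡ-+ (cube c) (edgePolynomial H w) (η * cube (natℚ (order H) * y)) ⟨
  cube c * (edgePolynomial H w + η * cube (natℚ (order H) * y)) ∎)
  where
  open ℚ.≤-Reasoning
  rescale : η * cube (natℚ (order H)) ≡ cube c * (η * cube (natℚ (order H) * y))
  rescale = trans (trans (solve 2 (λ η N → η :* (N :* (N :* N)) := con 1ℚ :* (η :* (N :* (N :* N)))) refl η (natℚ (order H)))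
    (cong (λ z → cube z * (η * cube (natℚ (order H)))) (sym yc≡1)))
    (solve 4 (λ c η N y → ((y :* c) :* ((y :* c) :* (y :* c))) :* (η :* (N :* (N :* N))) :=
      (c :* (c :* c)) :* (η :* ((N :* y) :* ((N :* y) :* (N :* y))))) refl c η (natℚ (order H)) y)

-- This is `newton₃` with ∑w² ≤ y∑w. The loss accounts for coincidences among the three chosen
-- vertices.
elementary-3-bound : ∀ (w : Fin n → ℚ) y → (∀ i → 0ℚ ≤ℚ w i) → (∀ i → w i ≤ℚ y) →
  cube (∑ w) ≤ℚ 6ℚ * elementary 3 w + 3ℚ * (∑ w * (y * ∑ w))
elementary-3-bound w y 0≤w w≤y = begin
  cube (∑ w)
    ≤⟨ ≤-offset (2ℚ * ∑ (cube ∘ w)) (0≤* (ℚ.nonNegative⁻¹ 2ℚ) (0≤∑ λ i → 0≤* (0≤w i) (0≤square (w i)))) refl ⟩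
  cube (∑ w) + 2ℚ * ∑ (cube ∘ w)
    ≡⟨ newton₃ w ⟨
  6ℚ * elementary 3 w + 3ℚ * (∑ w * ∑ (square ∘ w))
    ≤⟨ ℚ.+-monoʳ-≤ (6ℚ * elementary 3 w) (*-monoˡ (ℚ.nonNegative⁻¹ 3ℚ) (*-monoˡ (0≤∑ 0≤w)
         (ℚ.≤-trans (∑-mono λ i → *-monoʳ (0≤w i) (w≤y i)) (ℚ.≤-reflexive (∑-pull y w))))) ⟩
  6ℚ * elementary 3 w + 3ℚ * (∑ w * (y * ∑ w)) ∎
  where open ℚ.≤-Reasoning

total-mass : ∀ (νs : List (Fin n → ℚ)) → All Probability νs → ∑ (total νs) ≡ natℚ (length νs)
total-mass {n} []       []                             = trans (∑-zero {n} λ _ → refl) (sym natℚ-0)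
total-mass     (ν ∷ νs) (probability _ ∑ν≡1 ∷ probs) = trans (∑-+ ν (total νs))
  (trans (cong₂ _+_ ∑ν≡1 (total-mass νs probs)) (sym (natℚ-suc (length νs))))

total-nonNegative : ∀ (νs : List (Fin n → ℚ)) → All Probability νs → ∀ u → 0ℚ ≤ℚ total νs u
total-nonNegative []       []              u = ℚ.≤-refl
total-nonNegative (ν ∷ νs) (prob ∷ probs) u = 0≤+ (Probability.nonNegative prob u) (total-nonNegative νs probs u)

total-upper : ∀ {ρ} (νs : List (Fin n → ℚ)) → All (λ ν → ∀ u → ν u ≤ℚ ρ) νs → ∀ u → total νs u ≤ℚ natℚ (length νs) * ρ
total-upper {ρ = ρ} []       []           u = ℚ.≤-reflexive (sym (trans (cong (_* ρ) natℚ-0) (ℚ.*-zeroˡ ρ)))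
total-upper {ρ = ρ} (ν ∷ νs) (ν≤ ∷ νs≤) u = ℚ.≤-trans (ℚ.+-mono-≤ (ν≤ u) (total-upper νs νs≤ u))
  (ℚ.≤-reflexive (trans (solve 2 (λ ρ k → ρ :+ k :* ρ := (con 1ℚ :+ k) :* ρ) refl ρ (natℚ (length νs))) (cong (_* ρ) (sym (natℚ-suc (length νs))))))

-- The density carried by a homogeneous list of measures

module _ {P : Palette r} {H} (col : Colouring P H) where

  open Colouring col
  open Pattern P position colour

  private
    κ  = colourClass colour
    κ∈ = colourClass-01 colour

  record Good (ε : ℚ) (y : Fin r → ℚ) (μ ν : Fin (order H) → ℚ) : Set where
    constructor good
    field
      μ-probability : Probability μ
      ν-probability : Probability ν
      before        : Before μ ν
      density≤      : ∀ a → pairing (κ a) μ ν ≤ℚ y a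
      cut-bounded   : ∀ a → CutBounded (deviation κ κ∈ μ ν a) ε

  good-triple : ∀ {ε y α β γ} → 0ℚ ≤ℚ ε → (∀ a → 0ℚ ≤ℚ y a) → Good ε y α β → Good ε y α γ → Good ε y β γ →
    Tr α β γ ≤ℚ paletteDensity P y + natℚ r * (natℚ r * (natℚ r * (3ℚ * ε)))
  good-triple {ε} {y} {α} {β} {γ} 0≤ε 0≤y (good pα pβ _ dαβ cαβ) (good _ pγ _ dαγ cαγ) (good _ _ _ dβγ cβγ) =
    ℚ.≤-trans (Tr-regular 0≤ε pα pβ pγ cαβ cαγ cβγ)
      (ℚ.+-monoˡ-≤ (natℚ r * (natℚ r * (natℚ r * (3ℚ * ε)))) (∑³-mono λ a b d → *-monoˡ (0≤𝟙 (P a b d))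
        (*-mono (proj₁ (pairing-01 (κ∈ a) pα pβ)) (0≤* (0≤y b) (0≤y d)) (dαβ a)
          (*-mono (proj₁ (pairing-01 (κ∈ b) pα pγ)) (0≤y d) (dαγ b) (dβγ d)))))

  private
    6/m≤τ : ∀ {m τ} → 0ℚ ≤ℚ m → 6ℚ ≤ℚ m * τ → 6ℚ * square m ≤ℚ τ * cube m
    6/m≤τ {m} {τ} 0≤m 6≤mτ = ℚ.≤-trans (*-monoʳ (0≤square m) 6≤mτ)
      (ℚ.≤-reflexive (solve 2 (λ m τ → (m :* τ) :* (m :* m) := τ :* (m :* (m :* m))) refl m τ))

  -- Compare both sides of the density inequality for the sum W of the ℓ measures, in units of ℓ³.
  -- Each `τ` pays for one error: coincident vertices in the elementary polynomial (3ρ), the error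
  -- of uniform density (6ηK³), and triples of measures with a repetition (6/ℓ).
  good-density : ∀ {d η ε y ρ K τ L νs} → 0ℚ ≤ℚ ε → (∀ a → 0ℚ ≤ℚ y a) → In01 d → 0ℚ <ℚ τ → 0ℚ <ℚ ρ → 0ℚ ≤ℚ η → Dense d η H →
    AllPairs (Good ε y) νs → All Probability νs → All (λ ν → ∀ u → ν u ≤ℚ ρ) νs →
    paletteDensity P y + natℚ r * (natℚ r * (natℚ r * (3ℚ * ε))) ≡ L → 0ℚ <ℚ natℚ (length νs) →
    6ℚ ≤ℚ natℚ (length νs) * τ → 3ℚ * ρ ≤ℚ τ → natℚ (order H) * ρ ≤ℚ K → 6ℚ * (η * cube K) ≤ℚ τ → d ≤ℚ L + 3ℚ * τ
  good-density {d} {η} {ε} {y} {ρ} {K} {τ} {L} {νs} 0≤ε 0≤y d∈ 0<τ 0<ρ 0≤η dense pairs probs upper L≡ 0<ℓ 6≤ℓτ 3ρ≤τ Nρ≤K ηK≤τ =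
    *-cancelˡ-≤ (0<cube 0<ℓ) (begin
      cube ℓ * d
        ≡⟨ ℚ.*-comm (cube ℓ) d ⟩
      d * cube ℓ
        ≡⟨ cong (λ z → d * cube z) ∑W≡ℓ ⟨
      d * cube (∑ W)
        ≤⟨ *-monoˡ (proj₁ d∈) (elementary-3-bound W (ℓ * ρ) 0≤W W≤) ⟩
      d * (6ℚ * elementary 3 W + 3ℚ * (∑ W * (ℓ * ρ * ∑ W)))
        ≡⟨ cong (λ z → d * (6ℚ * elementary 3 W + 3ℚ * (z * (ℓ * ρ * z)))) ∑W≡ℓ ⟩
      d * (6ℚ * elementary 3 W + 3ℚ * (ℓ * (ℓ * ρ * ℓ)))
        ≡⟨ solve 4 (λ d e ℓ ρ → d :* (con 6ℚ :* e :+ con 3ℚ :* (ℓ :* (ℓ :* ρ :* ℓ))) := con 6ℚ :* (d :* e) :+ d :* (ℓ :* (ℓ :* ℓ) :* (con 3ℚ :* ρ))) refl d (elementary 3 W) ℓ ρ ⟩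
      6ℚ * (d * elementary 3 W) + d * (cube ℓ * (3ℚ * ρ))
        ≤⟨ ℚ.+-mono-≤ (*-monoˡ 0≤6 (dense-bounded {d} {η} H dense W (ℓ * ρ) (0<* 0<ℓ 0<ρ) 0≤W W≤))
             (ℚ.≤-trans (*-monoʳ (0≤* 0≤ℓ³ (0≤* (ℚ.nonNegative⁻¹ 3ℚ) (ℚ.<⇒≤ 0<ρ))) (proj₂ d∈))
               (ℚ.≤-trans (ℚ.≤-reflexive (ℚ.*-identityˡ (cube ℓ * (3ℚ * ρ)))) (*-monoˡ 0≤ℓ³ 3ρ≤τ))) ⟩
      6ℚ * (edgePolynomial H W + η * cube (N * (ℓ * ρ))) + cube ℓ * τ
        ≡⟨ cong (_+ cube ℓ * τ) (solve 5 (λ e η N ℓ ρ → con 6ℚ :* (e :+ η :* ((N :* (ℓ :* ρ)) :* ((N :* (ℓ :* ρ)) :* (N :* (ℓ :* ρ))))) :=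
             con 6ℚ :* e :+ ℓ :* (ℓ :* ℓ) :* (con 6ℚ :* (η :* ((N :* ρ) :* ((N :* ρ) :* (N :* ρ)))))) refl (edgePolynomial H W) η N ℓ ρ) ⟩
      6ℚ * edgePolynomial H W + cube ℓ * (6ℚ * (η * cube (N * ρ))) + cube ℓ * τ
        ≤⟨ ℚ.+-monoˡ-≤ (cube ℓ * τ) (ℚ.+-mono-≤ edges≤
             (*-monoˡ 0≤ℓ³ (ℚ.≤-trans (*-monoˡ 0≤6 (*-monoˡ 0≤η cubes)) ηK≤τ))) ⟩
      (L * cube ℓ + τ * cube ℓ) + cube ℓ * τ + cube ℓ * τ
        ≡⟨ solve 3 (λ L ℓ τ → (L :* ℓ :+ τ :* ℓ) :+ ℓ :* τ :+ ℓ :* τ := ℓ :* (L :+ con 3ℚ :* τ)) refl L (cube ℓ) τ ⟩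
      cube ℓ * (L + 3ℚ * τ) ∎)
    where
    open ℚ.≤-Reasoning
    W = total νs
    ℓ = natℚ (length νs)
    N = natℚ (order H)
    0≤6 = ℚ.nonNegative⁻¹ 6ℚ
    0≤ℓ³ = ℚ.<⇒≤ (0<cube 0<ℓ)
    ∑W≡ℓ = total-mass νs probs
    0≤W = total-nonNegative νs probs
    W≤ = total-upper νs upper
    0≤Nρ = 0≤* (0≤nat (order H)) (ℚ.<⇒≤ 0<ρ)
    cubes : cube (N * ρ) ≤ℚ cube K
    cubes = *-mono 0≤Nρ (0≤* 0≤K 0≤K) Nρ≤K (*-mono 0≤Nρ 0≤K Nρ≤K Nρ≤K)
      where 0≤K = ℚ.≤-trans 0≤Nρ Nρ≤K
    0≤L : 0ℚ ≤ℚ L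
    0≤L = subst (0ℚ ≤ℚ_) L≡ (0≤+
      (0≤∑ λ a → 0≤∑ λ b → 0≤∑ λ c → 0≤* (0≤𝟙 (P a b c)) (0≤* (0≤y a) (0≤* (0≤y b) (0≤y c))))
      (0≤* (0≤nat r) (0≤* (0≤nat r) (0≤* (0≤nat r) (0≤* (ℚ.nonNegative⁻¹ 3ℚ) 0≤ε)))))
    edges≤ : 6ℚ * edgePolynomial H W ≤ℚ L * cube ℓ + τ * cube ℓ
    edges≤ = begin
      6ℚ * edgePolynomial H W
        ≤⟨ *-monoˡ 0≤6 (edgePolynomial≤Tr col W 0≤W) ⟩
      6ℚ * Tr W W W
        ≤⟨ OrderedTrilinear.total³-bound Tr Tr-additive₁ Tr-additive₂ Tr-additive₃ (Good ε y) Probability 0≤L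
             (λ {x} {y′} {z} g g′ g″ → subst (Tr x y′ z ≤ℚ_) L≡ (good-triple 0≤ε 0≤y g g′ g″)) Tr≤1
             (λ {x} {y′} z g → Tr-vanish₁₂ {x} {y′} z (Good.before g)) (λ {x} {y′} z g → Tr-vanish₂₃ {x} {y′} z (Good.before g)) νs probs pairs ⟩
      L * cube ℓ + 6ℚ * square ℓ
        ≤⟨ ℚ.+-monoʳ-≤ (L * cube ℓ) (6/m≤τ (ℚ.<⇒≤ 0<ℓ) 6≤ℓτ) ⟩
      L * cube ℓ + τ * cube ℓ ∎

energy-nonNegative : ∀ {n r} (κ : Fin r → Fin n → Fin n → ℚ) (κ∈ : ∀ a u v → In01 (κ a u v)) (M : Measures R n) → 0ℚ ≤ℚ energy κ κ∈ M
energy-nonNegative κ κ∈ M = 0≤∑ λ k → 0≤∑ λ l → 0≤* (0≤𝟙 (toℕ k <ᵇ toℕ l)) (0≤∑ λ a → 0≤square (pairing (κ a) (M k) (M l)))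

-- Every ordered pair of vertices has exactly one colour, so the classes partition the product
-- measure.
colour-densities : ∀ (c : Fin n → Fin n → Fin r) {μ ν} → Probability μ → Probability ν →
  Probability (λ a → pairing (colourClass c a) μ ν)
colour-densities {n} {r} c {μ} {ν} μ-prob ν-prob = probability (λ a → proj₁ (pairing-01 (colourClass-01 c a) μ-prob ν-prob)) (begin
  ∑ (λ a → ∑ λ u → ∑ λ v → (μ u * ν v) * κ a u v)
    ≡⟨ ∑-swap (λ a u → ∑ λ v → (μ u * ν v) * κ a u v) ⟩
  ∑ (λ u → ∑ λ a → ∑ λ v → (μ u * ν v) * κ a u v)
    ≡⟨ ∑-cong (λ u → ∑-swap (λ a v → (μ u * ν v) * κ a u v)) ⟩
  ∑ (λ u → ∑ λ v → ∑ λ a → (μ u * ν v) * κ a u v)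
    ≡⟨ ∑-cong (λ u → ∑-cong λ v → trans (∑-pull (μ u * ν v) (λ a → κ a u v)) (trans (cong (μ u * ν v *_) (one-colour u v)) (ℚ.*-identityʳ (μ u * ν v)))) ⟩
  ∑ (λ u → ∑ λ v → μ u * ν v)
    ≡⟨ ∑∑-product μ ν ⟩
  ∑ μ * ∑ ν
    ≡⟨ cong₂ _*_ (Probability.mass μ-prob) (Probability.mass ν-prob) ⟩
  1ℚ ∎)
  where
  open ≡-Reasoning
  κ : Fin r → Fin n → Fin n → ℚ
  κ = colourClass c
  one-colour : ∀ u v → ∑ (λ a → κ a u v) ≡ 1ℚ
  one-colour u v = trans (∑-cong λ a → sym (ℚ.*-identityʳ (κ a u v))) (∑-select (c u v) (λ _ → 1ℚ))

allPairs-universal : ∀ {A : Set} {Q : A → A → Set} → (∀ x y → Q x y) → ∀ xs → AllPairs Q xs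
allPairs-universal q []       = []
allPairs-universal q (x ∷ xs) = All.universal (q x) xs ∷ allPairs-universal q xs

-- Choice of constants and the upper bound

10ℚ ⅓ : ℚ
10ℚ = + 10 / 1
⅓   = + 1 / 3

-- Of the gap 5τ, three parts are spent in `good-density` and one on the accuracy `δ`; the last
-- makes the final inequality strict.
module SparseColourable {r} (P : Palette r) {d τ : ℚ} (d∈ : In01 d) (0<τ : 0ℚ <ℚ τ)
  (sparse : ∀ x → Probability x → paletteDensity P x + (2ℚ + 3ℚ) * τ ≤ℚ d) where

  private
    r³ : ℚ → ℚ
    r³ z = natℚ r * (natℚ r * (natℚ r * z))

    -- The constant is 10 = 7 + 3: seven for shifting the point by `δ`, three for the regularity
    -- error of a triangle count. The same `δ` is the regularity threshold and the width of the 1 +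
    -- `s₀` slabs that fill [0,1].
    steps : ∃[ s ] r³ 10ℚ ≤ℚ natℚ s * τ
    steps = archimedean* (r³ 10ℚ) 0<τ

    s₀ : ℕ
    s₀ = proj₁ steps

    0<1+s₀ : 0ℚ <ℚ 1ℚ + natℚ s₀
    0<1+s₀ = ℚ.+-mono-<-≤ (ℚ.positive⁻¹ 1ℚ) (0≤nat s₀)

    δ : ℚ
    δ = proj₁ (reciprocal 0<1+s₀)

    0<δ : 0ℚ <ℚ δ
    0<δ = proj₁ (proj₂ (reciprocal 0<1+s₀))

    0≤δ : 0ℚ ≤ℚ δ
    0≤δ = ℚ.<⇒≤ 0<δ

    [1+s₀]δ≡1 : (1ℚ + natℚ s₀) * δ ≡ 1ℚ
    [1+s₀]δ≡1 = proj₂ (proj₂ (reciprocal 0<1+s₀))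

    δ≤1 : δ ≤ℚ 1ℚ
    δ≤1 = ≤-offset (natℚ s₀ * δ) (0≤* (0≤nat s₀) 0≤δ)
      (trans (solve 2 (λ s δ → δ :+ s :* δ := (con 1ℚ :+ s) :* δ) refl (natℚ s₀) δ) [1+s₀]δ≡1)

    10r³δ≤τ : r³ (10ℚ * δ) ≤ℚ τ
    10r³δ≤τ = begin
      r³ (10ℚ * δ)
        ≡⟨ solve 3 (λ r x δ → r :* (r :* (r :* (x :* δ))) := (r :* (r :* (r :* x))) :* δ) refl (natℚ r) 10ℚ δ ⟩
      r³ 10ℚ * δ
        ≤⟨ *-monoʳ 0≤δ (proj₂ steps) ⟩
      natℚ s₀ * τ * δ
        ≤⟨ ≤-offset (τ * δ) (0≤* (ℚ.<⇒≤ 0<τ) 0≤δ)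
             (solve 3 (λ s τ δ → s :* τ :* δ :+ τ :* δ := (con 1ℚ :+ s) :* δ :* τ) refl (natℚ s₀) τ δ) ⟩
      (1ℚ + natℚ s₀) * δ * τ
        ≡⟨ trans (cong (_* τ) [1+s₀]δ≡1) (ℚ.*-identityˡ τ) ⟩
      τ ∎
      where open ℚ.≤-Reasoning

    parts : ∃[ m ] 6ℚ ≤ℚ natℚ m * τ
    parts = archimedean* 6ℚ 0<τ

    -- The summand 2 provides a pair of measures from which a point of the simplex can be read. The
    -- successor makes `R₀` nonzero, so that the number of vertices can be divided by it.
    m₀ R₀ : ℕ
    m₀ = 2 ℕ.+ proj₁ parts
    R₀ = ℕ.suc (multiNumber r s₀ m₀)

    gain : ℚ
    gain = ⅓ * square δ

    3gain≡δ² : 3ℚ * gain ≡ square δ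
    3gain≡δ² = solve 1 (λ δ → con 3ℚ :* (con ⅓ :* (δ :* δ)) := δ :* δ) refl δ

    limit : ℚ
    limit = natℚ R₀ * (natℚ R₀ * natℚ r)

    fuel : ∃[ s ] limit + 1ℚ ≤ℚ natℚ s * gain
    fuel = archimedean* (limit + 1ℚ) (0<* (ℚ.positive⁻¹ ⅓) (0<* 0<δ 0<δ))

    s₁ : ℕ
    s₁ = proj₁ fuel

    -- `Q` is the growth of the peaks over `s₁` steps. `K` bounds the number of vertices times the
    -- peak value, independently of the 3-graph, because an interval contains at least a fraction
    -- 1/(2R₀) of the vertices.
    Q K : ℚ
    Q = quadruple s₁ 1ℚ
    K = natℚ (2 ℕ.* R₀) * Q

    0<Q : 0ℚ <ℚ Q
    0<Q = ℚ.<-≤-trans (ℚ.positive⁻¹ 1ℚ) (≤-quadruple s₁ 0≤1)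

    0<K : 0ℚ <ℚ K
    0<K = 0<* (0<nat (2 ℕ.* R₀)) 0<Q

    0<6K³ : 0ℚ <ℚ 6ℚ * cube K
    0<6K³ = 0<* (ℚ.positive⁻¹ 6ℚ) (0<cube 0<K)

  -- Chosen to solve 6ηK³ = τ, the error that remains once the peaks have been scaled to one.
  η : ℚ
  η = τ * proj₁ (reciprocal 0<6K³)

  0<η : 0ℚ <ℚ η
  0<η = 0<* 0<τ (proj₁ (proj₂ (reciprocal 0<6K³)))

  private
    6ηK³≡τ : 6ℚ * (η * cube K) ≡ τ
    6ηK³≡τ = trans (solve 3 (λ τ q K → con 6ℚ :* ((τ :* q) :* K) := τ :* ((con 6ℚ :* K) :* q)) refl τ (proj₁ (reciprocal 0<6K³)) (cube K))
      (trans (cong (τ *_) (proj₂ (proj₂ (reciprocal 0<6K³)))) (ℚ.*-identityʳ τ))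

    vertices : ∃[ n ] 3ℚ * K ≤ℚ natℚ n * τ
    vertices = archimedean* (3ℚ * K) 0<τ

  -- The first summand makes the intervals nonempty; the second makes the peaks, at most K divided
  -- by the number of vertices, small enough for 3ρ ≤ τ.
  n₀ : ℕ
  n₀ = R₀ ℕ.+ proj₁ vertices

  module _ (H : 3-Graph) (col : Colouring P H) (n₀≤n : n₀ ≤ order H) (dense : Dense d η H) where

    open Colouring col
    open Pattern P position colour

    private
      κ  = colourClass colour
      κ∈ = colourClass-01 colour
      N  = order H

      R₀≤N : R₀ ≤ N
      R₀≤N = ℕ.≤-trans (ℕ.m≤m+n R₀ (proj₁ vertices)) n₀≤n

      size : ℕ
      size = N ℕ./ R₀

      0<size : 0 ℕ.< size
      0<size = ℕ.m≥n⇒m/n>0 R₀≤N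

      instance
        size-nonZero : ℕ.NonZero size
        size-nonZero = ℕ.>-nonZero 0<size

      ρ₀ ρ : ℚ
      ρ₀ = proj₁ (reciprocal (0<nat size))
      ρ  = Q * ρ₀

      0<ρ₀ : 0ℚ <ℚ ρ₀
      0<ρ₀ = proj₁ (proj₂ (reciprocal (0<nat size)))

      size*ρ₀≡1 : natℚ size * ρ₀ ≡ 1ℚ
      size*ρ₀≡1 = proj₂ (proj₂ (reciprocal (0<nat size)))

      0<ρ : 0ℚ <ℚ ρ
      0<ρ = 0<* 0<Q 0<ρ₀

      N≤2R₀size : N ≤ 2 ℕ.* R₀ ℕ.* size
      N≤2R₀size = begin
        N                                ≡⟨ ℕ.m≡m%n+[m/n]*n N R₀ ⟩
        N ℕ.% R₀ ℕ.+ size ℕ.* R₀         ≤⟨ ℕ.+-monoˡ-≤ (size ℕ.* R₀) (ℕ.≤-trans (ℕ.<⇒≤ (ℕ.m%n<n N R₀)) (ℕ.m≤n*m R₀ size)) ⟩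
        size ℕ.* R₀ ℕ.+ size ℕ.* R₀      ≡⟨ cong₂ ℕ._+_ (ℕ.*-comm size R₀) (ℕ.*-comm size R₀) ⟩
        R₀ ℕ.* size ℕ.+ R₀ ℕ.* size      ≡⟨ cong (R₀ ℕ.* size ℕ.+_) (ℕ.+-identityʳ (R₀ ℕ.* size)) ⟨
        2 ℕ.* (R₀ ℕ.* size)              ≡⟨ ℕ.*-assoc 2 R₀ size ⟨
        2 ℕ.* R₀ ℕ.* size                ∎
        where open ℕ.≤-Reasoning

      Nρ≤K : natℚ N * ρ ≤ℚ K
      Nρ≤K = begin
        natℚ N * ρ
          ≤⟨ *-monoʳ (ℚ.<⇒≤ 0<ρ) (ℚ.≤-trans (natℚ-mono N≤2R₀size) (ℚ.≤-reflexive (natℚ-* (2 ℕ.* R₀) size))) ⟩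
        natℚ (2 ℕ.* R₀) * natℚ size * (Q * ρ₀)
          ≡⟨ solve 4 (λ a b c d → a :* b :* (c :* d) := a :* c :* (b :* d)) refl (natℚ (2 ℕ.* R₀)) (natℚ size) Q ρ₀ ⟩
        K * (natℚ size * ρ₀)
          ≡⟨ trans (cong (K *_) size*ρ₀≡1) (ℚ.*-identityʳ K) ⟩
        K ∎
        where open ℚ.≤-Reasoning

      3ρ≤τ : 3ℚ * ρ ≤ℚ τ
      3ρ≤τ = *-cancelˡ-≤ (0<nat N {{ℕ.>-nonZero (ℕ.<-≤-trans ℕ.z<s R₀≤N)}}) (begin
        natℚ N * (3ℚ * ρ)
          ≡⟨ solve 2 (λ n ρ → n :* (con 3ℚ :* ρ) := con 3ℚ :* (n :* ρ)) refl (natℚ N) ρ ⟩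
        3ℚ * (natℚ N * ρ)
          ≤⟨ *-monoˡ (ℚ.nonNegative⁻¹ 3ℚ) Nρ≤K ⟩
        3ℚ * K
          ≤⟨ proj₂ vertices ⟩
        natℚ (proj₁ vertices) * τ
          ≤⟨ *-monoʳ (ℚ.<⇒≤ 0<τ) (natℚ-mono (ℕ.≤-trans (ℕ.m≤n+m (proj₁ vertices) R₀) n₀≤n)) ⟩
        natℚ N * τ ∎)
        where open ℚ.≤-Reasoning

      blocks = intervals position position-injective R₀ size
        (ℕ.≤-trans (ℕ.≤-reflexive (ℕ.*-comm R₀ size)) (ℕ.m/n*n≤m N R₀))

      block : Fin R₀ → Fin N → Bool
      block = proj₁ blocks

      block-order : ∀ {k l} → toℕ k ℕ.< toℕ l → ∀ u v → position u ℕ.< position v → T (block l u) → ¬ T (block k v)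
      block-order = proj₂ (proj₂ blocks)

      M₀ : Measures R₀ N
      M₀ k u = ρ₀ * 𝟙 (block k u)

      0≤M₀ : ∀ k u → 0ℚ ≤ℚ M₀ k u
      0≤M₀ k u = 0≤* (ℚ.<⇒≤ 0<ρ₀) (0≤𝟙 (block k u))

      M₀-dominated : Dominated M₀ 1ℚ M₀
      M₀-dominated = dominated
        (λ k → probability (0≤M₀ k) (trans (∑-pull ρ₀ (λ u → 𝟙 (block k u)))
          (trans (cong (ρ₀ *_) (proj₁ (proj₂ blocks) k)) (trans (ℚ.*-comm ρ₀ (natℚ size)) size*ρ₀≡1))))
        (λ k u → ℚ.≤-reflexive (sym (ℚ.*-identityˡ (M₀ k u))))

      module _ (M : Measures R₀ N) (M-dominated : Dominated M₀ Q M) (M-regular : Regular κ κ∈ δ M) where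

        M-prob  = Dominated.prob M-dominated
        M-upper = Dominated.upper M-dominated

        M≤ρ : ∀ k u → M k u ≤ℚ ρ
        M≤ρ k u = begin
          M k u                      ≤⟨ M-upper k u ⟩
          Q * (ρ₀ * 𝟙 (block k u))   ≤⟨ *-monoˡ (ℚ.<⇒≤ 0<Q) (*-monoˡ (ℚ.<⇒≤ 0<ρ₀) (proj₂ (01-𝟙 (block k u)))) ⟩
          Q * (ρ₀ * 1ℚ)              ≡⟨ cong (Q *_) (ℚ.*-identityʳ ρ₀) ⟩
          ρ                          ∎
          where open ℚ.≤-Reasoning

        outside-block : ∀ k u → ¬ T (block k u) → M k u ≡ 0ℚ
        outside-block k u u∉ = ℚ.≤-antisym (ℚ.≤-trans (M-upper k u) (ℚ.≤-reflexive (vanish (block k u) u∉))) (Probability.nonNegative (M-prob k) u)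
          where
          vanish : ∀ b → ¬ T b → Q * (ρ₀ * 𝟙 b) ≡ 0ℚ
          vanish true  ¬tt = contradiction tt ¬tt
          vanish false _   = solve 2 (λ q x → q :* (x :* con 0ℚ) := con 0ℚ) refl Q ρ₀

        before : ∀ {k l} → toℕ k ℕ.< toℕ l → Before (M k) (M l)
        before {k} {l} k<l u v u<v = cases (T? (block l u))
          where
          cases : Dec (T (block l u)) → M l u * M k v ≡ 0ℚ
          cases (yes u∈) = trans (cong (M l u *_) (outside-block k v (block-order k<l u v u<v u∈))) (ℚ.*-zeroʳ (M l u))
          cases (no u∉)  = trans (cong (_* M k v) (outside-block l u u∉)) (ℚ.*-zeroˡ (M k v))

        density : Fin r → Fin R₀ → Fin R₀ → ℚ
        density a k l = pairing (κ a) (M k) (M l)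

        homogeneous : ∀ (l : Fin r → ℚ) ys → m₀ ≤ length ys → AllPairs (InIntervals density l δ) ys →
          AllPairs (λ k l → toℕ k ℕ.< toℕ l) ys → ⊥
        homogeneous l (y₀ ∷ []) (ℕ.s≤s ()) _ _
        homogeneous l ys@(y₀ ∷ y₁ ∷ _) m₀≤ intervals@((first ∷ _) ∷ _) increasing = ℚ.<-irrefl refl (begin-strict
          d
            ≤⟨ good-density col {d} {η} {δ} {y} {ρ} {K} {τ} {νs = List.map M ys} 0≤δ 0≤y d∈ 0<τ 0<ρ (ℚ.<⇒≤ 0<η) dense goods
                 (All.map⁺ (All.universal M-prob ys)) (All.map⁺ (All.universal M≤ρ ys)) refl
                 (0<nat (length (List.map M ys)) ) 6≤ 3ρ≤τ Nρ≤K (ℚ.≤-reflexive 6ηK³≡τ) ⟩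
          (paletteDensity P y + r³ (3ℚ * δ)) + 3ℚ * τ
            ≤⟨ ℚ.+-monoˡ-≤ (3ℚ * τ) (ℚ.+-monoˡ-≤ (r³ (3ℚ * δ)) (paletteDensity-shift P (Probability⇒01 x-prob) (0≤δ , δ≤1))) ⟩
          (paletteDensity P x + r³ (7ℚ * δ) + r³ (3ℚ * δ)) + 3ℚ * τ
            ≡⟨ solve 4 (λ p r δ τ → (p :+ r :* (r :* (r :* (con 7ℚ :* δ))) :+ r :* (r :* (r :* (con 3ℚ :* δ)))) :+ con 3ℚ :* τ :=
                 p :+ r :* (r :* (r :* (con 10ℚ :* δ))) :+ con 3ℚ :* τ) refl (paletteDensity P x) (natℚ r) δ τ ⟩
          paletteDensity P x + r³ (10ℚ * δ) + 3ℚ * τ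
            ≤⟨ ℚ.+-monoˡ-≤ (3ℚ * τ) (ℚ.+-monoʳ-≤ (paletteDensity P x) 10r³δ≤τ) ⟩
          paletteDensity P x + τ + 3ℚ * τ
            ≡⟨ trans (solve 2 (λ p τ → p :+ τ :+ con 3ℚ :* τ := con 0ℚ :+ (p :+ (con 2ℚ :+ con 2ℚ) :* τ)) refl (paletteDensity P x) τ) refl ⟩
          0ℚ + (paletteDensity P x + (2ℚ + 2ℚ) * τ)
            <⟨ ℚ.+-monoˡ-< (paletteDensity P x + (2ℚ + 2ℚ) * τ) 0<τ ⟩
          τ + (paletteDensity P x + (2ℚ + 2ℚ) * τ)
            ≡⟨ solve 2 (λ p τ → τ :+ (p :+ (con 2ℚ :+ con 2ℚ) :* τ) := p :+ (con 2ℚ :+ con 3ℚ) :* τ) refl (paletteDensity P x) τ ⟩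
          paletteDensity P x + (2ℚ + 3ℚ) * τ
            ≤⟨ sparse x x-prob ⟩
          d ∎)
          where
          open ℚ.≤-Reasoning
          -- The interval ends `l` need not sum to one, but the densities of an actual pair do. The
          -- densities of every other pair exceed these by at most `δ`.
          x y : Fin r → ℚ
          x a = density a y₀ y₁
          y a = x a + δ
          x-prob : Probability x
          x-prob = colour-densities colour (M-prob y₀) (M-prob y₁)
          0≤y : ∀ a → 0ℚ ≤ℚ y a
          0≤y a = 0≤+ (Probability.nonNegative x-prob a) 0≤δ
          goods : AllPairs (Good col δ y) (List.map M ys)
          goods = AllPairs.map⁺ (AllPairs.zipWith (λ (k<l , interval) → good (M-prob _) (M-prob _) (before k<l)
            (λ a → ℚ.≤-trans (proj₂ (interval a)) (ℚ.+-monoˡ-≤ δ (proj₁ (first a)))) (M-regular k<l)) (increasing , intervals))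
          6≤ : 6ℚ ≤ℚ natℚ (length (List.map M ys)) * τ
          6≤ = ℚ.≤-trans (proj₂ parts) (*-monoʳ (ℚ.<⇒≤ 0<τ) (natℚ-mono (ℕ.≤-trans (ℕ.m≤n+m (proj₁ parts) 2)
            (ℕ.≤-trans m₀≤ (ℕ.≤-reflexive (sym (List.length-map M ys)))))))

        contradictory : ⊥
        contradictory =
          let l , ys , σ , m₀≤ , intervals = multi-ramsey r s₀ m₀ density 0ℚ δ (allFin R₀)
                (ℕ.≤-trans (ℕ.n≤1+n (multiNumber r s₀ m₀)) (ℕ.≤-reflexive (sym (List.length-tabulate {n = R₀} id))))
                (λ a → allPairs-universal (λ k l → within a k l) (allFin R₀))
          in homogeneous l ys m₀≤ intervals (AllPairs-resp-⊆ σ (AllPairs.tabulate⁺-< id))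
          where
          within : ∀ a k l → InInterval (density a) 0ℚ (0ℚ + (1ℚ + natℚ s₀) * δ) k l
          within a k l = proj₁ D∈ , subst (density a k l ≤ℚ_) (sym (trans (ℚ.+-identityˡ ((1ℚ + natℚ s₀) * δ)) [1+s₀]δ≡1)) (proj₂ D∈)
            where D∈ = pairing-01 (κ∈ a) (M-prob k) (M-prob l)

    colourable-not-dense : ⊥
    colourable-not-dense = regularity κ κ∈ 0≤δ 3gain≡δ² 0≤M₀ s₁ 0≤1 M₀-dominated enough contradictory
      where
      enough : limit <ℚ energy κ κ∈ M₀ + natℚ s₁ * gain
      enough = begin-strict
        limit                                  ≡⟨ ℚ.+-identityˡ limit ⟨
        0ℚ + limit                             <⟨ ℚ.+-monoˡ-< limit (ℚ.positive⁻¹ 1ℚ) ⟩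
        1ℚ + limit                             ≡⟨ ℚ.+-comm 1ℚ limit ⟩
        limit + 1ℚ                             ≤⟨ proj₂ fuel ⟩
        natℚ s₁ * gain                         ≤⟨ ≤-offset (energy κ κ∈ M₀) (energy-nonNegative κ κ∈ M₀) (ℚ.+-comm (natℚ s₁ * gain) (energy κ κ∈ M₀)) ⟩
        energy κ κ∈ M₀ + natℚ s₁ * gain        ∎
        where open ℚ.≤-Reasoning

-- The 3-graph of a relation on increasing triples

private
  ∣pair∣ : ∀ {i j : Fin n} → toℕ i ℕ.< toℕ j → ∣ ⁅ i ⁆ ∪ ⁅ j ⁆ ∣ ≡ 2
  ∣pair∣ {i = zero}  {suc j} _   = cong ℕ.suc (trans (cong ∣_∣ (Subset.∪-identityˡ ⁅ j ⁆)) (Subset.∣⁅x⁆∣≡1 j))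
  ∣pair∣ {i = suc i} {suc j} i<j = ∣pair∣ {i = i} {j} (ℕ.≤-pred i<j)

∣triple∣ : ∀ {i j k : Fin n} → toℕ i ℕ.< toℕ j → toℕ j ℕ.< toℕ k → ∣ triple i j k ∣ ≡ 3
∣triple∣ {i = zero}  {suc j} {suc k} _   j<k =
  cong ℕ.suc (trans (cong ∣_∣ (Subset.∪-identityˡ (⁅ j ⁆ ∪ ⁅ k ⁆))) (∣pair∣ {i = j} {k} (ℕ.≤-pred j<k)))
∣triple∣ {i = suc i} {suc j} {suc k} i<j j<k = ∣triple∣ {i = i} {j} {k} (ℕ.≤-pred i<j) (ℕ.≤-pred j<k)

record Increasing (i j k : Fin n) : Set where
  constructor _<<_
  field
    i<j : toℕ i ℕ.< toℕ j
    j<k : toℕ j ℕ.< toℕ k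

  i<k : toℕ i ℕ.< toℕ k
  i<k = ℕ.<-trans i<j j<k

-- The set determines its least and its greatest element, and then the middle one is the element
-- left over.
triple-injective : ∀ {i j k i′ j′ k′ : Fin n} → Increasing i j k → Increasing i′ j′ k′ →
  triple i j k ≡ triple i′ j′ k′ → i ≡ i′ × j ≡ j′ × k ≡ k′
triple-injective {n} {i} {j} {k} {i′} {j′} {k′} inc inc′ eq = i≡ , j≡ , k≡
  where
  open Increasing
  member : ∀ {x a b c a′ b′ c′ : Fin n} → triple a b c ≡ triple a′ b′ c′ → x ≡ a ⊎ x ≡ b ⊎ x ≡ c → x ≡ a′ ⊎ x ≡ b′ ⊎ x ≡ c′
  member {x} {a} {b} {c} {a′} {b′} {c′} eq x∈ = ∈-triple⁻ a′ b′ c′ (subst (x ∈ˢ_) eq (∈-triple⁺ a b c x∈))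
  min≤ : ∀ {a b c x : Fin n} → Increasing a b c → x ≡ a ⊎ x ≡ b ⊎ x ≡ c → toℕ a ≤ toℕ x
  min≤ inc (inj₁ refl)        = ℕ.≤-refl
  min≤ inc (inj₂ (inj₁ refl)) = ℕ.<⇒≤ (i<j inc)
  min≤ inc (inj₂ (inj₂ refl)) = ℕ.<⇒≤ (i<k inc)
  ≤max : ∀ {a b c x : Fin n} → Increasing a b c → x ≡ a ⊎ x ≡ b ⊎ x ≡ c → toℕ x ≤ toℕ c
  ≤max inc (inj₁ refl)        = ℕ.<⇒≤ (i<k inc)
  ≤max inc (inj₂ (inj₁ refl)) = ℕ.<⇒≤ (j<k inc)
  ≤max inc (inj₂ (inj₂ refl)) = ℕ.≤-refl
  i≡ : i ≡ i′
  i≡ = Fin.toℕ-injective (ℕ.≤-antisym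
    (min≤ inc (member {x = i′} (sym eq) (inj₁ refl))) (min≤ inc′ (member {x = i} eq (inj₁ refl))))
  k≡ : k ≡ k′
  k≡ = Fin.toℕ-injective (ℕ.≤-antisym
    (≤max inc′ (member {x = k} eq (inj₂ (inj₂ refl)))) (≤max inc (member {x = k′} (sym eq) (inj₂ (inj₂ refl)))))
  j≡ : j ≡ j′
  j≡ with member {x = j} eq (inj₂ (inj₁ refl))
  ... | inj₁ j≡i′        = contradiction (trans i≡ (sym j≡i′)) (toℕ-<⇒≢ (i<j inc))
  ... | inj₂ (inj₁ j≡j′) = j≡j′
  ... | inj₂ (inj₂ j≡k′) = contradiction (trans j≡k′ (sym k≡)) (toℕ-<⇒≢ (j<k inc))

module _ (Q : Fin n → Fin n → Fin n → Bool) where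

  Represents : Subset n → Fin n → Fin n → Fin n → Set
  Represents e i j k = (toℕ i ℕ.< toℕ j × toℕ j ℕ.< toℕ k) × triple i j k ≡ e × T (Q i j k)

  opaque
    edgeOf : Subset n → Bool
    edgeOf e = ⌊ Fin.any? (λ i → Fin.any? λ j → Fin.any? λ k →
      ((toℕ i ℕ.<? toℕ j) ×-dec (toℕ j ℕ.<? toℕ k)) ×-dec ((≡-dec _≟ᵇ_ (triple i j k) e) ×-dec T? (Q i j k))) ⌋

    edgeOf-sound : ∀ e → T (edgeOf e) → ∃[ i ] ∃[ j ] ∃[ k ] Represents e i j k
    edgeOf-sound e t = toWitness t

    edgeOf-complete : ∀ {e i j k} → Represents e i j k → T (edgeOf e)
    edgeOf-complete {i = i} {j} {k} rep = fromWitness (i , j , k , rep)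

  edgeOf-triple : ∀ {i j k} → Increasing i j k → T (edgeOf (triple i j k)) → T (Q i j k)
  edgeOf-triple {i} {j} {k} inc t =
    let i′ , j′ , k′ , (i′<j′ , j′<k′) , eq , q = edgeOf-sound (triple i j k) t
        i≡ , j≡ , k≡ = triple-injective (i′<j′ << j′<k′) inc eq
    in subst T (trans (cong (λ i → Q i j′ k′) i≡) (cong₂ (Q i) j≡ k≡)) q

  graphOf : 3-Graph
  graphOf = record
    { order   = n
    ; edge    = edgeOf
    ; uniform = λ e t → let i , j , k , (i<j , j<k) , eq , _ = edgeOf-sound e t
                        in trans (cong ∣_∣ (sym eq)) (∣triple∣ {i = i} {j} {k} i<j j<k)
    }

-- Functions with prescribed rational frequencies

opaque
  unfolding ∑

  ∑-splitAt : ∀ m (f : Fin (m ℕ.+ n) → ℚ) → ∑ f ≡ ∑ (λ i → f (i Fin.↑ˡ n)) + ∑ (λ j → f (m Fin.↑ʳ j))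
  ∑-splitAt ℕ.zero    f = sym (ℚ.+-identityˡ (∑ f))
  ∑-splitAt {n} (ℕ.suc m) f = trans (cong₂ _+_ (refl {x = f zero}) (∑-splitAt m (f ∘ suc)))
    (sym (ℚ.+-assoc (f zero) (∑ (λ i → f (suc (i Fin.↑ˡ n)))) (∑ (λ j → f (suc (m Fin.↑ʳ j))))))

  ∑-combine : ∀ m (f : Fin (m ℕ.* n) → ℚ) → ∑ f ≡ ∑ (λ i → ∑ λ j → f (Fin.combine {m} {n} i j))
  ∑-combine ℕ.zero    f = refl
  ∑-combine {n} (ℕ.suc m) f = trans (∑-splitAt n f)
    (cong₂ _+_ (refl {x = ∑ λ j → f (j Fin.↑ˡ (m ℕ.* n))}) (∑-combine m (λ i → f (n Fin.↑ʳ i))))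

sumℕ : (Fin r → ℕ) → ℕ
sumℕ {ℕ.zero}  p = 0
sumℕ {ℕ.suc r} p = p zero ℕ.+ sumℕ (p ∘ suc)

natℚ-sumℕ : (p : Fin r → ℕ) → natℚ (sumℕ p) ≡ ∑ (natℚ ∘ p)
natℚ-sumℕ {ℕ.zero}  p = trans natℚ-0 (sym (∑-empty (natℚ ∘ p)))
natℚ-sumℕ {ℕ.suc r} p = trans (natℚ-+ (p zero) (sumℕ (p ∘ suc)))
  (trans (cong₂ _+_ (refl {x = natℚ (p zero)}) (natℚ-sumℕ (p ∘ suc))) (sym (∑-suc (natℚ ∘ p))))

blocksOf : (p : Fin r → ℕ) → Fin (sumℕ p) → Fin r
blocksOf {ℕ.suc r} p z = Sum.[ const zero , suc ∘ blocksOf (p ∘ suc) ] (Fin.splitAt (p zero) z)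

∑-blocksOf : ∀ (p : Fin r → ℕ) a → ∑ (λ z → 𝟙 (blocksOf p z ≡ᵇ a)) ≡ natℚ (p a)
∑-blocksOf {ℕ.suc r} p a = trans (∑-splitAt (p zero) (λ z → 𝟙 (blocksOf p z ≡ᵇ a)))
  (trans (cong₂ _+_
    (trans (∑-cong λ i → cong (λ s → 𝟙 (Sum.[ const zero , suc ∘ blocksOf (p ∘ suc) ] s ≡ᵇ a)) (Fin.splitAt-↑ˡ (p zero) i (sumℕ (p ∘ suc))))
      (∑-const (p zero) (𝟙 (zero ≡ᵇ a))))
    (∑-cong λ j → cong (λ s → 𝟙 (Sum.[ const zero , suc ∘ blocksOf (p ∘ suc) ] s ≡ᵇ a)) (Fin.splitAt-↑ʳ (p zero) (sumℕ (p ∘ suc)) j)))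
    (cases a))
  where
  cases : ∀ a → natℚ (p zero) * 𝟙 (zero ≡ᵇ a) + ∑ (λ z → 𝟙 (suc (blocksOf (p ∘ suc) z) ≡ᵇ a)) ≡ natℚ (p a)
  cases zero = trans (cong₂ _+_ (ℚ.*-identityʳ (natℚ (p zero))) (∑-zero {f = λ z → 𝟙 (suc (blocksOf (p ∘ suc) z) ≡ᵇ zero)} λ _ → refl))
    (ℚ.+-identityʳ (natℚ (p zero)))
  cases (suc a) = trans (cong₂ _+_ (ℚ.*-zeroʳ (natℚ (p zero))) (∑-blocksOf (p ∘ suc) a)) (ℚ.+-identityˡ (natℚ (p (suc a))))

private
  numerator-form : ∀ x → 0ℚ ≤ℚ x → ∃[ D ] ∃[ p ] (x * natℚ (ℕ.suc D) ≡ natℚ p)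
  numerator-form (ℚ.mkℚ ℤ.-[1+ a ] d c) 0≤x = contradiction 0≤x λ { (ℚ.*≤* ()) }
  numerator-form x@(ℚ.mkℚ (+ a) d _) 0≤x = d , a , ℚ.toℚᵘ-injective (begin
    ℚ.toℚᵘ (x * natℚ (ℕ.suc d))                       ≈⟨ ℚ.toℚᵘ-homo-* x (natℚ (ℕ.suc d)) ⟩
    ℚᵘ.mkℚᵘ (+ a) d ℚᵘ.* ℚ.toℚᵘ (natℚ (ℕ.suc d))      ≈⟨ ℚᵘ.*-congˡ {ℚᵘ.mkℚᵘ (+ a) d} (toℚᵘ-nat (ℕ.suc d)) ⟩
    ℚᵘ.mkℚᵘ (+ a) d ℚᵘ.* ℚᵘ.mkℚᵘ (+ ℕ.suc d) 0        ≈⟨ ℚᵘ.*≡* (trans (ℤ.*-identityʳ (+ a ℤ.* + ℕ.suc d))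
                                                          (cong (λ z → + a ℤ.* + z) (sym (ℕ.*-identityʳ (ℕ.suc d))))) ⟩
    ℚᵘ.mkℚᵘ (+ a) 0                                   ≈⟨ toℚᵘ-nat a ⟨
    ℚ.toℚᵘ (natℚ a)                                   ∎)
    where open ℚᵘ.≃-Reasoning

common-denominator : ∀ {x : Fin r → ℚ} → (∀ a → 0ℚ ≤ℚ x a) → ∃[ D ] Σ[ p ∈ (Fin r → ℕ) ] (∀ a → x a * natℚ (ℕ.suc D) ≡ natℚ (p a))
common-denominator {ℕ.zero}  0≤x = 0 , (λ ()) , λ ()
common-denominator {ℕ.suc r} {x} 0≤x =
  let D , p , p≡   = common-denominator (0≤x ∘ suc)
      D₀ , p₀ , p₀≡ = numerator-form (x zero) (0≤x zero)
      -- With this value `suc E` is definitionally the product of the two denominators.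
      E = D₀ ℕ.+ D ℕ.* ℕ.suc D₀
  in E , extend (p₀ ℕ.* ℕ.suc D) (λ a → p a ℕ.* ℕ.suc D₀) , λ where
    zero → begin
      x zero * natℚ (ℕ.suc D ℕ.* ℕ.suc D₀)
        ≡⟨ cong (x zero *_) (natℚ-* (ℕ.suc D) (ℕ.suc D₀)) ⟩
      x zero * (natℚ (ℕ.suc D) * natℚ (ℕ.suc D₀))
        ≡⟨ solve 3 (λ x d e → x :* (d :* e) := (x :* e) :* d) refl (x zero) (natℚ (ℕ.suc D)) (natℚ (ℕ.suc D₀)) ⟩
      x zero * natℚ (ℕ.suc D₀) * natℚ (ℕ.suc D)
        ≡⟨ cong (_* natℚ (ℕ.suc D)) p₀≡ ⟩
      natℚ p₀ * natℚ (ℕ.suc D)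
        ≡⟨ natℚ-* p₀ (ℕ.suc D) ⟨
      natℚ (p₀ ℕ.* ℕ.suc D) ∎
    (suc a) → begin
      x (suc a) * natℚ (ℕ.suc D ℕ.* ℕ.suc D₀)
        ≡⟨ cong (x (suc a) *_) (natℚ-* (ℕ.suc D) (ℕ.suc D₀)) ⟩
      x (suc a) * (natℚ (ℕ.suc D) * natℚ (ℕ.suc D₀))
        ≡⟨ ℚ.*-assoc (x (suc a)) (natℚ (ℕ.suc D)) (natℚ (ℕ.suc D₀)) ⟨
      x (suc a) * natℚ (ℕ.suc D) * natℚ (ℕ.suc D₀)
        ≡⟨ cong (_* natℚ (ℕ.suc D₀)) (p≡ a) ⟩
      natℚ (p a) * natℚ (ℕ.suc D₀)
        ≡⟨ natℚ-* (p a) (ℕ.suc D₀) ⟨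
      natℚ (p a ℕ.* ℕ.suc D₀) ∎
  where
  open ≡-Reasoning
  extend : ℕ → (Fin r → ℕ) → Fin (ℕ.suc r) → ℕ
  extend p₀ p zero    = p₀
  extend p₀ p (suc a) = p a

-- Since `x` sums to one, its numerators over a common denominator sum to that denominator.
-- Consecutive blocks with these lengths therefore fill `Fin q` in the right proportions.
frequencies : ∀ {x : Fin r → ℚ} → Probability x →
  ∃[ q ] ℕ.NonZero q × Σ[ g ∈ (Fin q → Fin r) ] (∀ a → ∑ (λ z → 𝟙 (g z ≡ᵇ a)) ≡ x a * natℚ q)
frequencies {r} {x} (probability 0≤x ∑x≡1) =
  let D , p , p≡ = common-denominator 0≤x
      q≡D : natℚ (sumℕ p) ≡ natℚ (ℕ.suc D)
      q≡D = trans (natℚ-sumℕ p) (trans (∑-cong λ a → trans (sym (p≡ a)) (ℚ.*-comm (x a) (natℚ (ℕ.suc D))))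
        (trans (∑-pull (natℚ (ℕ.suc D)) x) (trans (cong (natℚ (ℕ.suc D) *_) ∑x≡1) (ℚ.*-identityʳ (natℚ (ℕ.suc D))))))
  in sumℕ p , ℕ.>-nonZero (ℕ.<-≤-trans ℕ.z<s (natℚ-cancel-≤ (ℚ.≤-reflexive (sym q≡D)))) , blocksOf p ,
     λ a → trans (∑-blocksOf p a) (trans (sym (p≡ a)) (cong (x a *_) (sym q≡D)))

-- Pairwise independence of the coordinates of Fin q ^ N

module _ {q} (f : Fin q → ℚ) (∑f≡0 : ∑ f ≡ 0ℚ) (f∈ : ∀ z → Within1 (f z)) where

  private
    coordinate-zero : ∀ N i j → Fin.finToFun {q} {ℕ.suc N} (Fin.combine {q} {q ℕ.^ N} i j) zero ≡ i
    coordinate-zero N i j = cong proj₁ (Fin.remQuot-combine {q} {q ℕ.^ N} i j)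

    coordinate-suc : ∀ N i j d → Fin.finToFun {q} {ℕ.suc N} (Fin.combine {q} {q ℕ.^ N} i j) (suc d) ≡ Fin.finToFun {q} {N} j d
    coordinate-suc N i j d = cong (λ qr → Fin.finToFun {q} {N} (proj₂ qr) d) (Fin.remQuot-combine {q} {q ℕ.^ N} i j)

  coordinate-mean : ∀ N (d : Fin N) → ∑ (λ w → f (Fin.finToFun {q} {N} w d)) ≡ 0ℚ
  coordinate-mean (ℕ.suc N) zero = trans (∑-combine q (λ w → f (Fin.finToFun {q} {ℕ.suc N} w zero)))
    (trans (∑-cong λ i → trans (∑-cong λ j → cong f (coordinate-zero N i j)) (∑-const (q ℕ.^ N) (f i)))
      (trans (∑-pull (natℚ (q ℕ.^ N)) f) (trans (cong (natℚ (q ℕ.^ N) *_) ∑f≡0) (ℚ.*-zeroʳ (natℚ (q ℕ.^ N))))))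
  coordinate-mean (ℕ.suc N) (suc d) = trans (∑-combine q (λ w → f (Fin.finToFun {q} {ℕ.suc N} w (suc d))))
    (∑-zero λ i → trans (∑-cong λ j → cong f (coordinate-suc N i j d)) (coordinate-mean N d))

  -- Split off the first letter of the word. If it is one of the two coordinates, it is constant
  -- while the other one averages to zero over the rest; otherwise both lie in the rest.
  coordinates-orthogonal : ∀ N (d d′ : Fin N) → d ≢ d′ →
    ∑ (λ w → f (Fin.finToFun {q} {N} w d) * f (Fin.finToFun {q} {N} w d′)) ≡ 0ℚ
  coordinates-orthogonal (ℕ.suc N) zero zero d≢d′ = contradiction refl d≢d′
  coordinates-orthogonal (ℕ.suc N) zero (suc d′) _ =
    trans (∑-combine q (λ w → f (Fin.finToFun {q} {ℕ.suc N} w zero) * f (Fin.finToFun {q} {ℕ.suc N} w (suc d′))))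
      (∑-zero λ i → trans (∑-cong λ j → cong₂ (λ y z → f y * f z) (coordinate-zero N i j) (coordinate-suc N i j d′))
        (trans (∑-pull (f i) (λ j → f (Fin.finToFun {q} {N} j d′))) (trans (cong (f i *_) (coordinate-mean N d′)) (ℚ.*-zeroʳ (f i)))))
  coordinates-orthogonal (ℕ.suc N) (suc d) zero _ =
    trans (∑-combine q (λ w → f (Fin.finToFun {q} {ℕ.suc N} w (suc d)) * f (Fin.finToFun {q} {ℕ.suc N} w zero)))
      (∑-zero λ i → trans (∑-cong λ j → trans (cong₂ (λ y z → f y * f z) (coordinate-suc N i j d) (coordinate-zero N i j))
          (ℚ.*-comm (f (Fin.finToFun {q} {N} j d)) (f i)))
        (trans (∑-pull (f i) (λ j → f (Fin.finToFun {q} {N} j d))) (trans (cong (f i *_) (coordinate-mean N d)) (ℚ.*-zeroʳ (f i)))))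
  coordinates-orthogonal (ℕ.suc N) (suc d) (suc d′) d≢d′ =
    trans (∑-combine q (λ w → f (Fin.finToFun {q} {ℕ.suc N} w (suc d)) * f (Fin.finToFun {q} {ℕ.suc N} w (suc d′))))
      (∑-zero λ i → trans (∑-cong λ j → cong₂ (λ y z → f y * f z) (coordinate-suc N i j d) (coordinate-suc N i j d′))
        (coordinates-orthogonal N d d′ (d≢d′ ∘ cong suc)))

  private
    square≤1 : ∀ z → f z * f z ≤ℚ 1ℚ
    square≤1 z = ≤-offset ((1ℚ - f z) * (f z - - 1ℚ)) (0≤* (≤⇒0≤- (proj₂ (f∈ z))) (≤⇒0≤- (proj₁ (f∈ z))))
      (solve 1 (λ x → x :* x :+ (con 1ℚ :- x) :* (x :- con (- 1ℚ)) := con 1ℚ) refl (f z))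

  combination : ∀ {N} → (Fin N → ℚ) → Fin (q ℕ.^ N) → ℚ
  combination {N} h w = ∑ λ d → h d * f (Fin.finToFun {q} {N} w d)

  -- The second moment of a sum of uncorrelated terms: after expansion the mixed terms vanish by
  -- `coordinates-orthogonal`, and each diagonal term is at most the number of words.
  combination-square : ∀ {N} (h : Fin N → ℚ) →
    ∑ (λ w → square (combination h w)) ≤ℚ natℚ (q ℕ.^ N) * ∑ (square ∘ h)
  combination-square {N} h = begin
    ∑ (λ w → square (combination h w))
      ≡⟨ ∑-cong (λ w → sym (∑∑-product (λ d → h d * F w d) (λ d → h d * F w d))) ⟩
    ∑ (λ w → ∑ λ d → ∑ λ d′ → (h d * F w d) * (h d′ * F w d′))
      ≡⟨ trans (∑-swap (λ w d → ∑ λ d′ → (h d * F w d) * (h d′ * F w d′))) (∑-cong λ d → ∑-swap (λ w d′ → (h d * F w d) * (h d′ * F w d′))) ⟩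
    ∑ (λ d → ∑ λ d′ → ∑ λ w → (h d * F w d) * (h d′ * F w d′))
      ≡⟨ ∑-cong (λ d → ∑-cong λ d′ → trans
           (∑-cong λ w → solve 4 (λ a b x y → (a :* x) :* (b :* y) := (a :* b) :* (x :* y)) refl (h d) (h d′) (F w d) (F w d′))
           (∑-pull (h d * h d′) (λ w → F w d * F w d′))) ⟩
    ∑ (λ d → ∑ λ d′ → h d * h d′ * G d d′)
      ≡⟨ ∑-cong (λ d → trans (∑-cong (diagonal d)) (∑-select d (λ d′ → h d * h d′ * G d d′))) ⟩
    ∑ (λ d → h d * h d * G d d)
      ≤⟨ ∑-mono (λ d → ℚ.≤-trans (*-monoˡ (0≤square (h d)) (G≤ d)) (ℚ.≤-reflexive (ℚ.*-comm (h d * h d) (natℚ (q ℕ.^ N))))) ⟩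
    ∑ (λ d → natℚ (q ℕ.^ N) * (h d * h d))
      ≡⟨ ∑-pull (natℚ (q ℕ.^ N)) (square ∘ h) ⟩
    natℚ (q ℕ.^ N) * ∑ (square ∘ h) ∎
    where
    open ℚ.≤-Reasoning
    F : Fin (q ℕ.^ N) → Fin N → ℚ
    F w d = f (Fin.finToFun {q} {N} w d)
    G : Fin N → Fin N → ℚ
    G d d′ = ∑ λ w → F w d * F w d′
    G≤ : ∀ d → G d d ≤ℚ natℚ (q ℕ.^ N)
    G≤ d = ℚ.≤-trans (∑-bound 1ℚ λ w → square≤1 (Fin.finToFun {q} {N} w d)) (ℚ.≤-reflexive (ℚ.*-identityʳ (natℚ (q ℕ.^ N))))
    diagonal : ∀ d d′ → h d * h d′ * G d d′ ≡ 𝟙 (d ≡ᵇ d′) * (h d * h d′ * G d d′)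
    diagonal d d′ = cases (d Fin.≟ d′)
      where
      cases : (d≟d′ : Dec (d ≡ d′)) → h d * h d′ * G d d′ ≡ 𝟙 (does d≟d′) * (h d * h d′ * G d d′)
      cases (yes _)   = sym (ℚ.*-identityˡ (h d * h d′ * G d d′))
      cases (no d≢d′) = trans (cong (h d * h d′ *_) (coordinates-orthogonal N d d′ d≢d′))
        (trans (ℚ.*-zeroʳ (h d * h d′)) (sym (ℚ.*-zeroˡ (h d * h d′ * G d d′))))

  -- Cauchy–Schwarz, in the form 2 e Q X G ≤ (e Q)² + G² so that no square root is needed.
  combination-correlation : ∀ e .{{_ : ℕ.NonZero e}} .{{_ : ℕ.NonZero q}} (h : Fin (e ℕ.* e) → ℚ) (X : Fin (q ℕ.^ (e ℕ.* e)) → ℚ) →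
    let Q = natℚ (q ℕ.^ (e ℕ.* e)) in (∀ d → 0ℚ ≤ℚ h d) → (∀ d → h d ≤ℚ Q) → (∀ w → In01 (X w)) →
    ∑ (λ w → X w * combination h w) ≤ℚ natℚ e * (Q * Q)
  combination-correlation e h X 0≤h h≤Q X∈ = *-cancelˡ-≤ 0<2eQ (begin
    2ℚ * (ê * Q) * ∑ (λ w → X w * combination h w)
      ≡⟨ ∑-pull (2ℚ * (ê * Q)) (λ w → X w * combination h w) ⟨
    ∑ (λ w → 2ℚ * (ê * Q) * (X w * combination h w))
      ≤⟨ ∑-mono pointwise ⟩
    ∑ (λ w → square (ê * Q) + square (combination h w))
      ≡⟨ trans (∑-+ (λ _ → square (ê * Q)) (λ w → square (combination h w))) (cong (_+ ∑ (λ w → square (combination h w))) (∑-const (q ℕ.^ (e ℕ.* e)) (square (ê * Q)))) ⟩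
    Q * square (ê * Q) + ∑ (λ w → square (combination h w))
      ≤⟨ ℚ.+-monoʳ-≤ (Q * square (ê * Q)) (ℚ.≤-trans (combination-square h) (*-monoˡ 0≤Q
           (∑-bound (Q * Q) λ d → *-mono (0≤h d) 0≤Q (h≤Q d) (h≤Q d)))) ⟩
    Q * square (ê * Q) + Q * (natℚ (e ℕ.* e) * (Q * Q))
      ≡⟨ cong (λ z → Q * square (ê * Q) + Q * (z * (Q * Q))) (natℚ-* e e) ⟩
    Q * square (ê * Q) + Q * (ê * ê * (Q * Q))
      ≡⟨ solve 2 (λ e Q → Q :* ((e :* Q) :* (e :* Q)) :+ Q :* (e :* e :* (Q :* Q)) := con 2ℚ :* (e :* Q) :* (e :* (Q :* Q))) refl ê Q ⟩
    2ℚ * (ê * Q) * (ê * (Q * Q)) ∎)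
    where
    open ℚ.≤-Reasoning
    ê = natℚ e
    Q = natℚ (q ℕ.^ (e ℕ.* e))
    0≤Q = 0≤nat (q ℕ.^ (e ℕ.* e))
    0<2eQ : 0ℚ <ℚ 2ℚ * (ê * Q)
    0<2eQ = 0<* (ℚ.positive⁻¹ 2ℚ) (0<* (0<nat e) (0<nat (q ℕ.^ (e ℕ.* e)) {{ℕ.m^n≢0 q (e ℕ.* e)}}))
    pointwise : ∀ w → 2ℚ * (ê * Q) * (X w * combination h w) ≤ℚ square (ê * Q) + square (combination h w)
    pointwise w = ≤-offset
      (square (ê * Q) * (1ℚ - X w * X w) + square (ê * Q * X w - combination h w))
      (0≤+ (0≤* (0≤square (ê * Q)) (≤⇒0≤- (proj₂ (01-* (X∈ w) (X∈ w))))) (0≤square (ê * Q * X w - combination h w)))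
      (solve 3 (λ k x g → con 2ℚ :* k :* (x :* g) :+ (k :* k :* (con 1ℚ :- x :* x) :+ (k :* x :- g) :* (k :* x :- g)) := k :* k :+ g :* g) refl
        (ê * Q) (X w) (combination h w))

-- The vertices are pairs (d , w) of a block d and a word w; the colour of a pair is read off the
-- coordinate of the first word at the block of the second vertex.
module QuasirandomColouring {r q} .{{_ : ℕ.NonZero q}} (g : Fin q → Fin r) (x : Fin r → ℚ) (x∈ : ∀ a → In01 (x a))
  (frequency : ∀ a → ∑ (λ z → 𝟙 (g z ≡ᵇ a)) ≡ x a * natℚ q) (e : ℕ) .{{_ : ℕ.NonZero e}} where

  -- The number of blocks is a square, so that the square root arising from Cauchy-Schwarz is the
  -- natural number `e`.
  N W size : ℕ
  N    = e ℕ.* e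
  W    = q ℕ.^ N
  size = N ℕ.* W

  blk : Fin size → Fin N
  blk v = proj₁ (Fin.remQuot {N} W v)

  word : Fin size → Fin W
  word v = proj₂ (Fin.remQuot {N} W v)

  pair : Fin N → Fin W → Fin size
  pair = Fin.combine {N} {W}

  blk-pair : ∀ d w → blk (pair d w) ≡ d
  blk-pair d w = cong proj₁ (Fin.remQuot-combine {N} {W} d w)

  word-pair : ∀ d w → word (pair d w) ≡ w
  word-pair d w = cong proj₂ (Fin.remQuot-combine {N} {W} d w)

  hue : Fin size → Fin size → Fin r
  hue v v′ = g (Fin.finToFun {q} {N} (word v) (blk v′))

  inBlockOrder : Fin size → Fin size → Bool
  inBlockOrder v v′ = toℕ (blk v) <ᵇ toℕ (blk v′)

  private
    deficit : Fin r → Fin q → ℚ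
    deficit a z = x a - 𝟙 (g z ≡ᵇ a)

    ∑-deficit : ∀ a → ∑ (deficit a) ≡ 0ℚ
    ∑-deficit a = begin
      ∑ (deficit a)
        ≡⟨ ∑-cong (λ z → solve 2 (λ x y → x :- y := con 1ℚ :* x :+ con (- 1ℚ) :* y) refl (x a) (𝟙 (g z ≡ᵇ a))) ⟩
      ∑ (λ z → 1ℚ * x a + (- 1ℚ) * 𝟙 (g z ≡ᵇ a))
        ≡⟨ ∑-linear 1ℚ (- 1ℚ) (λ _ → x a) (λ z → 𝟙 (g z ≡ᵇ a)) ⟩
      1ℚ * ∑ {q} (λ _ → x a) + (- 1ℚ) * ∑ (λ z → 𝟙 (g z ≡ᵇ a))
        ≡⟨ cong₂ (λ y z → 1ℚ * y + (- 1ℚ) * z) (∑-const q (x a)) (frequency a) ⟩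
      1ℚ * (natℚ q * x a) + (- 1ℚ) * (x a * natℚ q)
        ≡⟨ solve 2 (λ q x → con 1ℚ :* (q :* x) :+ con (- 1ℚ) :* (x :* q) := con 0ℚ) refl (natℚ q) (x a) ⟩
      0ℚ ∎
      where open ≡-Reasoning

    deficit-Within1 : ∀ a z → Within1 (deficit a z)
    deficit-Within1 a z = 01-difference (x∈ a) (01-𝟙 (g z ≡ᵇ a))

  model actual : Fin r → Fin size → Fin size → ℚ
  model a v v′  = 𝟙 (inBlockOrder v v′) * x a
  actual a v v′ = 𝟙 (inBlockOrder v v′) * 𝟙 (hue v v′ ≡ᵇ a)

  -- The trivial bound is the square of `size`, that is N²W²; this value is smaller by the factor
  -- N/e = e.
  error : ℚ
  error = natℚ N * (natℚ e * (natℚ W * natℚ W))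

  -- Fix the block of the first vertex. The second vertex influences the colour only through its
  -- block, so summing over its word leaves a coefficient `h d d′` for each block, and the sum over
  -- blocks is a combination of mean-zero functions of distinct coordinates of the first word.
  -- `combination-correlation` bounds its correlation with a test function; the weight `U` is
  -- absorbed into the tests.
  quasirandom : ∀ {U : Fin size → ℚ} → (∀ v → In01 (U v)) → ∀ a →
    CutBounded (λ v v′ → U v * U v′ * (model a v v′ - actual a v v′)) error
  quasirandom {U} U∈ a X Y X∈ Y∈ = begin
    ∑ (λ v → ∑ λ v′ → U v * U v′ * (model a v v′ - actual a v v′) * (X v * Y v′))
      ≡⟨ trans (∑-combine N (λ v → ∑ (F v))) (∑-cong λ d → ∑-cong λ w → ∑-combine N (F (pair d w))) ⟩
    ∑ (λ d → ∑ λ w → ∑ λ d′ → ∑ λ w′ → F (pair d w) (pair d′ w′))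
      ≡⟨ ∑-cong (λ d → ∑-cong λ w → trans (∑-cong λ d′ → trans (∑-cong λ w′ → rearrange d w d′ w′)
           (∑-pull (X′ (pair d w) * (b d d′ * f (Fin.finToFun {q} {N} w d′))) (λ w′ → Y′ (pair d′ w′))))
           (trans (∑-cong λ d′ → solve 4 (λ X b f Y → X :* (b :* f) :* Y := X :* ((b :* Y) :* f)) refl
                (X′ (pair d w)) (b d d′) (f (Fin.finToFun {q} {N} w d′)) (∑ λ w′ → Y′ (pair d′ w′)))
              (∑-pull (X′ (pair d w)) (λ d′ → h d d′ * f (Fin.finToFun {q} {N} w d′))))) ⟩
    ∑ (λ d → ∑ λ w → X′ (pair d w) * combination f (∑-deficit a) (deficit-Within1 a) (h d) w)
      ≤⟨ ∑-bound (natℚ e * (natℚ W * natℚ W)) (λ d → combination-correlation f (∑-deficit a) (deficit-Within1 a) e (h d) (λ w → X′ (pair d w))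
           (λ d′ → 0≤* (0≤𝟙 (toℕ d <ᵇ toℕ d′)) (0≤∑ λ w′ → proj₁ (Y′∈ (pair d′ w′)))) (h≤ d) (λ w → X′∈ (pair d w))) ⟩
    error ∎
    where
    open ℚ.≤-Reasoning
    f : Fin q → ℚ
    f = deficit a
    X′ Y′ : Fin size → ℚ
    X′ v = U v * X v
    Y′ v = U v * Y v
    X′∈ : ∀ v → In01 (X′ v)
    X′∈ v = 01-* (U∈ v) (X∈ v)
    Y′∈ : ∀ v → In01 (Y′ v)
    Y′∈ v = 01-* (U∈ v) (Y∈ v)
    F : Fin size → Fin size → ℚ
    F v v′ = U v * U v′ * (model a v v′ - actual a v v′) * (X v * Y v′)
    b : Fin N → Fin N → ℚ
    b d d′ = 𝟙 (toℕ d <ᵇ toℕ d′)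
    h : Fin N → Fin N → ℚ
    h d d′ = b d d′ * ∑ λ w′ → Y′ (pair d′ w′)
    h≤ : ∀ d d′ → h d d′ ≤ℚ natℚ W
    h≤ d d′ = ℚ.≤-trans (*-mono (0≤𝟙 (toℕ d <ᵇ toℕ d′)) (0≤nat W) (proj₂ (01-𝟙 (toℕ d <ᵇ toℕ d′)))
        (ℚ.≤-trans (∑-bound 1ℚ λ w′ → proj₂ (Y′∈ (pair d′ w′))) (ℚ.≤-reflexive (ℚ.*-identityʳ (natℚ W)))))
      (ℚ.≤-reflexive (ℚ.*-identityˡ (natℚ W)))
    factored : ∀ v v′ → F v v′ ≡ X′ v * (b (blk v) (blk v′) * f (Fin.finToFun {q} {N} (word v) (blk v′))) * Y′ v′
    factored v v′ = solve 7 (λ u u′ b x k X Y → u :* u′ :* (b :* x :- b :* k) :* (X :* Y) := (u :* X) :* (b :* (x :- k)) :* (u′ :* Y)) refl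
      (U v) (U v′) (b (blk v) (blk v′)) (x a) (𝟙 (hue v v′ ≡ᵇ a)) (X v) (Y v′)
    rearrange : ∀ d w d′ w′ → F (pair d w) (pair d′ w′) ≡ X′ (pair d w) * (b d d′ * f (Fin.finToFun {q} {N} w d′)) * Y′ (pair d′ w′)
    rearrange d w d′ w′ = trans (factored (pair d w) (pair d′ w′))
      (trans (cong₂ (λ B w″ → X′ (pair d w) * (B * f (Fin.finToFun {q} {N} w″ (blk (pair d′ w′)))) * Y′ (pair d′ w′))
          (cong₂ b (blk-pair d w) (blk-pair d′ w′)) (word-pair d w))
        (cong (λ d″ → X′ (pair d w) * (b d d′ * f (Fin.finToFun {q} {N} w d″)) * Y′ (pair d′ w′)) (blk-pair d′ w′)))

-- The quasirandom 3-graph and its density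

paletteDensity-01 : ∀ (P : Palette r) {x} → Probability x → In01 (paletteDensity P x)
paletteDensity-01 P {x} (probability 0≤x ∑x≡1) =
  (0≤∑ λ a → 0≤∑ λ b → 0≤∑ λ c → 0≤* (0≤𝟙 (P a b c)) (0≤xxx a b c)) ,
  ℚ.≤-trans (∑³-mono λ a b c → ℚ.≤-trans (*-monoʳ (0≤xxx a b c) (proj₂ (01-𝟙 (P a b c)))) (ℚ.≤-reflexive (ℚ.*-identityˡ (x a * (x b * x c)))))
    (ℚ.≤-reflexive (trans (∑³-product x x x) (cong₂ _*_ ∑x≡1 (cong₂ _*_ ∑x≡1 ∑x≡1))))
  where
  0≤xxx : ∀ a b c → 0ℚ ≤ℚ x a * (x b * x c)
  0≤xxx a b c = 0≤* (0≤x a) (0≤* (0≤x b) (0≤x c))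

module QuasirandomGraph {r q} .{{_ : ℕ.NonZero q}} (P : Palette r) (g : Fin q → Fin r) {x : Fin r → ℚ} (x-prob : Probability x)
  (frequency : ∀ a → ∑ (λ z → 𝟙 (g z ≡ᵇ a)) ≡ x a * natℚ q) (e : ℕ) .{{_ : ℕ.NonZero e}} where

  open QuasirandomColouring g x (Probability⇒01 x-prob) frequency e

  private
    pattern′ : Fin size → Fin size → Fin size → Bool
    pattern′ i j k = (inBlockOrder i j ∧ inBlockOrder j k) ∧ P (hue i j) (hue i k) (hue j k)

    ∧-left : ∀ a {b} → T (a ∧ b) → T a
    ∧-left true _ = tt

    ∧-right : ∀ a {b} → T (a ∧ b) → T b
    ∧-right true t = t

    blk-cancel-< : ∀ {v v′} → toℕ (blk v) ℕ.< toℕ (blk v′) → toℕ v ℕ.< toℕ v′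
    blk-cancel-< {v} {v′} lt = subst₂ (λ u u′ → toℕ u ℕ.< toℕ u′) (Fin.combine-remQuot {N} W v) (Fin.combine-remQuot {N} W v′)
      (Fin.combine-monoˡ-< (word v) (word v′) lt)

  graph : 3-Graph
  graph = graphOf pattern′

  colouring : Colouring P graph
  colouring = record
    { position           = toℕ
    ; position-injective = Fin.toℕ-injective
    ; colour             = hue
    ; edge-colours       = λ i j k t i<j j<k → ∧-right (inBlockOrder i j ∧ inBlockOrder j k) (edgeOf-triple pattern′ (i<j << j<k) t)
    }

  private
    module _ (U : Subset size) where

      u : Fin size → ℚ
      u = indicator U

      u∈ : ∀ i → In01 (u i)
      u∈ i = 01-𝟙 (lookup U i)

      uuu : Fin size → Fin size → Fin size → ℚ
      uuu i j k = u i * (u j * u k)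

      uuu∈ : ∀ i j k → In01 (uuu i j k)
      uuu∈ i j k = 01-* (u∈ i) (01-* (u∈ j) (u∈ k))

      bo : Fin size → Fin size → ℚ
      bo i j = 𝟙 (inBlockOrder i j)

      -- The triples of `U` in increasing blocks, written with one factor for each pair of vertices,
      -- the shape on which `triangle-counting` works.
      spread : ℚ
      spread = ∑³ λ i j k → uuu i j k * (bo i j * (bo i k * bo j k))

      edges-lower : ∑³ (λ i j k → uuu i j k * (bo i j * bo j k * 𝟙 (P (hue i j) (hue i k) (hue j k)))) ≤ℚ natℚ (edgesWithin graph U)
      edges-lower = begin
        ∑³ (λ i j k → uuu i j k * (bo i j * bo j k * 𝟙 (P (hue i j) (hue i k) (hue j k))))
          ≡⟨ ∑³-cong (λ i j k → cong (uuu i j k *_) (sym (trans (𝟙-∧ (inBlockOrder i j ∧ inBlockOrder j k) (P (hue i j) (hue i k) (hue j k)))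
               (cong (_* 𝟙 (P (hue i j) (hue i k) (hue j k))) (𝟙-∧ (inBlockOrder i j) (inBlockOrder j k)))))) ⟩
        ∑³ (λ i j k → uuu i j k * 𝟙 (pattern′ i j k))
          ≤⟨ ∑³-mono (λ i j k → by-cases i j k (T? (pattern′ i j k))) ⟩
        ∑³ (λ i j k → increasing toℕ i j k * (𝟙 (edge graph (triple i j k)) * uuu i j k))
          ≡⟨ ∑ᵏ-3 (𝟙 ∘ edge graph) u ⟨
        edgePolynomial graph u
          ≡⟨ natℚ-edgesWithin graph U ⟨
        natℚ (edgesWithin graph U) ∎
        where
        open ℚ.≤-Reasoning
        by-cases : ∀ i j k → Dec (T (pattern′ i j k)) → uuu i j k * 𝟙 (pattern′ i j k) ≤ℚ increasing toℕ i j k * (𝟙 (edge graph (triple i j k)) * uuu i j k)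
        by-cases i j k (no ¬p) = ℚ.≤-trans (ℚ.≤-reflexive (trans (cong (uuu i j k *_) (false-𝟙 (pattern′ i j k) ¬p)) (ℚ.*-zeroʳ (uuu i j k))))
          (0≤* (0≤* (0≤𝟙 (toℕ i <ᵇ toℕ j)) (0≤𝟙 (toℕ j <ᵇ toℕ k))) (0≤* (0≤𝟙 (edge graph (triple i j k))) (proj₁ (uuu∈ i j k))))
          where
          false-𝟙 : ∀ b → ¬ T b → 𝟙 b ≡ 0ℚ
          false-𝟙 true  ¬t = contradiction tt ¬t
          false-𝟙 false _  = refl
        by-cases i j k (yes p) = ℚ.≤-reflexive (trans (cong (λ b → uuu i j k * 𝟙 b) (Equivalence.to T-≡ p)) (sym (trans
          (cong₂ (λ o b → o * (𝟙 b * uuu i j k)) (cong₂ _*_ (lt-true i<j) (lt-true j<k))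
            (Equivalence.to T-≡ (edgeOf-complete pattern′ ((i<j , j<k) , refl , p))))
          (solve 1 (λ u → con 1ℚ :* con 1ℚ :* (con 1ℚ :* u) := u :* con 1ℚ) refl (uuu i j k)))))
          where
          blocks = ∧-left (inBlockOrder i j ∧ inBlockOrder j k) p
          i<j = blk-cancel-< (ℕ.<ᵇ⇒< (toℕ (blk i)) (toℕ (blk j)) (∧-left (inBlockOrder i j) blocks))
          j<k = blk-cancel-< (ℕ.<ᵇ⇒< (toℕ (blk j)) (toℕ (blk k)) (∧-right (inBlockOrder i j) blocks))

      r³ : ℚ → ℚ
      r³ z = natℚ r * (natℚ r * (natℚ r * z))

      n̂ : ℚ
      n̂ = natℚ size

      0≤error : 0ℚ ≤ℚ error
      0≤error = 0≤* (0≤nat N) (0≤* (0≤nat e) (0≤* (0≤nat W) (0≤nat W)))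

      -- `triangle-counting` runs from `model` to `actual`, so its upper bound for the model count
      -- is a lower bound for the edges. The at most r³ colour triples of `P` incur one counting
      -- error each.
      pattern-count : paletteDensity P x * spread ≤ℚ natℚ (edgesWithin graph U) + r³ (3ℚ * (n̂ * error))
      pattern-count = begin
        paletteDensity P x * spread
          ≡⟨ trans (ℚ.*-comm (paletteDensity P x) spread) (sym (∑³-pull spread (λ a b c → 𝟙 (P a b c) * (x a * (x b * x c))))) ⟩
        ∑³ (λ a b c → spread * (𝟙 (P a b c) * (x a * (x b * x c))))
          ≡⟨ ∑³-cong (λ a b c → trans (solve 3 (λ s p x → s :* (p :* x) := p :* (x :* s)) refl spread (𝟙 (P a b c)) (x a * (x b * x c)))
               (cong (𝟙 (P a b c) *_) (trans (sym (∑³-pull (x a * (x b * x c)) (λ i j k → uuu i j k * (bo i j * (bo i k * bo j k)))))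
                 (∑³-cong λ i j k → solve 7 (λ xa xb xc u l m n → (xa :* (xb :* xc)) :* (u :* (l :* (m :* n))) := u :* ((l :* xa) :* ((m :* xb) :* (n :* xc)))) refl
                   (x a) (x b) (x c) (uuu i j k) (bo i j) (bo i k) (bo j k))))) ⟩
        ∑³ (λ a b c → 𝟙 (P a b c) * ∑³ (λ i j k → uuu i j k * (model a i j * (model b i k * model c j k))))
          ≤⟨ ∑³-mono (λ a b c → *-monoˡ (0≤𝟙 (P a b c)) (counted a b c)) ⟩
        ∑³ (λ a b c → 𝟙 (P a b c) * (A a b c + 3ℚ * (n̂ * error)))
          ≤⟨ ∑³-mono (λ a b c → ℚ.≤-trans (ℚ.≤-reflexive (ℚ.*-distribˡ-+ (𝟙 (P a b c)) (A a b c) (3ℚ * (n̂ * error))))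
               (ℚ.+-monoʳ-≤ (𝟙 (P a b c) * A a b c) (ℚ.≤-trans (*-monoʳ 0≤3nE (proj₂ (01-𝟙 (P a b c)))) (ℚ.≤-reflexive (ℚ.*-identityˡ (3ℚ * (n̂ * error))))))) ⟩
        ∑³ (λ a b c → 𝟙 (P a b c) * A a b c + 3ℚ * (n̂ * error))
          ≡⟨ ∑³-+ (λ a b c → 𝟙 (P a b c) * A a b c) (λ _ _ _ → 3ℚ * (n̂ * error)) ⟩
        ∑³ (λ a b c → 𝟙 (P a b c) * A a b c) + ∑³ {r} (λ _ _ _ → 3ℚ * (n̂ * error))
          ≤⟨ ℚ.+-mono-≤ (ℚ.≤-trans (ℚ.≤-reflexive regroup) edges-lower) (∑³-bound (3ℚ * (n̂ * error)) λ _ _ _ → ℚ.≤-refl) ⟩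
        natℚ (edgesWithin graph U) + r³ (3ℚ * (n̂ * error)) ∎
        where
        open ℚ.≤-Reasoning
        0≤3nE = 0≤* {3ℚ} (ℚ.nonNegative⁻¹ 3ℚ) (0≤* (0≤nat size) 0≤error)
        A : Fin r → Fin r → Fin r → ℚ
        A a b c = ∑³ λ i j k → uuu i j k * (actual a i j * (actual b i k * actual c j k))
        mass≤ : ∑ u ≤ℚ n̂
        mass≤ = ℚ.≤-trans (∑-bound 1ℚ (λ i → proj₂ (u∈ i))) (ℚ.≤-reflexive (ℚ.*-identityʳ n̂))
        0≤u = λ i → proj₁ (u∈ i)
        model∈ : ∀ a i j → In01 (model a i j)
        model∈ a i j = 01-* (01-𝟙 (inBlockOrder i j)) (Probability⇒01 x-prob a)
        actual∈ : ∀ a i j → In01 (actual a i j)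
        actual∈ a i j = 01-* (01-𝟙 (inBlockOrder i j)) (01-𝟙 (hue i j ≡ᵇ a))
        counted : ∀ a b c → ∑³ (λ i j k → uuu i j k * (model a i j * (model b i k * model c j k))) ≤ℚ A a b c + 3ℚ * (n̂ * error)
        counted a b c = triangle-counting 0≤u 0≤u 0≤u mass≤ mass≤ mass≤
          (model a) (model b) (model c) (actual a) (actual b) (actual c) 0≤error
          (model∈ b) (model∈ c) (actual∈ a) (actual∈ b) (quasirandom u∈ a) (quasirandom u∈ b) (quasirandom u∈ c)
        κκκ : Fin r → Fin r → Fin r → Fin size → Fin size → Fin size → ℚ
        κκκ a b c i j k = 𝟙 (hue i j ≡ᵇ a) * (𝟙 (hue i k ≡ᵇ b) * 𝟙 (hue j k ≡ᵇ c))
        regroup : ∑³ (λ a b c → 𝟙 (P a b c) * A a b c) ≡ ∑³ (λ i j k → uuu i j k * (bo i j * bo j k * 𝟙 (P (hue i j) (hue i k) (hue j k))))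
        regroup = trans (∑³-cong λ a b c → trans (sym (∑³-pull (𝟙 (P a b c)) (λ i j k → uuu i j k * (actual a i j * (actual b i k * actual c j k)))))
            (∑³-cong λ i j k → trans (solve 8 (λ p u l m n ka kb kc → p :* (u :* ((l :* ka) :* ((m :* kb) :* (n :* kc)))) :=
                 (u :* (l :* n :* m)) :* (p :* (ka :* (kb :* kc)))) refl
                 (𝟙 (P a b c)) (uuu i j k) (bo i j) (bo i k) (bo j k) (𝟙 (hue i j ≡ᵇ a)) (𝟙 (hue i k ≡ᵇ b)) (𝟙 (hue j k ≡ᵇ c)))
               -- `chain` removes the comparison of the outer two blocks, which follows from the
               -- other two comparisons.
               (cong (λ z → uuu i j k * z * (𝟙 (P a b c) * κκκ a b c i j k)) (chain (toℕ (blk i)) (toℕ (blk j)) (toℕ (blk k))))))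
          (trans (∑³-∑³-swap (λ a b c i j k → uuu i j k * (bo i j * bo j k) * (𝟙 (P a b c) * κκκ a b c i j k)))
            (∑³-cong λ i j k → trans (∑³-pull (uuu i j k * (bo i j * bo j k)) (λ a b c → 𝟙 (P a b c) * κκκ a b c i j k))
              (trans (cong (uuu i j k * (bo i j * bo j k) *_) (sym (palette-expansion P (hue i j) (hue i k) (hue j k))))
                (ℚ.*-assoc (uuu i j k) (bo i j * bo j k) (𝟙 (P (hue i j) (hue i k) (hue j k)))))))

      same : Fin size → Fin size → ℚ
      same i j = 𝟙 (blk i ≡ᵇ blk j)

      ∑-same : ∀ i → ∑ (same i) ≡ natℚ W
      ∑-same i = trans (∑-combine N (same i)) (trans
        (∑-cong λ d → trans (∑-cong λ w → cong (λ d′ → 𝟙 (blk i ≡ᵇ d′)) (blk-pair d w)) (trans (∑-const W (𝟙 (blk i ≡ᵇ d))) (ℚ.*-comm (natℚ W) (𝟙 (blk i ≡ᵇ d)))))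
        (∑-select (blk i) (λ _ → natℚ W)))

      -- Blocks are monotone in the labels, so an increasing triple that `spread` misses has two
      -- consecutive vertices in one block. With n vertices there are at most n²W triples of either
      -- kind.
      triples-upper : natℚ (∣ U ∣ C 3) ≤ℚ spread + 2ℚ * (n̂ * (n̂ * natℚ W))
      triples-upper = begin
        natℚ (∣ U ∣ C 3)
          ≡⟨ trans (sym (∑ᵏ-binomial 3 U)) (∑ᵏ-3 (const 1ℚ) u) ⟩
        ∑³ (λ i j k → increasing toℕ i j k * (1ℚ * uuu i j k))
          ≤⟨ ∑³-mono pointwise ⟩
        ∑³ (λ i j k → uuu i j k * (bo i j * (bo i k * bo j k)) + (same i j + same j k))
          ≡⟨ trans (∑³-+ (λ i j k → uuu i j k * (bo i j * (bo i k * bo j k))) (λ i j k → same i j + same j k))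
               (cong₂ _+_ (refl {x = spread}) (∑³-+ (λ i j k → same i j) (λ i j k → same j k))) ⟩
        spread + (∑³ (λ i j k → same i j) + ∑³ (λ i j k → same j k))
          ≡⟨ cong₂ (λ y z → spread + (y + z)) same₁₂ same₂₃ ⟩
        spread + (n̂ * (n̂ * natℚ W) + n̂ * (n̂ * natℚ W))
          ≡⟨ solve 2 (λ s z → s :+ (z :+ z) := s :+ con 2ℚ :* z) refl spread (n̂ * (n̂ * natℚ W)) ⟩
        spread + 2ℚ * (n̂ * (n̂ * natℚ W)) ∎
        where
        open ℚ.≤-Reasoning
        same₁₂ : ∑³ (λ i j k → same i j) ≡ n̂ * (n̂ * natℚ W)
        same₁₂ = trans (∑-cong λ i → trans (∑-cong λ j → ∑-const size (same i j)) (trans (∑-pull n̂ (same i)) (cong (n̂ *_) (∑-same i))))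
          (∑-const size (n̂ * natℚ W))
        same₂₃ : ∑³ (λ i j k → same j k) ≡ n̂ * (n̂ * natℚ W)
        same₂₃ = trans (∑-const size (∑ λ j → ∑ (same j))) (cong (n̂ *_) (trans (∑-cong ∑-same) (∑-const size (natℚ W))))
        0≤same : ∀ i j → 0ℚ ≤ℚ same i j
        0≤same i j = 0≤𝟙 (blk i ≡ᵇ blk j)
        0≤s : ∀ i j k → 0ℚ ≤ℚ uuu i j k * (bo i j * (bo i k * bo j k))
        0≤s i j k = 0≤* (proj₁ (uuu∈ i j k)) (0≤* (0≤𝟙 (inBlockOrder i j)) (0≤* (0≤𝟙 (inBlockOrder i k)) (0≤𝟙 (inBlockOrder j k))))
        ≤uuu : ∀ i j k → increasing toℕ i j k * (1ℚ * uuu i j k) ≤ℚ uuu i j k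
        ≤uuu i j k = ℚ.≤-trans (*-mono (proj₁ inc∈) (proj₁ (uuu∈ i j k)) (proj₂ inc∈) (ℚ.≤-reflexive (ℚ.*-identityˡ (uuu i j k))))
            (ℚ.≤-reflexive (ℚ.*-identityˡ (uuu i j k)))
          where inc∈ = 01-* (01-𝟙 (toℕ i <ᵇ toℕ j)) (01-𝟙 (toℕ j <ᵇ toℕ k))
        ≤1 : ∀ i j k → increasing toℕ i j k * (1ℚ * uuu i j k) ≤ℚ 1ℚ
        ≤1 i j k = ℚ.≤-trans (≤uuu i j k) (proj₂ (uuu∈ i j k))
        blk-< : ∀ {i j} → toℕ i ℕ.< toℕ j → ¬ (blk i ≡ blk j) → toℕ (blk i) ℕ.< toℕ (blk j)
        blk-< {i} {j} i<j i≁j = ℕ.≤∧≢⇒< (ℕ.≮⇒≥ λ j<i → ℕ.<-asym i<j (blk-cancel-< {j} {i} j<i)) (i≁j ∘ Fin.toℕ-injective)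
        cases : ∀ i j k → Dec (toℕ i ℕ.< toℕ j) → Dec (toℕ j ℕ.< toℕ k) → Dec (blk i ≡ blk j) → Dec (blk j ≡ blk k) →
          increasing toℕ i j k * (1ℚ * uuu i j k) ≤ℚ uuu i j k * (bo i j * (bo i k * bo j k)) + (same i j + same j k)
        cases i j k (no i≮j) _ _ _ = ℚ.≤-trans (ℚ.≤-reflexive (trans (cong (λ z → z * 𝟙 (toℕ j <ᵇ toℕ k) * (1ℚ * uuu i j k)) (lt-false i≮j))
            (solve 2 (λ y z → con 0ℚ :* y :* z := con 0ℚ) refl (𝟙 (toℕ j <ᵇ toℕ k)) (1ℚ * uuu i j k))))
          (0≤+ (0≤s i j k) (0≤+ (0≤same i j) (0≤same j k)))
        cases i j k (yes _) (no j≮k) _ _ = ℚ.≤-trans (ℚ.≤-reflexive (trans (cong (λ z → 𝟙 (toℕ i <ᵇ toℕ j) * z * (1ℚ * uuu i j k)) (lt-false j≮k))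
            (solve 2 (λ y z → y :* con 0ℚ :* z := con 0ℚ) refl (𝟙 (toℕ i <ᵇ toℕ j)) (1ℚ * uuu i j k))))
          (0≤+ (0≤s i j k) (0≤+ (0≤same i j) (0≤same j k)))
        cases i j k (yes _) (yes _) (yes i~j) _ = ℚ.≤-trans (≤1 i j k) (≤-offset (uuu i j k * (bo i j * (bo i k * bo j k)) + same j k)
          (0≤+ (0≤s i j k) (0≤same j k))
          (trans (solve 2 (λ s t → con 1ℚ :+ (s :+ t) := s :+ (con 1ℚ :+ t)) refl (uuu i j k * (bo i j * (bo i k * bo j k))) (same j k))
            (cong (λ z → uuu i j k * (bo i j * (bo i k * bo j k)) + (𝟙 z + same j k)) (sym (dec-true (blk i Fin.≟ blk j) i~j)))))
        cases i j k (yes _) (yes _) (no _) (yes j~k) = ℚ.≤-trans (≤1 i j k) (≤-offset (uuu i j k * (bo i j * (bo i k * bo j k)) + same i j)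
          (0≤+ (0≤s i j k) (0≤same i j))
          (trans (solve 2 (λ s t → con 1ℚ :+ (s :+ t) := s :+ (t :+ con 1ℚ)) refl (uuu i j k * (bo i j * (bo i k * bo j k))) (same i j))
            (cong (λ z → uuu i j k * (bo i j * (bo i k * bo j k)) + (same i j + 𝟙 z)) (sym (dec-true (blk j Fin.≟ blk k) j~k)))))
        cases i j k (yes i<j) (yes j<k) (no i≁j) (no j≁k) = ℚ.≤-trans (≤uuu i j k) (≤-offset (same i j + same j k) (0≤+ (0≤same i j) (0≤same j k))
          (cong (_+ (same i j + same j k)) (trans (sym (ℚ.*-identityʳ (uuu i j k))) (cong (uuu i j k *_)
            (sym (cong₂ _*_ (lt-true bi<bj) (cong₂ _*_ (lt-true (ℕ.<-trans bi<bj bj<bk)) (lt-true bj<bk))))))))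
          where
          bi<bj = blk-< i<j i≁j
          bj<bk = blk-< j<k j≁k
        pointwise : ∀ i j k → increasing toℕ i j k * (1ℚ * uuu i j k) ≤ℚ uuu i j k * (bo i j * (bo i k * bo j k)) + (same i j + same j k)
        pointwise i j k = cases i j k (toℕ i ℕ.<? toℕ j) (toℕ j ℕ.<? toℕ k) (blk i Fin.≟ blk j) (blk j Fin.≟ blk k)

  -- In units of the cubed number of vertices the counting error is 3r³/e, and the triples with a
  -- shared block cost 2/e² ≤ 2/e. This is the origin of the requirement on `e`.
  graph-dense : ∀ {ε} → 0ℚ ≤ℚ ε → natℚ r * (natℚ r * (natℚ r * 3ℚ)) + 2ℚ ≤ℚ natℚ e * ε → Dense (paletteDensity P x) ε graph
  graph-dense {ε} 0≤ε large U = begin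
    D * natℚ (∣ U ∣ C 3)
      ≤⟨ *-monoˡ (proj₁ D∈) (triples-upper U) ⟩
    D * (spread U + 2ℚ * (ν * (ν * w)))
      ≡⟨ ℚ.*-distribˡ-+ D (spread U) (2ℚ * (ν * (ν * w))) ⟩
    D * spread U + D * (2ℚ * (ν * (ν * w)))
      ≤⟨ ℚ.+-mono-≤ (pattern-count U) (ℚ.≤-trans (*-monoʳ 0≤2nnw (proj₂ D∈)) (ℚ.≤-reflexive (ℚ.*-identityˡ (2ℚ * (ν * (ν * w)))))) ⟩
    E + r³ U (3ℚ * (ν * error)) + 2ℚ * (ν * (ν * w))
      ≡⟨ cong₂ (λ y z → E + r³ U (3ℚ * (y * (z * (ê * (w * w))))) + 2ℚ * (y * (y * w))) ν≡ (natℚ-* e e) ⟩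
    E + r³ U (3ℚ * ((ê * ê * w) * (ê * ê * (ê * (w * w))))) + 2ℚ * ((ê * ê * w) * ((ê * ê * w) * w))
      ≡⟨ solve 4 (λ E r e w → E :+ r :* (r :* (r :* (con 3ℚ :* ((e :* e :* w) :* (e :* e :* (e :* (w :* w))))))) :+ con 2ℚ :* ((e :* e :* w) :* ((e :* e :* w) :* w)) :=
           E :+ ((r :* (r :* (r :* con 3ℚ))) :* e :+ con 2ℚ) :* (e :* e :* (e :* e) :* (w :* (w :* w)))) refl E (natℚ r) ê w ⟩
    E + (natℚ r * (natℚ r * (natℚ r * 3ℚ)) * ê + 2ℚ) * (ê * ê * (ê * ê) * cube w)
      ≤⟨ ℚ.+-monoʳ-≤ E (*-monoʳ 0≤e⁴w³ (ℚ.≤-trans (ℚ.+-monoʳ-≤ (natℚ r * (natℚ r * (natℚ r * 3ℚ)) * ê) 2≤2e)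
           (ℚ.≤-trans (ℚ.≤-reflexive (sym (ℚ.*-distribʳ-+ ê (natℚ r * (natℚ r * (natℚ r * 3ℚ))) 2ℚ))) (*-monoʳ (0≤nat e) large)))) ⟩
    E + ê * ε * ê * (ê * ê * (ê * ê) * cube w)
      ≡⟨ cong₂ _+_ (refl {x = E}) (solve 3 (λ e ε w → e :* ε :* e :* (e :* e :* (e :* e) :* (w :* (w :* w))) :=
           ε :* ((e :* e :* w) :* ((e :* e :* w) :* (e :* e :* w)))) refl ê ε w) ⟩
    E + ε * cube (ê * ê * w)
      ≡⟨ cong (λ z → E + ε * cube z) ν≡ ⟨
    E + ε * cube ν ∎
    where
    open ℚ.≤-Reasoning
    D = paletteDensity P x
    D∈ = paletteDensity-01 P x-prob
    E = natℚ (edgesWithin graph U)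
    ν = natℚ size
    w = natℚ W
    ê = natℚ e
    ν≡ : ν ≡ ê * ê * w
    ν≡ = trans (natℚ-* N W) (cong (_* w) (natℚ-* e e))
    0≤2nnw = 0≤* {2ℚ} (ℚ.nonNegative⁻¹ 2ℚ) (0≤* (0≤nat size) (0≤* (0≤nat size) (0≤nat W)))
    0≤e⁴w³ = 0≤* (0≤* (0≤* (0≤nat e) (0≤nat e)) (0≤* (0≤nat e) (0≤nat e))) (0≤* (0≤nat W) (0≤* (0≤nat W) (0≤nat W)))
    2≤2e : 2ℚ ≤ℚ 2ℚ * ê
    2≤2e = *-monoˡ {2ℚ} (ℚ.nonNegative⁻¹ 2ℚ) (ℚ.≤-trans (ℚ.≤-reflexive (sym natℚ-1)) (natℚ-mono (ℕ.>-nonZero⁻¹ e)))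

  e≤order : e ≤ order graph
  e≤order = ℕ.≤-trans (ℕ.m≤m*n e e) (ℕ.m≤m*n N W {{ℕ.m^n≢0 q N}})

dense-colourable : ∀ (P : Palette r) {x} → Probability x → ∀ {ε} → 0ℚ <ℚ ε → ∀ n₀ →
  Σ[ H ∈ 3-Graph ] (Colouring P H × n₀ ≤ order H × Dense (paletteDensity P x) ε H)
dense-colourable {r} P {x} x-prob {ε} 0<ε n₀ =
  let q , q-nonZero , g , frequency = frequencies x-prob
      e₀ , large = archimedean* (natℚ r * (natℚ r * (natℚ r * 3ℚ)) + 2ℚ) 0<ε
      open QuasirandomGraph {{q-nonZero}} P g x-prob frequency (ℕ.suc (n₀ ℕ.+ e₀))
  in graph , colouring , ℕ.≤-trans (ℕ.≤-trans (ℕ.m≤m+n n₀ e₀) (ℕ.n≤1+n (n₀ ℕ.+ e₀))) e≤order ,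
     graph-dense (ℚ.<⇒≤ 0<ε) (ℚ.≤-trans large (*-monoʳ (ℚ.<⇒≤ 0<ε) (natℚ-mono (ℕ.≤-trans (ℕ.m≤n+m e₀ n₀) (ℕ.n≤1+n (n₀ ℕ.+ e₀))))))

-- Colourability passes to subhypergraphs

∈-⋃-singletons⁻ : ∀ {x} (f : Fin m → Fin n) is → x ∈ˢ ⋃ (List.map (⁅_⁆ ∘ f) is) → ∃[ i ] i ∈ᴸ is × x ≡ f i
∈-⋃-singletons⁻ f []       x∈ = contradiction x∈ Subset.∉⊥
∈-⋃-singletons⁻ f (i ∷ is) x∈ with Subset.x∈p∪q⁻ ⁅ f i ⁆ (⋃ (List.map (⁅_⁆ ∘ f) is)) x∈
... | inj₁ x∈fi = i , here refl , Subset.x∈⁅y⁆⇒x≡y (f i) x∈fi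
... | inj₂ x∈is = let j , j∈ , x≡ = ∈-⋃-singletons⁻ f is x∈is in j , there j∈ , x≡

∈-⋃-singletons⁺ : ∀ (f : Fin m → Fin n) {i} is → i ∈ᴸ is → f i ∈ˢ ⋃ (List.map (⁅_⁆ ∘ f) is)
∈-⋃-singletons⁺ f (i ∷ is) (here refl) = Subset.x∈p∪q⁺ (inj₁ (Subset.x∈⁅x⁆ (f i)))
∈-⋃-singletons⁺ f (j ∷ is) (there i∈)  = Subset.x∈p∪q⁺ {p = ⁅ f j ⁆} (inj₂ (∈-⋃-singletons⁺ f is i∈))

∈-image⁻ : ∀ {x} (f : Fin m → Fin n) e → x ∈ˢ image f e → ∃[ i ] i ∈ˢ e × x ≡ f i
∈-image⁻ f e x∈ = let i , i∈ , x≡ = ∈-⋃-singletons⁻ f (elements e) x∈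
                  in i , proj₂ (∈-filter⁻ (Subset._∈? e) {xs = allFin _} i∈) , x≡

∈-image⁺ : ∀ (f : Fin m → Fin n) e {i} → i ∈ˢ e → f i ∈ˢ image f e
∈-image⁺ f e {i} i∈ = ∈-⋃-singletons⁺ f (elements e) (∈-filter⁺ (Subset._∈? e) (∈-allFin i) i∈)

image-id : ∀ (e : Subset n) → image id e ≡ e
image-id e = Subset.⊆-antisym
  (λ x∈ → let i , i∈ , x≡i = ∈-image⁻ id e x∈ in subst (_∈ˢ e) (sym x≡i) i∈)
  (λ x∈ → ∈-image⁺ id e x∈)

image-triple : ∀ (f : Fin m → Fin n) i j k → image f (triple i j k) ≡ triple (f i) (f j) (f k)
image-triple f i j k = Subset.⊆-antisym
  (λ x∈ → let l , l∈ , x≡ = ∈-image⁻ f (triple i j k) x∈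
          in ∈-triple⁺ (f i) (f j) (f k) (Sum.map (trans x≡ ∘ cong f) (Sum.map (trans x≡ ∘ cong f) (trans x≡ ∘ cong f)) (∈-triple⁻ i j k l∈)))
  (λ {x} x∈ → back (∈-triple⁻ (f i) (f j) (f k) x∈))
  where
  back : ∀ {x} → x ≡ f i ⊎ x ≡ f j ⊎ x ≡ f k → x ∈ˢ image f (triple i j k)
  back (inj₁ refl)        = ∈-image⁺ f (triple i j k) (∈-triple⁺ i j k (inj₁ refl))
  back (inj₂ (inj₁ refl)) = ∈-image⁺ f (triple i j k) (∈-triple⁺ i j k (inj₂ (inj₁ refl)))
  back (inj₂ (inj₂ refl)) = ∈-image⁺ f (triple i j k) (∈-triple⁺ i j k (inj₂ (inj₂ refl)))

⊑-refl : ∀ H → H ⊑ H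
⊑-refl H = id , id , λ e e∈ → subst (T ∘ edge H) (sym (image-id e)) e∈

colouring-⊑ : ∀ {P : Palette r} {G H} → G ⊑ H → Colouring P H → Colouring P G
colouring-⊑ {G = G} {H} (f , f-injective , f-edges) col = record
  { position           = position ∘ f
  ; position-injective = f-injective ∘ position-injective
  ; colour             = λ i j → colour (f i) (f j)
  ; edge-colours       = λ i j k e → edge-colours (f i) (f j) (f k) (subst (T ∘ edge H) (image-triple f i j k) (f-edges (triple i j k) e))
  }
  where open Colouring col

Uncolourable : Palette r → Family
Uncolourable P G = ¬ Colouring P G

colourable⇒free : ∀ {P : Palette r} {H} → Colouring P H → H IsFree Uncolourable P
colourable⇒free col G ¬col G⊑H = ¬col (colouring-⊑ G⊑H col)

-- An uncolourable `H` would be a member of the family and contain itself. The double negation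
-- suffices because the upper bound ends in a contradiction.
free⇒¬¬colourable : ∀ {P : Palette r} {H} → H IsFree Uncolourable P → ¬ ¬ Colouring P H
free⇒¬¬colourable {H = H} free ¬col = free H ¬col (⊑-refl H)

-- The uniform Turán density of the family of uncolourable 3-graphs

≤-from-≤+ε : ∀ {p q} → (∀ ε → 0ℚ <ℚ ε → p ≤ℚ q + ε) → p ≤ℚ q
≤-from-≤+ε {p} {q} h with p ℚ.≤? q
... | yes p≤q = p≤q
... | no p≰q  = contradiction (begin-strict
  p                   ≤⟨ h (½ * (p - q)) (0<* (ℚ.positive⁻¹ ½) 0<p-q) ⟩
  q + ½ * (p - q)     ≡⟨ solve 2 (λ p q → q :+ con ½ :* (p :- q) := con 0ℚ :+ (q :+ con ½ :* (p :- q))) refl p q ⟩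
  0ℚ + (q + ½ * (p - q)) <⟨ ℚ.+-monoˡ-< (q + ½ * (p - q)) (0<* (ℚ.positive⁻¹ ½) 0<p-q) ⟩
  ½ * (p - q) + (q + ½ * (p - q)) ≡⟨ solve 2 (λ p q → con ½ :* (p :- q) :+ (q :+ con ½ :* (p :- q)) := p) refl p q ⟩
  p                   ∎) (ℚ.<-irrefl refl)
  where
  open ℚ.≤-Reasoning
  0<p-q : 0ℚ <ℚ p - q
  0<p-q = subst (_<ℚ p - q) (ℚ.+-inverseʳ q) (ℚ.+-monoˡ-< (- q) (ℚ.≰⇒> p≰q))

p≤∣p∣ : ∀ p → p ≤ℚ ℚ.∣ p ∣
p≤∣p∣ p with ℚ.≤-total 0ℚ p
... | inj₁ 0≤p = ℚ.≤-reflexive (sym (ℚ.0≤p⇒∣p∣≡p 0≤p))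
... | inj₂ p≤0 = ℚ.≤-trans p≤0 (ℚ.0≤∣p∣ p)

close⇒≤ : ∀ {p q ε} → ℚ.∣ p - q ∣ <ℚ ε → p ≤ℚ q + ε
close⇒≤ {p} {q} {ε} close = begin
  p                      ≡⟨ solve 2 (λ p q → p := q :+ (p :- q)) refl p q ⟩
  q + (p - q)            ≤⟨ ℚ.+-monoʳ-≤ q (p≤∣p∣ (p - q)) ⟩
  q + ℚ.∣ p - q ∣        ≤⟨ ℚ.+-monoʳ-≤ q (ℚ.<⇒≤ close) ⟩
  q + ε                  ∎
  where
  open ℚ.≤-Reasoning

binomial≤cube : ∀ (U : Subset n) → natℚ (∣ U ∣ C 3) ≤ℚ cube (natℚ n)
binomial≤cube {n} U = begin
  natℚ (∣ U ∣ C 3)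
    ≡⟨ trans (sym (∑ᵏ-binomial 3 U)) (∑ᵏ-3 (const 1ℚ) (indicator U)) ⟩
  ∑³ (λ i j k → increasing toℕ i j k * (1ℚ * (indicator U i * (indicator U j * indicator U k))))
    ≤⟨ ∑³-bound 1ℚ (λ i j k → proj₂ (01-* (01-* (01-𝟙 (toℕ i <ᵇ toℕ j)) (01-𝟙 (toℕ j <ᵇ toℕ k)))
         (01-* (01-𝟙 true) (01-* (01-𝟙 (lookup U i)) (01-* (01-𝟙 (lookup U j)) (01-𝟙 (lookup U k))))))) ⟩
  natℚ n * (natℚ n * (natℚ n * 1ℚ))
    ≡⟨ cong (λ z → natℚ n * (natℚ n * z)) (ℚ.*-identityʳ (natℚ n)) ⟩
  cube (natℚ n) ∎
  where open ℚ.≤-Reasoning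

natℚ-^3 : ∀ n → natℚ (n ℕ.^ 3) ≡ cube (natℚ n)
natℚ-^3 n = trans (natℚ-* n (n ℕ.* (n ℕ.* 1))) (cong (natℚ n *_) (trans (natℚ-* n (n ℕ.* 1)) (cong (λ z → natℚ n * natℚ z) (ℕ.*-identityʳ n))))

-- The two hypotheses say that `y` is the supremum of the palette density over the rational points
-- of the simplex, without asking for a rational point that attains it.
module _ (P : Palette r) (y : ℝ)
  (approached : ∀ ε → 0ℚ <ℚ ε → ∃[ x ] Probability x × ∃[ N ] (∀ n → N ≤ n → seq y n ≤ℚ paletteDensity P x + ε))
  (bounded : ∀ x → Probability x → ∀ ε → 0ℚ <ℚ ε → ∃[ N ] (∀ n → N ≤ n → paletteDensity P x ≤ℚ seq y n + ε)) where

  y∈[0,1] : y ∈ [0,1]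
  y∈[0,1] = 0≤y , y≤1
    where
    0≤y : 0ℝ ≤ℝ y
    0≤y ε 0<ε = let x , x-prob , _ = approached 1ℚ (ℚ.positive⁻¹ 1ℚ)
                    N , below = bounded x x-prob ε 0<ε
                in N , λ n N≤n → ℚ.≤-trans (proj₁ (paletteDensity-01 P x-prob)) (below n N≤n)
    y≤1 : y ≤ℝ 1ℝ
    y≤1 ε 0<ε = let x , x-prob , N , above = approached ε 0<ε
                in N , λ n N≤n → ℚ.≤-trans (above n N≤n) (ℚ.+-monoˡ-≤ ε (proj₂ (paletteDensity-01 P x-prob)))

  y-attainable : y ∈ AttainableDensity (Uncolourable P)
  y-attainable = y∈[0,1] , λ η (ε₀ , 0<ε₀ , N₁ , η≥) n₀ →
    -- `ε₀` is a rational that eventually lies below `η`. Half of it pays for replacing `y` by the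
    -- palette density at `x`, the other half is the density error of `H`; `binomial≤cube` expresses
    -- both in the same unit.
    let ε₁ = ½ * ε₀
        0<ε₁ = 0<* {½} (ℚ.positive⁻¹ ½) 0<ε₀
        x , x-prob , N₂ , above = approached ε₁ 0<ε₁
        H , col , n₀≤ , dense = dense-colourable P x-prob 0<ε₁ n₀
    in H , colourable⇒free col , (λ U ε 0<ε → N₁ ℕ.⊔ N₂ , λ n N≤n →
         estimate H η ε₀ 0<ε₀ (paletteDensity P x) dense U ε 0<ε n (η≥ n (ℕ.m⊔n≤o⇒m≤o N₁ N₂ N≤n)) (above n (ℕ.m⊔n≤o⇒n≤o N₁ N₂ N≤n))) , n₀≤
    where
    open ℚ.≤-Reasoning
    estimate : ∀ H η ε₀ → 0ℚ <ℚ ε₀ → ∀ D → Dense D (½ * ε₀) H → ∀ (U : Subset (order H)) ε → 0ℚ <ℚ ε → ∀ n →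
      0ℚ + ε₀ ≤ℚ seq η n → seq y n ≤ℚ D + ½ * ε₀ →
      seq (y *ℝ fromℕ (∣ U ∣ C 3) -ℝ η *ℝ fromℕ (order H ℕ.^ 3)) n ≤ℚ seq (fromℕ (edgesWithin H U)) n + ε
    estimate H η ε₀ 0<ε₀ D dense U ε 0<ε n η≥ y≤ = begin
      seq y n * (+ (∣ U ∣ C 3) / 1) + (- (seq η n * (+ (order H ℕ.^ 3) / 1)))
        ≡⟨ cong₂ (λ a b → seq y n * a + (- (seq η n * b))) (sym (natℚ-def (∣ U ∣ C 3))) (trans (sym (natℚ-def (order H ℕ.^ 3))) (natℚ-^3 (order H))) ⟩
      seq y n * c + (- (seq η n * V))
        ≤⟨ ℚ.+-mono-≤ (*-monoʳ (0≤nat (∣ U ∣ C 3)) y≤) (ℚ.neg-antimono-≤ (*-monoʳ 0≤V (ℚ.≤-trans (ℚ.≤-reflexive (sym (ℚ.+-identityˡ ε₀))) η≥))) ⟩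
      (D + ½ * ε₀) * c + (- (ε₀ * V))
        ≡⟨ cong (_+ (- (ε₀ * V))) (ℚ.*-distribʳ-+ c D (½ * ε₀)) ⟩
      D * c + ½ * ε₀ * c + (- (ε₀ * V))
        ≤⟨ ℚ.+-monoˡ-≤ (- (ε₀ * V)) (ℚ.+-mono-≤ (dense U) (*-monoˡ (0≤* {½} (ℚ.nonNegative⁻¹ ½) (ℚ.<⇒≤ 0<ε₀)) (binomial≤cube U))) ⟩
      E + ½ * ε₀ * V + ½ * ε₀ * V + (- (ε₀ * V))
        ≡⟨ solve 3 (λ E e V → E :+ con ½ :* e :* V :+ con ½ :* e :* V :+ (:- (e :* V)) := E) refl E ε₀ V ⟩
      E
        ≤⟨ ≤-offset ε (ℚ.<⇒≤ 0<ε) refl ⟩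
      E + ε
        ≡⟨ cong (_+ ε) (natℚ-def (edgesWithin H U)) ⟩
      (+ edgesWithin H U / 1) + ε ∎
      where
      c = natℚ (∣ U ∣ C 3)
      V = cube (natℚ (order H))
      E = natℚ (edgesWithin H U)
      0≤V : 0ℚ ≤ℚ V
      0≤V = 0≤* (0≤nat (order H)) (0≤* (0≤nat (order H)) (0≤nat (order H)))

  dense-rational : ∀ {d d′ η} H → UniformlyDense d (fromℚ η) H → ∃[ N ] (∀ n → N ≤ n → d′ ≤ℚ seq d n) → Dense d′ η H
  dense-rational {d} {d′} {η} H dense (N₁ , d′≤d) U = ≤-from-≤+ε λ ε 0<ε →
    let N₂ , below = dense U ε 0<ε
        n = N₁ ℕ.⊔ N₂
    in begin
    d′ * c
      ≤⟨ *-monoʳ (0≤nat (∣ U ∣ C 3)) (d′≤d n (ℕ.m≤m⊔n N₁ N₂)) ⟩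
    seq d n * c
      ≡⟨ solve 3 (λ x η V → x := x :+ (:- (η :* V)) :+ η :* V) refl (seq d n * c) η V ⟩
    seq d n * c + (- (η * V)) + η * V
      ≡⟨ cong (_+ η * V) (cong₂ (λ a b → seq d n * a + (- (η * b))) (natℚ-def (∣ U ∣ C 3)) (trans (sym (natℚ-^3 (order H))) (natℚ-def (order H ℕ.^ 3)))) ⟩
    seq (d *ℝ fromℕ (∣ U ∣ C 3) -ℝ fromℚ η *ℝ fromℕ (order H ℕ.^ 3)) n + η * V
      ≤⟨ ℚ.+-monoˡ-≤ (η * V) (below n (ℕ.m≤n⊔m N₁ N₂)) ⟩
    (+ edgesWithin H U / 1) + ε + η * V
      ≡⟨ cong (λ z → z + ε + η * V) (natℚ-def (edgesWithin H U)) ⟨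
    E + ε + η * V
      ≡⟨ solve 3 (λ E ε x → E :+ ε :+ x := E :+ x :+ ε) refl E ε (η * V) ⟩
    E + η * V + ε ∎
    where
    open ℚ.≤-Reasoning
    c = natℚ (∣ U ∣ C 3)
    V = cube (natℚ (order H))
    E = natℚ (edgesWithin H U)

  Attains : ℝ → Set
  Attains d = ∀ η → 0ℝ <ℝ η → ∀ n → Σ[ H ∈ 3-Graph ] (H IsFree Uncolourable P × UniformlyDense d η H × n ≤ order H)

  -- The allowance 7ε splits as follows: 2ε in `d′`, one to pass below `d` and one to bring `d′`
  -- down to 1; 2ε for comparing palette densities with `b` by way of `y`; and 5τ = 5ε/2 as the gap
  -- of `SparseColourable`. Half an `ε` remains.
  not-attainable : ∀ {d a b ε} → d ≤ℝ 1ℝ → 0ℚ <ℚ ε → ∃[ N ] (∀ n → N ≤ n → a ≤ℚ seq d n + ε) →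
    ∃[ N ] (∀ n → N ≤ n → seq y n ≤ℚ b + ε) → b + 7ℚ * ε ≤ℚ a → ¬ Attains d
  not-attainable {d} {a} {b} {ε} d≤1 0<ε (N₁ , a≤) (N₂ , ≤b) b≤a attainable = contradictory (attainable (fromℚ η) 0<η′ n₀)
    where
    open ℚ.≤-Reasoning
    d′ τ : ℚ
    d′ = a - 2ℚ * ε
    τ  = ½ * ε
    0<τ : 0ℚ <ℚ τ
    0<τ = 0<* (ℚ.positive⁻¹ ½) 0<ε
    0≤ε : 0ℚ ≤ℚ ε
    0≤ε = ℚ.<⇒≤ 0<ε
    d′≤d : ∀ n → N₁ ≤ n → d′ ≤ℚ seq d n
    d′≤d n N≤n = begin
      a - 2ℚ * ε               ≤⟨ ℚ.+-monoˡ-≤ (- (2ℚ * ε)) (a≤ n N≤n) ⟩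
      seq d n + ε - 2ℚ * ε     ≤⟨ ≤-offset ε 0≤ε (solve 2 (λ d e → d :+ e :- con 2ℚ :* e :+ e := d) refl (seq d n) ε) ⟩
      seq d n                  ∎
    sparse : ∀ x → Probability x → paletteDensity P x + (2ℚ + 3ℚ) * τ ≤ℚ d′
    sparse x x-prob = from (bounded x x-prob ε 0<ε)
      where
      D = paletteDensity P x
      from : ∃[ M ] (∀ n → M ≤ n → D ≤ℚ seq y n + ε) → D + (2ℚ + 3ℚ) * τ ≤ℚ d′
      from (M , below) = begin
        D + (2ℚ + 3ℚ) * τ
          ≤⟨ ℚ.+-monoˡ-≤ ((2ℚ + 3ℚ) * τ) (below (M ℕ.⊔ N₂) (ℕ.m≤m⊔n M N₂)) ⟩
        seq y (M ℕ.⊔ N₂) + ε + (2ℚ + 3ℚ) * τ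
          ≤⟨ ℚ.+-monoˡ-≤ ((2ℚ + 3ℚ) * τ) (ℚ.+-monoˡ-≤ ε (≤b (M ℕ.⊔ N₂) (ℕ.m≤n⊔m M N₂))) ⟩
        b + ε + ε + (2ℚ + 3ℚ) * τ
          ≤⟨ ≤-offset (½ * ε) (0≤* (ℚ.nonNegative⁻¹ ½) 0≤ε)
               (solve 2 (λ y e → y :+ e :+ e :+ (con 2ℚ :+ con 3ℚ) :* (con ½ :* e) :+ con ½ :* e := y :+ con 7ℚ :* e :- con 2ℚ :* e) refl b ε) ⟩
        b + 7ℚ * ε - 2ℚ * ε
          ≤⟨ ℚ.+-monoˡ-≤ (- (2ℚ * ε)) b≤a ⟩
        d′ ∎
    0≤d′ : ∃[ x ] Probability x × ∃[ N ] (∀ n → N ≤ n → seq y n ≤ℚ paletteDensity P x + 1ℚ) → 0ℚ ≤ℚ d′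
    0≤d′ (x , x-prob , _) = ℚ.≤-trans
      (0≤+ (proj₁ (paletteDensity-01 P x-prob)) (0≤* (0≤+ (ℚ.nonNegative⁻¹ 2ℚ) (ℚ.nonNegative⁻¹ 3ℚ)) (ℚ.<⇒≤ 0<τ))) (sparse x x-prob)
    d′≤1 : ∃[ M ] (∀ n → M ≤ n → seq d n ≤ℚ 1ℚ + ε) → d′ ≤ℚ 1ℚ
    d′≤1 (M , below) = begin
      a - 2ℚ * ε
        ≤⟨ ℚ.+-monoˡ-≤ (- (2ℚ * ε)) (a≤ (M ℕ.⊔ N₁) (ℕ.m≤n⊔m M N₁)) ⟩
      seq d (M ℕ.⊔ N₁) + ε - 2ℚ * ε
        ≤⟨ ℚ.+-monoˡ-≤ (- (2ℚ * ε)) (ℚ.+-monoˡ-≤ ε (below (M ℕ.⊔ N₁) (ℕ.m≤m⊔n M N₁))) ⟩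
      1ℚ + ε + ε - 2ℚ * ε
        ≡⟨ solve 1 (λ e → con 1ℚ :+ e :+ e :- con 2ℚ :* e := con 1ℚ) refl ε ⟩
      1ℚ ∎
    open SparseColourable P {d′} {τ} (0≤d′ (approached 1ℚ (ℚ.positive⁻¹ 1ℚ)) , d′≤1 (d≤1 ε 0<ε)) 0<τ sparse
    0<η′ : 0ℝ <ℝ fromℚ η
    0<η′ = η , 0<η , 0 , λ _ _ → ℚ.≤-reflexive (ℚ.+-identityˡ η)
    contradictory : Σ[ H ∈ 3-Graph ] (H IsFree Uncolourable P × UniformlyDense d (fromℚ η) H × n₀ ≤ order H) → ⊥
    contradictory (H , free , dense , n₀≤) = free⇒¬¬colourable free λ col →
      colourable-not-dense H col n₀≤ (dense-rational {d} {d′} {η} H dense (N₁ , d′≤d))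

  private
    ⅑ : ℚ
    ⅑ = + 1 / 9

  -- Real numbers admit no decidable comparison, so the rational approximations at one index `N` are
  -- compared instead. Seven ninths of `ε` are the allowance of `not-attainable`; the other two
  -- carry `d` and `y` between the indices `N` and `n`.
  y-bound : ∀ d → d ∈ AttainableDensity (Uncolourable P) → d ≤ℝ y
  y-bound d ((0≤d , d≤1) , attainable) ε 0<ε = N , λ n N≤n → cases (seq d N ℚ.≤? seq y N + 7ℚ * ε₁) n N≤n
    where
    open ℚ.≤-Reasoning
    ε₁ = ⅑ * ε
    0<ε₁ : 0ℚ <ℚ ε₁
    0<ε₁ = 0<* (ℚ.positive⁻¹ ⅑) 0<ε
    N₁ = proj₁ (cauchy d ε₁ 0<ε₁)
    N₂ = proj₁ (cauchy y ε₁ 0<ε₁)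
    N = N₁ ℕ.⊔ N₂
    d-close : ∀ m n → N ≤ m → N ≤ n → seq d m ≤ℚ seq d n + ε₁
    d-close m n N≤m N≤n = close⇒≤ (proj₂ (cauchy d ε₁ 0<ε₁) m n (ℕ.m⊔n≤o⇒m≤o N₁ N₂ N≤m) (ℕ.m⊔n≤o⇒m≤o N₁ N₂ N≤n))
    y-close : ∀ m n → N ≤ m → N ≤ n → seq y m ≤ℚ seq y n + ε₁
    y-close m n N≤m N≤n = close⇒≤ (proj₂ (cauchy y ε₁ 0<ε₁) m n (ℕ.m⊔n≤o⇒n≤o N₁ N₂ N≤m) (ℕ.m⊔n≤o⇒n≤o N₁ N₂ N≤n))
    cases : Dec (seq d N ≤ℚ seq y N + 7ℚ * ε₁) → ∀ n → N ≤ n → seq d n ≤ℚ seq y n + ε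
    cases (no d≰)  n N≤n = ⊥-elim (not-attainable {d} {seq d N} {seq y N} {ε₁} d≤1 0<ε₁
      (N , λ n N≤n → d-close N n ℕ.≤-refl N≤n) (N , λ n N≤n → y-close n N N≤n ℕ.≤-refl) (ℚ.<⇒≤ (ℚ.≰⇒> d≰)) attainable)
    cases (yes d≤) n N≤n = begin
      seq d n                        ≤⟨ d-close n N N≤n ℕ.≤-refl ⟩
      seq d N + ε₁                   ≤⟨ ℚ.+-monoˡ-≤ ε₁ d≤ ⟩
      seq y N + 7ℚ * ε₁ + ε₁         ≤⟨ ℚ.+-monoˡ-≤ ε₁ (ℚ.+-monoˡ-≤ (7ℚ * ε₁) (y-close N n ℕ.≤-refl N≤n)) ⟩
      seq y n + ε₁ + 7ℚ * ε₁ + ε₁    ≡⟨ solve 2 (λ y e → y :+ con ⅑ :* e :+ con 7ℚ :* (con ⅑ :* e) :+ con ⅑ :* e := y :+ e) refl (seq y n) ε ⟩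
      seq y n + ε                    ∎

  palette-π : Isπᵥᵥᵥ (Uncolourable P) y
  palette-π = y-bound , λ b upper → upper y y-attainable

-- The Lagrange polynomial along the approximating sequences

seq-sumℝ : ∀ {A : Set} (h : A → ℝ) xs n → seq (sumℝ (List.map h xs)) n ≡ ∑ᴸ (λ a → seq (h a) n) xs
seq-sumℝ h []       n = refl
seq-sumℝ h (x ∷ xs) n = cong₂ _+_ (refl {x = seq (h x) n}) (seq-sumℝ h xs n)

productᴸ : {A : Set} → (A → ℚ) → List A → ℚ
productᴸ f = List.foldr (λ x p → f x * p) 1ℚ

seq-productℝ : ∀ {A : Set} (h : A → ℝ) xs n → seq (productℝ (List.map h xs)) n ≡ productᴸ (λ a → seq (h a) n) xs
seq-productℝ h []       n = refl
seq-productℝ h (x ∷ xs) n = cong₂ _*_ (refl {x = seq (h x) n}) (seq-productℝ h xs n)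

opaque
  unfolding ∑

  ∑ᴸ-tabulate : ∀ {A : Set} (f : A → ℚ) (h : Fin n → A) → ∑ᴸ f (List.tabulate h) ≡ ∑ (f ∘ h)
  ∑ᴸ-tabulate {ℕ.zero}  f h = refl
  ∑ᴸ-tabulate {ℕ.suc n} f h = cong₂ _+_ (refl {x = f (h zero)}) (∑ᴸ-tabulate f (h ∘ suc))

private
  mono-select : (Fin n → Bool) → (Fin n → ℚ) → ℚ
  mono-select {ℕ.zero}  b z = 1ℚ
  mono-select {ℕ.suc n} b z = (if b zero then z zero * mono-select (b ∘ suc) (z ∘ suc) else mono-select (b ∘ suc) (z ∘ suc))

  productᴸ-filter : ∀ {A : Set} {Q : Pred A 0ℓ} (Q? : ∀ a → Dec (Q a)) (f : A → ℚ) (h : Fin n → A) →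
    productᴸ f (List.filter Q? (List.tabulate h)) ≡ mono-select (does ∘ Q? ∘ h) (f ∘ h)
  productᴸ-filter {ℕ.zero}  Q? f h = refl
  productᴸ-filter {ℕ.suc n} Q? f h with does (Q? (h zero))
  ... | true  = cong (f (h zero) *_) (productᴸ-filter Q? f (h ∘ suc))
  ... | false = productᴸ-filter Q? f (h ∘ suc)

  mono-select-∈ : ∀ (e : Subset n) z → mono-select (λ i → does (i Subset.∈? e)) z ≡ mono z e
  mono-select-∈ []            z = refl
  mono-select-∈ (inside ∷ e)  z = cong (z zero *_) (mono-select-∈ e (z ∘ suc))
  mono-select-∈ (outside ∷ e) z = mono-select-∈ e (z ∘ suc)

seq-lagrangePolynomial : ∀ F x n → seq (lagrangePolynomial F x) n ≡ 6ℚ * edgePolynomial F (λ i → seq (x i) n)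
seq-lagrangePolynomial F x n = cong (6ℚ *_) (begin
  seq (sumℝ (List.map (λ e → productℝ (List.map x (elements e))) (edges F))) n
    ≡⟨ seq-sumℝ (λ e → productℝ (List.map x (elements e))) (edges F) n ⟩
  ∑ᴸ (λ e → seq (productℝ (List.map x (elements e))) n) (edges F)
    ≡⟨ List.foldr-cong (λ e s → cong (_+ s) (trans (seq-productℝ x (elements e) n)
         (trans (productᴸ-filter (Subset._∈? e) z id) (mono-select-∈ e z)))) refl (edges F) ⟩
  ∑ᴸ (mono z) (edges F)
    ≡⟨ ∑-edges F z ⟩
  edgePolynomial F z ∎)
  where
  open ≡-Reasoning
  z : Fin (order F) → ℚ
  z i = seq (x i) n

t/6*6 : ∀ {t} → t ≤ 6 → (+ t / 6) * 6ℚ ≡ natℚ t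
t/6*6 {0} _ = sym (natℚ-def 0)
t/6*6 {1} _ = sym (natℚ-def 1)
t/6*6 {2} _ = sym (natℚ-def 2)
t/6*6 {3} _ = sym (natℚ-def 3)
t/6*6 {4} _ = sym (natℚ-def 4)
t/6*6 {5} _ = sym (natℚ-def 5)
t/6*6 {6} _ = sym (natℚ-def 6)
t/6*6 {ℕ.suc (ℕ.suc (ℕ.suc (ℕ.suc (ℕ.suc (ℕ.suc (ℕ.suc _))))))} (ℕ.s≤s (ℕ.s≤s (ℕ.s≤s (ℕ.s≤s (ℕ.s≤s (ℕ.s≤s ()))))))

t/6∈ : ∀ {t} → t ≤ 6 → In01 (+ t / 6)
t/6∈ {t} t≤6 = *-cancelˡ-≤ 0<6 (subst₂ _≤ℚ_ (sym (ℚ.*-zeroʳ 6ℚ)) (sym 6t≡) (0≤nat t)) ,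
               *-cancelˡ-≤ 0<6 (subst₂ _≤ℚ_ (sym 6t≡) (trans (natℚ-def 6) (sym (ℚ.*-identityʳ 6ℚ))) (natℚ-mono t≤6))
  where
  0<6 : 0ℚ <ℚ 6ℚ
  0<6 = ℚ.positive⁻¹ 6ℚ
  6t≡ : 6ℚ * (+ t / 6) ≡ natℚ t
  6t≡ = trans (ℚ.*-comm 6ℚ (+ t / 6)) (t/6*6 t≤6)

orderedPalette-lagrange : ∀ {t} → t ≤ 6 → ∀ F x n →
  (+ t / 6) * seq (lagrangePolynomial F x) n ≡ paletteDensity (orderedPalette t F) (λ i → seq (x i) n)
orderedPalette-lagrange {t} t≤6 F x n = begin
  (+ t / 6) * seq (lagrangePolynomial F x) n     ≡⟨ cong ((+ t / 6) *_) (seq-lagrangePolynomial F x n) ⟩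
  (+ t / 6) * (6ℚ * edgePolynomial F z)          ≡⟨ ℚ.*-assoc (+ t / 6) 6ℚ (edgePolynomial F z) ⟨
  (+ t / 6) * 6ℚ * edgePolynomial F z            ≡⟨ cong (_* edgePolynomial F z) (t/6*6 t≤6) ⟩
  natℚ t * edgePolynomial F z                    ≡⟨ orderedPalette-density t≤6 F z ⟨
  paletteDensity (orderedPalette t F) z          ∎
  where
  open ≡-Reasoning
  z : Fin (order F) → ℚ
  z i = seq (x i) n

-- Rational approximation of points of the simplex

∣p∣≤p+2δ : ∀ {p δ} → 0ℚ ≤ℚ p + δ → 0ℚ ≤ℚ δ → ℚ.∣ p ∣ ≤ℚ p + 2ℚ * δ
∣p∣≤p+2δ {p} {δ} 0≤p+δ 0≤δ with ℚ.∣p∣≡p∨∣p∣≡-p p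
... | inj₁ eq = subst (_≤ℚ p + 2ℚ * δ) (sym eq) (≤-offset (2ℚ * δ) (0≤* (ℚ.nonNegative⁻¹ 2ℚ) 0≤δ) refl)
... | inj₂ eq = subst (_≤ℚ p + 2ℚ * δ) (sym eq) (≤-offset (2ℚ * (p + δ)) (0≤* (ℚ.nonNegative⁻¹ 2ℚ) 0≤p+δ)
    (solve 2 (λ p δ → (:- p) :+ con 2ℚ :* (p :+ δ) := p :+ con 2ℚ :* δ) refl p δ))

paletteDensity-∣∣ : ∀ (P : Palette r) x → paletteDensity P x ≤ℚ paletteDensity P (λ a → ℚ.∣ x a ∣)
paletteDensity-∣∣ P x = ∑³-mono λ a b c → *-monoˡ (0≤𝟙 (P a b c)) (ℚ.≤-trans (p≤∣p∣ (x a * (x b * x c)))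
  (ℚ.≤-reflexive (trans (ℚ.∣p*q∣≡∣p∣*∣q∣ (x a) (x b * x c)) (cong (ℚ.∣ x a ∣ *_) (ℚ.∣p*q∣≡∣p∣*∣q∣ (x b) (x c))))))

paletteDensity-mono : ∀ (P : Palette r) {x y} → (∀ a → 0ℚ ≤ℚ x a) → (∀ a → x a ≤ℚ y a) → paletteDensity P x ≤ℚ paletteDensity P y
paletteDensity-mono P {x} {y} 0≤x x≤y = ∑³-mono λ a b c → *-monoˡ (0≤𝟙 (P a b c))
  (*-mono (0≤x a) (0≤* (0≤y b) (0≤y c)) (x≤y a) (*-mono (0≤x b) (0≤y c) (x≤y b) (x≤y c)))
  where
  0≤y : ∀ a → 0ℚ ≤ℚ y a
  0≤y a = ℚ.≤-trans (0≤x a) (x≤y a)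

-- With x = z/∑z one has z a = ∑z · x a ≤ (1 + ε) x a, and x a ≤ 1.
normalise : ∀ (z : Fin r → ℚ) {ε} → (∀ a → 0ℚ ≤ℚ z a) → 0ℚ <ℚ ∑ z → ∑ z ≤ℚ 1ℚ + ε → 0ℚ ≤ℚ ε →
  ∃[ x ] Probability x × (∀ a → z a ≤ℚ x a + ε)
normalise z {ε} 0≤z 0<∑z ∑z≤ 0≤ε = from (reciprocal 0<∑z)
  where
  from : ∃[ s ] 0ℚ <ℚ s × ∑ z * s ≡ 1ℚ → ∃[ x ] Probability x × (∀ a → z a ≤ℚ x a + ε)
  from (s , 0<s , ∑z*s≡1) = x , x-prob , z≤
    where
    open ℚ.≤-Reasoning
    x : Fin _ → ℚ
    x a = s * z a
    x-prob : Probability x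
    x-prob = probability (λ a → 0≤* (ℚ.<⇒≤ 0<s) (0≤z a)) (trans (∑-pull s z) (trans (ℚ.*-comm s (∑ z)) ∑z*s≡1))
    z≤ : ∀ a → z a ≤ℚ x a + ε
    z≤ a = begin
      z a                    ≡⟨ trans (sym (ℚ.*-identityˡ (z a))) (cong (_* z a) (sym ∑z*s≡1)) ⟩
      ∑ z * s * z a          ≡⟨ ℚ.*-assoc (∑ z) s (z a) ⟩
      ∑ z * x a              ≤⟨ *-monoʳ (Probability.nonNegative x-prob a) ∑z≤ ⟩
      (1ℚ + ε) * x a         ≡⟨ solve 2 (λ e x → (con 1ℚ :+ e) :* x := x :+ e :* x) refl ε (x a) ⟩
      x a + ε * x a          ≤⟨ ℚ.+-monoʳ-≤ (x a) (ℚ.≤-trans (*-monoˡ 0≤ε (proj₂ (Probability⇒01 x-prob a))) (ℚ.≤-reflexive (ℚ.*-identityʳ ε))) ⟩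
      x a + ε                ∎

-- A term of the sequences approximating a simplex point may have slightly negative coordinates and
-- a total slightly off one. Absolute values repair the signs at a cost of 2δ per coordinate, so the
-- total is at most 1 + (1 + 2r)δ = 1 + δ′; normalising then lowers each coordinate by at most δ′.
simplex-rational : ∀ {r} (P : Palette r) ε → 0ℚ <ℚ ε → ∃[ δ ] 0ℚ <ℚ δ × (∀ (z : Fin r → ℚ) →
  (∀ a → 0ℚ ≤ℚ z a + δ) → 1ℚ ≤ℚ ∑ z + δ → ∑ z ≤ℚ 1ℚ + δ → ∃[ x ] Probability x × paletteDensity P z ≤ℚ paletteDensity P x + ε)
simplex-rational {r} P ε 0<ε = from (archimedean* (r³ 7ℚ) 0<ε)
  where
  open ℚ.≤-Reasoning
  r³ : ℚ → ℚ
  r³ z = natℚ r * (natℚ r * (natℚ r * z))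
  from : ∃[ M ] r³ 7ℚ ≤ℚ natℚ M * ε → _
  from (M , large) = from′ (reciprocal 0<2+M) (reciprocal 0<1+2r)
    where
    -- The summand 2 gives δ′ ≤ 1/2, which keeps the total positive; `M` brings the shift error
    -- 7r³δ′ below `ε`.
    0<2+M : 0ℚ <ℚ 2ℚ + natℚ M
    0<2+M = ℚ.+-mono-<-≤ (ℚ.positive⁻¹ 2ℚ) (0≤nat M)
    0<1+2r : 0ℚ <ℚ 1ℚ + 2ℚ * natℚ r
    0<1+2r = ℚ.+-mono-<-≤ (ℚ.positive⁻¹ 1ℚ) (0≤* (ℚ.nonNegative⁻¹ 2ℚ) (0≤nat r))
    from′ : ∃[ δ′ ] 0ℚ <ℚ δ′ × (2ℚ + natℚ M) * δ′ ≡ 1ℚ → ∃[ s ] 0ℚ <ℚ s × (1ℚ + 2ℚ * natℚ r) * s ≡ 1ℚ → _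
    from′ (δ′ , 0<δ′ , [2+M]δ′≡1) (s , 0<s , [1+2r]s≡1) = δ , 0<δ , approximate
      where
      δ : ℚ
      δ = δ′ * s
      0<δ : 0ℚ <ℚ δ
      0<δ = 0<* 0<δ′ 0<s
      0≤δ : 0ℚ ≤ℚ δ
      0≤δ = ℚ.<⇒≤ 0<δ
      [1+2r]δ≡δ′ : (1ℚ + 2ℚ * natℚ r) * δ ≡ δ′
      [1+2r]δ≡δ′ = trans (solve 3 (λ k d s → k :* (d :* s) := d :* (k :* s)) refl (1ℚ + 2ℚ * natℚ r) δ′ s)
        (trans (cong (δ′ *_) [1+2r]s≡1) (ℚ.*-identityʳ δ′))
      δ≤δ′ : δ ≤ℚ δ′
      δ≤δ′ = ≤-offset (2ℚ * natℚ r * δ) (0≤* (0≤* (ℚ.nonNegative⁻¹ 2ℚ) (0≤nat r)) 0≤δ)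
        (trans (solve 2 (λ r d → d :+ con 2ℚ :* r :* d := (con 1ℚ :+ con 2ℚ :* r) :* d) refl (natℚ r) δ) [1+2r]δ≡δ′)
      2δ′≤1 : 2ℚ * δ′ ≤ℚ 1ℚ
      2δ′≤1 = ≤-offset (natℚ M * δ′) (0≤* (0≤nat M) (ℚ.<⇒≤ 0<δ′))
        (trans (solve 2 (λ M d → con 2ℚ :* d :+ M :* d := (con 2ℚ :+ M) :* d) refl (natℚ M) δ′) [2+M]δ′≡1)
      δ′∈ : In01 δ′
      δ′∈ = ℚ.<⇒≤ 0<δ′ , ℚ.≤-trans (≤-offset δ′ (ℚ.<⇒≤ 0<δ′) (solve 1 (λ d → d :+ d := con 2ℚ :* d) refl δ′)) 2δ′≤1
      r³7δ′≤ε : r³ (7ℚ * δ′) ≤ℚ ε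
      r³7δ′≤ε = begin
        r³ (7ℚ * δ′)
          ≡⟨ solve 2 (λ r d → r :* (r :* (r :* (con 7ℚ :* d))) := r :* (r :* (r :* con 7ℚ)) :* d) refl (natℚ r) δ′ ⟩
        r³ 7ℚ * δ′
          ≤⟨ *-monoʳ (ℚ.<⇒≤ 0<δ′) large ⟩
        natℚ M * ε * δ′
          ≤⟨ ≤-offset (2ℚ * ε * δ′) (0≤* (0≤* (ℚ.nonNegative⁻¹ 2ℚ) (ℚ.<⇒≤ 0<ε)) (ℚ.<⇒≤ 0<δ′))
               (solve 3 (λ M e d → M :* e :* d :+ con 2ℚ :* e :* d := e :* ((con 2ℚ :+ M) :* d)) refl (natℚ M) ε δ′) ⟩
        ε * ((2ℚ + natℚ M) * δ′)
          ≡⟨ trans (cong (ε *_) [2+M]δ′≡1) (ℚ.*-identityʳ ε) ⟩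
        ε ∎
      approximate : ∀ (z : Fin r → ℚ) → (∀ a → 0ℚ ≤ℚ z a + δ) → 1ℚ ≤ℚ ∑ z + δ → ∑ z ≤ℚ 1ℚ + δ →
        ∃[ x ] Probability x × paletteDensity P z ≤ℚ paletteDensity P x + ε
      approximate z 0≤z+δ 1≤∑z+δ ∑z≤1+δ = finish (normalise ∣z∣ (λ a → ℚ.0≤∣p∣ (z a)) 0<∑∣z∣ ∑∣z∣≤ (proj₁ δ′∈))
        where
        ∣z∣ : Fin r → ℚ
        ∣z∣ a = ℚ.∣ z a ∣
        0<∑∣z∣ : 0ℚ <ℚ ∑ ∣z∣
        0<∑∣z∣ = ℚ.<-≤-trans 0<δ′ (begin
          δ′              ≡⟨ solve 1 (λ d → d := con 2ℚ :* d :- d) refl δ′ ⟩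
          2ℚ * δ′ - δ′    ≤⟨ ℚ.+-mono-≤ 2δ′≤1 (ℚ.neg-antimono-≤ δ≤δ′) ⟩
          1ℚ - δ          ≤⟨ ℚ.+-monoˡ-≤ (- δ) 1≤∑z+δ ⟩
          ∑ z + δ - δ     ≡⟨ solve 2 (λ z d → z :+ d :- d := z) refl (∑ z) δ ⟩
          ∑ z             ≤⟨ ∑-mono (λ a → p≤∣p∣ (z a)) ⟩
          ∑ ∣z∣           ∎)
        ∑∣z∣≤ : ∑ ∣z∣ ≤ℚ 1ℚ + δ′
        ∑∣z∣≤ = begin
          ∑ ∣z∣                          ≤⟨ ∑-mono (λ a → ∣p∣≤p+2δ (0≤z+δ a) 0≤δ) ⟩
          ∑ (λ a → z a + 2ℚ * δ)         ≡⟨ trans (∑-+ z (λ _ → 2ℚ * δ)) (cong₂ _+_ (refl {x = ∑ z}) (∑-const r (2ℚ * δ))) ⟩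
          ∑ z + natℚ r * (2ℚ * δ)        ≤⟨ ℚ.+-monoˡ-≤ (natℚ r * (2ℚ * δ)) ∑z≤1+δ ⟩
          1ℚ + δ + natℚ r * (2ℚ * δ)     ≡⟨ solve 2 (λ d r → con 1ℚ :+ d :+ r :* (con 2ℚ :* d) := con 1ℚ :+ (con 1ℚ :+ con 2ℚ :* r) :* d) refl δ (natℚ r) ⟩
          1ℚ + (1ℚ + 2ℚ * natℚ r) * δ    ≡⟨ cong (λ w → 1ℚ + w) [1+2r]δ≡δ′ ⟩
          1ℚ + δ′                        ∎
        finish : ∃[ x ] Probability x × (∀ a → ∣z∣ a ≤ℚ x a + δ′) → ∃[ x ] Probability x × paletteDensity P z ≤ℚ paletteDensity P x + ε
        finish (x , x-prob , ∣z∣≤) = x , x-prob , (begin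
          paletteDensity P z                           ≤⟨ paletteDensity-∣∣ P z ⟩
          paletteDensity P ∣z∣                         ≤⟨ paletteDensity-mono P (λ a → ℚ.0≤∣p∣ (z a)) ∣z∣≤ ⟩
          paletteDensity P (λ a → x a + δ′)            ≤⟨ paletteDensity-shift P (Probability⇒01 x-prob) δ′∈ ⟩
          paletteDensity P x + r³ (7ℚ * δ′)            ≤⟨ ℚ.+-monoʳ-≤ (paletteDensity P x) r³7δ′≤ε ⟩
          paletteDensity P x + ε                       ∎)

-- The Lagrangian as a supremum over rational points

eventually-all : ∀ {Q : Fin r → ℕ → Set} → (∀ a → ∃[ N ] (∀ n → N ≤ n → Q a n)) → ∃[ N ] (∀ n → N ≤ n → ∀ a → Q a n)
eventually-all {ℕ.zero}  ev = 0 , λ _ _ ()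
eventually-all {ℕ.suc r} ev with ev zero | eventually-all (ev ∘ suc)
... | N₁ , h₁ | N₂ , h₂ = N₁ ℕ.⊔ N₂ , λ where
  n N≤n zero    → h₁ n (ℕ.m⊔n≤o⇒m≤o N₁ N₂ N≤n)
  n N≤n (suc a) → h₂ n (ℕ.m⊔n≤o⇒n≤o N₁ N₂ N≤n) a

seq-sum-all : ∀ (x : Fin r → ℝ) n → seq (sumℝ (List.map x (allFin r))) n ≡ ∑ (λ a → seq (x a) n)
seq-sum-all {r} x n = trans (seq-sumℝ x (allFin r) n) (∑ᴸ-tabulate (λ a → seq (x a) n) id)

module _ {t} (t≤6 : t ≤ 6) (F : 3-Graph) {Λ y : ℝ} (lagrangian : IsLagrangian F Λ) (y≃ : y ≃ℝ fromℚ (+ t / 6) *ℝ Λ) where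

  private
    P = orderedPalette t F
    T′ = + t / 6

    scaled≤ : ∀ {a b} ε → 0ℚ <ℚ ε → a ≤ℚ b + ε → T′ * a ≤ℚ T′ * b + ε
    scaled≤ {a} {b} ε 0<ε a≤ = begin
      T′ * a              ≤⟨ *-monoˡ (proj₁ (t/6∈ t≤6)) a≤ ⟩
      T′ * (b + ε)        ≡⟨ ℚ.*-distribˡ-+ T′ b ε ⟩
      T′ * b + T′ * ε     ≤⟨ ℚ.+-monoʳ-≤ (T′ * b) (ℚ.≤-trans (*-monoʳ (ℚ.<⇒≤ 0<ε) (proj₂ (t/6∈ t≤6))) (ℚ.≤-reflexive (ℚ.*-identityˡ ε))) ⟩
      T′ * b + ε          ∎
      where open ℚ.≤-Reasoning

  -- Constant sequences turn a rational point into a real point of the simplex, to which the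
  -- maximality of `Λ` applies.
  lagrangian-bounded : ∀ x → Probability x → ∀ ε → 0ℚ <ℚ ε → ∃[ N ] (∀ n → N ≤ n → paletteDensity P x ≤ℚ seq y n + ε)
  lagrangian-bounded x x-prob ε 0<ε = from (proj₂ lagrangian X X∈ ε₁ 0<ε₁) (proj₂ y≃ ε₁ 0<ε₁)
    where
    open ℚ.≤-Reasoning
    ε₁ : ℚ
    ε₁ = ½ * ε
    0<ε₁ : 0ℚ <ℚ ε₁
    0<ε₁ = 0<* (ℚ.positive⁻¹ ½) 0<ε
    X : Fin (order F) → ℝ
    X a = fromℚ (x a)
    ∑X≡1 : ∀ n → seq (sumℝ (List.map X (allFin (order F)))) n ≡ 1ℚ
    ∑X≡1 n = trans (seq-sum-all X n) (Probability.mass x-prob)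
    ≤+ : ∀ {p q ε} → 0ℚ <ℚ ε → p ≤ℚ q → p ≤ℚ q + ε
    ≤+ {q = q} {ε} 0<ε p≤q = ℚ.≤-trans p≤q (≤-offset ε (ℚ.<⇒≤ 0<ε) refl)
    X∈ : X ∈ Simplex (order F)
    X∈ = (λ a → (λ ε 0<ε → 0 , λ _ _ → ≤+ 0<ε (Probability.nonNegative x-prob a)) ,
                (λ ε 0<ε → 0 , λ _ _ → ≤+ 0<ε (proj₂ (Probability⇒01 x-prob a)))) ,
         (λ ε 0<ε → 0 , λ n _ → ≤+ 0<ε (ℚ.≤-reflexive (∑X≡1 n))) ,
         (λ ε 0<ε → 0 , λ n _ → ≤+ 0<ε (ℚ.≤-reflexive (sym (∑X≡1 n))))
    from : ∃[ N ] (∀ n → N ≤ n → seq (lagrangePolynomial F X) n ≤ℚ seq Λ n + ε₁) →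
      ∃[ N ] (∀ n → N ≤ n → T′ * seq Λ n ≤ℚ seq y n + ε₁) → ∃[ N ] (∀ n → N ≤ n → paletteDensity P x ≤ℚ seq y n + ε)
    from (N₁ , λ≤Λ) (N₂ , Λ≤y) = N₁ ℕ.⊔ N₂ , λ n N≤n → begin
      paletteDensity P x                       ≡⟨ orderedPalette-lagrange t≤6 F X n ⟨
      T′ * seq (lagrangePolynomial F X) n      ≤⟨ scaled≤ ε₁ 0<ε₁ (λ≤Λ n (ℕ.m⊔n≤o⇒m≤o N₁ N₂ N≤n)) ⟩
      T′ * seq Λ n + ε₁                        ≤⟨ ℚ.+-monoˡ-≤ ε₁ (Λ≤y n (ℕ.m⊔n≤o⇒n≤o N₁ N₂ N≤n)) ⟩
      seq y n + ε₁ + ε₁                        ≡⟨ solve 2 (λ y e → y :+ con ½ :* e :+ con ½ :* e := y :+ e) refl (seq y n) ε ⟩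
      seq y n + ε                              ∎

  -- The maximiser has real coordinates. One late term of each of their sequences gives a rational
  -- vector close to the simplex, which `simplex-rational` corrects.
  lagrangian-approached : ∀ ε → 0ℚ <ℚ ε → ∃[ x ] Probability x × ∃[ N ] (∀ n → N ≤ n → seq y n ≤ℚ paletteDensity P x + ε)
  lagrangian-approached ε 0<ε = from (proj₁ lagrangian) (simplex-rational P ε₁ 0<ε₁)
    where
    open ℚ.≤-Reasoning
    -- A quarter for each of four errors: moving `y` from index `n` to `N`, passing from `y` to the
    -- multiple of `Λ`, from `Λ` to the polynomial at `X`, and correcting `z` to a point of the
    -- simplex.
    ε₁ : ℚ
    ε₁ = (½ * ½) * ε
    0<ε₁ : 0ℚ <ℚ ε₁
    0<ε₁ = 0<* (ℚ.positive⁻¹ (½ * ½)) 0<ε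
    Goal : Set
    Goal = ∃[ x ] Probability x × ∃[ N ] (∀ n → N ≤ n → seq y n ≤ℚ paletteDensity P x + ε)
    from : Σ[ X ∈ (Fin (order F) → ℝ) ] (X ∈ Simplex (order F) × lagrangePolynomial F X ≃ℝ Λ) →
      ∃[ δ ] 0ℚ <ℚ δ × (∀ (z : Fin (order F) → ℚ) → (∀ a → 0ℚ ≤ℚ z a + δ) → 1ℚ ≤ℚ ∑ z + δ → ∑ z ≤ℚ 1ℚ + δ →
        ∃[ x ] Probability x × paletteDensity P z ≤ℚ paletteDensity P x + ε₁) → Goal
    from (X , (X∈ , (∑X≤1 , 1≤∑X)) , (_ , Λ≤λ)) (δ , 0<δ , approximate) =
      at (eventually-all λ a → proj₁ (X∈ a) δ 0<δ) (∑X≤1 δ 0<δ) (1≤∑X δ 0<δ) (Λ≤λ ε₁ 0<ε₁) (proj₁ y≃ ε₁ 0<ε₁) (cauchy y ε₁ 0<ε₁)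
      where
      at : ∃[ N ] (∀ n → N ≤ n → ∀ a → 0ℚ ≤ℚ seq (X a) n + δ) →
        ∃[ N ] (∀ n → N ≤ n → seq (sumℝ (List.map X (allFin (order F)))) n ≤ℚ 1ℚ + δ) →
        ∃[ N ] (∀ n → N ≤ n → 1ℚ ≤ℚ seq (sumℝ (List.map X (allFin (order F)))) n + δ) →
        ∃[ N ] (∀ n → N ≤ n → seq Λ n ≤ℚ seq (lagrangePolynomial F X) n + ε₁) →
        ∃[ N ] (∀ n → N ≤ n → seq y n ≤ℚ T′ * seq Λ n + ε₁) →
        ∃[ N ] (∀ m n → N ≤ m → N ≤ n → ℚ.∣ seq y m - seq y n ∣ <ℚ ε₁) → Goal
      at (N₁ , h₁) (N₂ , h₂) (N₃ , h₃) (N₄ , h₄) (N₅ , h₅) (N₆ , h₆) = finish (approximate z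
          (h₁ N N₁≤) (subst (λ s → 1ℚ ≤ℚ s + δ) (seq-sum-all X N) (h₃ N N₃≤)) (subst (_≤ℚ 1ℚ + δ) (seq-sum-all X N) (h₂ N N₂≤)))
        where
        N = (N₁ ℕ.⊔ N₂) ℕ.⊔ ((N₃ ℕ.⊔ N₄) ℕ.⊔ (N₅ ℕ.⊔ N₆))
        N₁₂≤ = ℕ.m≤m⊔n (N₁ ℕ.⊔ N₂) ((N₃ ℕ.⊔ N₄) ℕ.⊔ (N₅ ℕ.⊔ N₆))
        N₃₋₆≤ = ℕ.m≤n⊔m (N₁ ℕ.⊔ N₂) ((N₃ ℕ.⊔ N₄) ℕ.⊔ (N₅ ℕ.⊔ N₆))
        N₃₄≤ = ℕ.≤-trans (ℕ.m≤m⊔n (N₃ ℕ.⊔ N₄) (N₅ ℕ.⊔ N₆)) N₃₋₆≤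
        N₅₆≤ = ℕ.≤-trans (ℕ.m≤n⊔m (N₃ ℕ.⊔ N₄) (N₅ ℕ.⊔ N₆)) N₃₋₆≤
        N₁≤ = ℕ.m⊔n≤o⇒m≤o N₁ N₂ N₁₂≤
        N₂≤ = ℕ.m⊔n≤o⇒n≤o N₁ N₂ N₁₂≤
        N₃≤ = ℕ.m⊔n≤o⇒m≤o N₃ N₄ N₃₄≤
        N₄≤ = ℕ.m⊔n≤o⇒n≤o N₃ N₄ N₃₄≤
        N₅≤ = ℕ.m⊔n≤o⇒m≤o N₅ N₆ N₅₆≤
        N₆≤ = ℕ.m⊔n≤o⇒n≤o N₅ N₆ N₅₆≤
        z : Fin (order F) → ℚ
        z a = seq (X a) N
        finish : ∃[ x ] Probability x × paletteDensity P z ≤ℚ paletteDensity P x + ε₁ → Goal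
        finish (x , x-prob , z≤) = x , x-prob , N₆ , λ n N₆≤n → begin
          seq y n
            ≤⟨ close⇒≤ (h₆ n N N₆≤n N₆≤) ⟩
          seq y N + ε₁
            ≤⟨ ℚ.+-monoˡ-≤ ε₁ (h₅ N N₅≤) ⟩
          T′ * seq Λ N + ε₁ + ε₁
            ≤⟨ ℚ.+-monoˡ-≤ ε₁ (ℚ.+-monoˡ-≤ ε₁ (scaled≤ ε₁ 0<ε₁ (h₄ N N₄≤))) ⟩
          T′ * seq (lagrangePolynomial F X) N + ε₁ + ε₁ + ε₁
            ≡⟨ cong (λ w → w + ε₁ + ε₁ + ε₁) (orderedPalette-lagrange t≤6 F X N) ⟩
          paletteDensity P z + ε₁ + ε₁ + ε₁
            ≤⟨ ℚ.+-monoˡ-≤ ε₁ (ℚ.+-monoˡ-≤ ε₁ (ℚ.+-monoˡ-≤ ε₁ z≤)) ⟩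
          paletteDensity P x + ε₁ + ε₁ + ε₁ + ε₁
            ≡⟨ solve 2 (λ p e → let f = (con ½ :* con ½) :* e in p :+ f :+ f :+ f :+ f := p :+ e) refl (paletteDensity P x) ε ⟩
          paletteDensity P x + ε ∎

theorem1p2 : (t : ℕ) → 1 ≤ t → t ≤ 6 → (fromℚ (+ t / 6) · Λ⁽³⁾) ⊆ Πᵥᵥᵥ,∞
theorem1p2 t _ t≤6 {y} (Λ , (F , lagrangian) , y≃) = Uncolourable (orderedPalette t F) ,
  palette-π (orderedPalette t F) y (lagrangian-approached t≤6 F {Λ} {y} lagrangian y≃) (lagrangian-bounded t≤6 F {Λ} {y} lagrangian y≃)
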